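{- As $n \to \infty$, \[\operatorname{ssp}(K_n) = (1 + o(1))n.\]
   Context: For a graph $G$, a family $\mathcal{P}$ of paths in $G$ is strong-separating if for every ordered pair of distinct edges $e,f$ of $G$ there is a path in $\mathcal{P}$ containing $e$ but not $f$. $\operatorname{ssp}(G)$ denotes the minimum size of a strong-separating family of paths in $G$. $K_n$ is the complete graph on $n$ vertices. -}

module Defs where

open import Data.Empty using (⊥-elim)
open import Data.Fin.Base using (Fin; zero; suc; toℕ; fromℕ<)
open import Data.Fin.Properties using (any?; all?; toℕ-fromℕ<; injective⇒≤) renaming (_≟_ to _≟ᶠ_)
open import Data.Integer.Base using (+_)
open import Data.List.Base using (List; []; _∷_; length; lookup; map; filter; allFin; cartesianProduct)
open import Data.List.Properties using (≡-dec)
open import Data.List.Membership.Propositional using (_∈_; lose)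
open import Data.List.Membership.Propositional.Properties
  using (∈-allFin; ∈-cartesianProduct⁺; ∈-filter⁺; ∈-filter⁻; ∈-map⁺; ∈-lookup)
open import Data.List.Relation.Unary.All as All using (All; []; _∷_)
import Data.List.Relation.Unary.All.Properties as All
open import Data.List.Relation.Unary.AllPairs using ([]; _∷_)
open import Data.List.Relation.Unary.Any as Any using (Any)
open import Data.List.Relation.Unary.Linked using (Linked; [-]; _∷_; linked?)
open import Data.List.Relation.Unary.Unique.Propositional using (Unique)
import Data.List.Relation.Unary.Unique.DecPropositional as DecUnique
open import Data.List.Relation.Binary.Infix.Heterogeneous using (Infix; here; there)
open import Data.List.Relation.Binary.Infix.Heterogeneous.Properties using (infix?)
open import Data.List.Relation.Binary.Prefix.Heterogeneous using ([]; _∷_)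
open import Data.Nat.Base using (ℕ; zero; suc; _≤_; _≥_; z≤n; s≤s)
open import Data.Nat.Properties using (suc-injective)
open import Data.Product.Base using (∃; ∃-syntax; _×_; _,_; proj₁; proj₂; uncurry)
open import Data.Rational.Base using (ℚ; 0ℚ; _/_; ∣_∣) renaming (_<_ to _<ℚ_)
open import Data.Sum.Base using (_⊎_; inj₁; inj₂)
open import Function.Base using (_∘_)
open import Level using (0ℓ)
open import Relation.Binary.Core using (Rel)
import Relation.Binary.Definitions as B
open import Relation.Binary.PropositionalEquality using (_≡_; _≢_; refl; sym; cong; subst; ≢-sym)
open import Relation.Nullary.Decidable using (Dec; yes; no; map′; ¬?; _×-dec_; _⊎-dec_; _→-dec_)
open import Relation.Nullary.Negation using (¬_)
open import Relation.Unary using (Pred; Decidable)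

------------------------------------------------------------------------
-- Graphs, edges, paths

record Graph : Set₁ where
  field
    order   : ℕ
    Adj     : Rel (Fin order) 0ℓ
    adj?    : B.Decidable Adj
    adj-sym : B.Symmetric Adj
    irrefl  : ∀ {u} → ¬ Adj u u

  Vertex : Set
  Vertex = Fin order

K : ℕ → Graph
K n = record
  { order   = n
  ; Adj     = _≢_
  ; adj?    = λ u v → ¬? (u ≟ᶠ v)
  ; adj-sym = ≢-sym
  ; irrefl  = λ u≢u → u≢u refl
  }

module _ (G : Graph) where
  open Graph G

  -- An edge is an unordered pair: it is given by its ends in some order, and
  -- two edges are identified by _≈ₑ_, not by _≡_.
  record Edge : Set where
    constructor edge
    field
      end₁ end₂ : Vertex
      adjacent  : Adj end₁ end₂

  record IsPath (p : List Vertex) : Set where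
    constructor isPath
    field
      nonEmpty : p ≢ []
      distinct : Unique p
      linked   : Linked Adj p

module _ {G : Graph} where
  open Graph G
  open Edge

  infix 4 _≈ₑ_ _∈ₑ_

  _≈ₑ_ : Rel (Edge G) 0ℓ
  e ≈ₑ f = (end₁ e ≡ end₁ f × end₂ e ≡ end₂ f)
         ⊎ (end₁ e ≡ end₂ f × end₂ e ≡ end₁ f)

  -- The ends of e occur consecutively, in either order, in p.
  _∈ₑ_ : Edge G → List Vertex → Set
  e ∈ₑ p = Infix _≡_ (end₁ e ∷ end₂ e ∷ []) p
         ⊎ Infix _≡_ (end₂ e ∷ end₁ e ∷ []) p

------------------------------------------------------------------------
-- Strong-separating families

-- Families are lists. A list may repeat a path, which does not affect the
-- minimum size.
record IsStrongSeparating (G : Graph) (𝒫 : List (List (Graph.Vertex G))) : Set where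
  constructor strongSeparating
  field
    paths     : All (IsPath G) 𝒫
    separates : ∀ (e f : Edge G) → ¬ (e ≈ₑ f) → Any (λ p → e ∈ₑ p × ¬ (f ∈ₑ p)) 𝒫

record IsSsp (G : Graph) (k : ℕ) : Set where
  constructor isSsp
  field
    attained : ∃[ 𝒫 ] length 𝒫 ≡ k × IsStrongSeparating G 𝒫
    minimal  : ∀ 𝒫 → IsStrongSeparating G 𝒫 → k ≤ length 𝒫

-- The minimum exists: one-edge paths form a strong-separating family, and the
-- existence of one of a given size is decidable. ssp is defined at the end.

private

  least : ∀ {P : Pred ℕ 0ℓ} → Decidable P → ∀ m → P m →
          ∃[ k ] P k × (∀ j → P j → k ≤ j)
  least P? zero    p = zero , p , λ _ _ → z≤n
  least P? (suc m) p with P? zero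
  ... | yes p₀ = zero , p₀ , λ _ _ → z≤n
  ... | no ¬p₀ with least (P? ∘ suc) m p
  ...   | k , pk , k≤ = suc k , pk , λ where
            zero    p₀ → ⊥-elim (¬p₀ p₀)
            (suc j) pj → s≤s (k≤ j pj)

  lookup-injective : ∀ {A : Set} {xs : List A} → Unique xs →
                     ∀ {i j} → lookup xs i ≡ lookup xs j → i ≡ j
  lookup-injective {xs = _ ∷ _}  _        {zero}  {zero}  _  = refl
  lookup-injective {xs = _ ∷ xs} (≢s ∷ _) {zero}  {suc j} eq =
    ⊥-elim (All.lookup ≢s (∈-lookup {xs = xs} j) eq)
  lookup-injective {xs = _ ∷ xs} (≢s ∷ _) {suc i} {zero}  eq =
    ⊥-elim (All.lookup ≢s (∈-lookup {xs = xs} i) (sym eq))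
  lookup-injective {xs = _ ∷ _}  (_ ∷ u)  {suc i} {suc j} eq =
    cong suc (lookup-injective u eq)

  Searchable : {A : Set} → Pred A 0ℓ → Set₁
  Searchable {A} C = ∀ {P : Pred A 0ℓ} → Decidable P → Dec (∃[ x ] C x × P x)

  searchLists : ∀ {A : Set} {C : Pred A 0ℓ} → Searchable C →
                ∀ k → Searchable (λ xs → length xs ≡ k × All C xs)
  searchLists s zero    P? =
    map′ (λ p → [] , (refl , []) , p) (λ { ([] , _ , p) → p }) (P? [])
  searchLists s (suc k) P? =
    map′ (λ { (x , c , xs , (l , cs) , p) → x ∷ xs , (cong suc l , c ∷ cs) , p })
         (λ { (x ∷ xs , (l , c ∷ cs) , p) → x , c , xs , (suc-injective l , cs) , p })
         (s (λ x → searchLists s k (λ xs → P? (x ∷ xs))))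

module _ (G : Graph) where
  open Graph G
  open Edge

  private

    isPath? : Decidable (IsPath G)
    isPath? p =
      map′ (λ { (n , u , l) → isPath n u l }) (λ { (isPath n u l) → n , u , l })
        (¬? (≡-dec _≟ᶠ_ p []) ×-dec DecUnique.unique? _≟ᶠ_ p ×-dec linked? adj? p)

    searchPaths : Searchable (IsPath G)
    searchPaths {P} P? =
      map′ (λ { (_ , xs , _ , ip , p) → xs , ip , p })
           (λ { (xs , ip , p) →
                let l<  = s≤s (injective⇒≤ (lookup-injective (IsPath.distinct ip)))
                in fromℕ< l< , xs
                   , (sym (toℕ-fromℕ< l<) , All.universal (λ v → v , refl) xs) , ip , p })
           (any? {suc order} λ i →
             searchLists searchVertices (toℕ i) {P = λ xs → IsPath G xs × P xs} (λ xs → isPath? xs ×-dec P? xs))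
      where
      searchVertices : Searchable (λ (v : Vertex) → ∃[ w ] v ≡ w)
      searchVertices P? =
        map′ (λ { (v , p) → v , (v , refl) , p }) (λ { (v , _ , p) → v , p }) (any? P?)

    all-edges? : ∀ {P : Pred (Edge G) 0ℓ} →
                 (∀ u v (a b : Adj u v) → P (edge u v a) → P (edge u v b)) →
                 Decidable P → Dec (∀ e → P e)
    all-edges? {P} resp P? =
      map′ (λ h e → h (end₁ e) (end₂ e) (adjacent e)) (λ h u v a → h (edge u v a))
           (all? λ u → all? λ v → at u v)
      where
      at : ∀ u v → Dec (∀ a → P (edge u v a))
      at u v with adj? u v
      ... | no ¬a = yes (λ a → ⊥-elim (¬a a))
      ... | yes a = map′ (λ p b → resp u v a b p) (λ h → h a) (P? (edge u v a))

    ≈ₑ? : B.Decidable (_≈ₑ_ {G})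
    ≈ₑ? e f = (end₁ e ≟ᶠ end₁ f ×-dec end₂ e ≟ᶠ end₂ f)
            ⊎-dec (end₁ e ≟ᶠ end₂ f ×-dec end₂ e ≟ᶠ end₁ f)

    ∈ₑ? : B.Decidable (_∈ₑ_ {G})
    ∈ₑ? e p = infix? _≟ᶠ_ _ p ⊎-dec infix? _≟ᶠ_ _ p

    separates? : Decidable λ 𝒫 →
      ∀ (e f : Edge G) → ¬ (e ≈ₑ f) → Any (λ p → e ∈ₑ p × ¬ (f ∈ₑ p)) 𝒫
    separates? 𝒫 =
      all-edges? (λ u v a b h f → h f) λ e →
      all-edges? (λ u v a b h → h) λ f →
      ¬? (≈ₑ? e f) →-dec Any.any? (λ p → ∈ₑ? e p ×-dec ¬? (∈ₑ? f p)) 𝒫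

    ofSize? : Decidable λ k → ∃[ 𝒫 ] length 𝒫 ≡ k × IsStrongSeparating G 𝒫
    ofSize? k =
      map′ (λ { (𝒫 , (l , ps) , s) → 𝒫 , l , strongSeparating ps s })
           (λ { (𝒫 , l , strongSeparating ps s) → 𝒫 , (l , ps) , s })
           (searchLists searchPaths k separates?)

    -- The family of all one-edge paths.
    arcs : List (Vertex × Vertex)
    arcs = filter (uncurry adj?) (cartesianProduct (allFin order) (allFin order))

    arcPath : Vertex × Vertex → List Vertex
    arcPath (u , v) = u ∷ v ∷ []

    arcPath-isPath : ∀ {u v} → Adj u v → IsPath G (arcPath (u , v))
    arcPath-isPath {u} a =
      isPath (λ ()) (((λ eq → irrefl (subst (Adj u) (sym eq) a)) ∷ []) ∷ [] ∷ []) (a ∷ [-])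

    infix-arc : ∀ {u v x y : Vertex} → Infix _≡_ (x ∷ y ∷ []) (u ∷ v ∷ []) → u ≡ x × v ≡ y
    infix-arc (here (p ∷ q ∷ []))     = sym p , sym q
    infix-arc (there (here (_ ∷ ())))
    infix-arc (there (there (here ())))

    singles : IsStrongSeparating G (map arcPath arcs)
    singles = strongSeparating
      (All.map⁺ (All.tabulate λ m → arcPath-isPath (proj₂ (∈-filter⁻ (uncurry adj?)
        {xs = cartesianProduct (allFin order) (allFin order)} m))))
      λ e f e≉f → lose
        (∈-map⁺ arcPath (∈-filter⁺ (uncurry adj?)
          (∈-cartesianProduct⁺ (∈-allFin (end₁ e)) (∈-allFin (end₂ e))) (adjacent e)))
        ( inj₁ (here (refl ∷ refl ∷ []))
        , λ { (inj₁ i) → e≉f (inj₁ (infix-arc i)) ; (inj₂ i) → e≉f (inj₂ (infix-arc i)) })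

  minimum : ∃[ k ] IsSsp G k
  minimum with least ofSize? _ (map arcPath arcs , refl , singles)
  ... | k , att , k≤ = k , isSsp att (λ 𝒫 s → k≤ (length 𝒫) (𝒫 , refl , s))

  ssp : ℕ
  ssp = proj₁ minimum

  ssp-isSsp : IsSsp G ssp
  ssp-isSsp = proj₂ minimum

------------------------------------------------------------------------
-- Asymptotics

fromℕ : ℕ → ℚ
fromℕ n = + n / 1

-- Rational ε suffices, as every positive real exceeds a positive rational.
IsLittleO1 : (ℕ → ℚ) → Set
IsLittleO1 δ = ∀ (ε : ℚ) → 0ℚ <ℚ ε → ∃[ N ] (∀ n → n ≥ N → ∣ δ n ∣ <ℚ ε)

{-# OPTIONS --safe #-}

module Submission where

-- Lower bound.  Every edge at a fixed vertex v occupies two of the 2|𝒫| places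
-- next to v in the paths of 𝒫, so |𝒫| ≥ n - 1.
--
-- Upper bound.  Let N ≡ 1 (mod 30) with N ≤ n < N + 30, and in ℤ/N join every
-- x ≠ 0 to 2x.  Each difference d occurs on exactly two edges, {d, 2d} and
-- {-2d, -d}, and these are 3d apart.  As 3 is invertible, two translates of this
-- 2-regular graph have exactly one edge in common, so that its N translates
-- would separate all edges strongly if the graph were a path.  It is the union
-- of the cycles of doubling; for every L all but boundedly many of them are
-- longer than L, so there are only o(N).  Splicing the cycle with least element w
-- in behind w - 1 turns it into a single cycle on the nonzero residues.  The o(N)
-- new edges spoil only o(N) differences d, and a spoiled difference is repaired
-- by two more paths, which run through the chains j, j + d, j + 2d, … for
-- increasing and for decreasing j.  For the other n - N vertices, cut the cycle
-- behind some D and insert the i-th extra vertex between 3ⁱD and 2·3ⁱD: the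
-- distance 3ⁱD of its two neighbours has become free because the edge
-- {3ⁱ⁻¹D, 2·3ⁱ⁻¹D} is gone.


-- An edge on fewer than two paths of a strong-separating family must be a path by itself. On the
-- other hand, `N` paths with about `N` edges each cover every edge of the complete graph about
-- twice. So the construction has almost no slack: a typical edge lies on exactly two translates,
-- and these must have nothing else in common. The two chain paths of a spoiled difference share all
-- edges of that difference and cannot tell these apart. The translates still can. An edge of the
-- cut cycle with a given difference has at most six possible starting points, so their set is not
-- invariant under a shift `g` unless `m * g` vanishes for some `m` from 1 to 6. Therefore `60`, the
-- least common multiple of `1, …, 6`, has to be invertible, which `N ≡ 1 (mod 30)` ensures.
-- Splicing at the least element `w` of a cycle keeps the new edges under control: `w` is odd and
-- `2w < N`, so no vertex is used twice for splicing, and all new edges start below `N / 2`. Edges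
-- between extra vertices get paths of their own, at most 29 * 29 in number.

-- Consecutive elements of lists, and insertion into lists

module ConsecutivePairs where

  open import Data.List.Base using (List; []; _∷_; _++_; map; length)
  open import Data.List.Membership.Propositional using (_∈_)
  open import Data.List.Membership.Propositional.Properties using (∈-++⁺ˡ; ∈-++⁺ʳ; ∈-++⁻)
  open import Data.List.Relation.Binary.Infix.Heterogeneous using (Infix; here; there; _++ⁱ_; _ⁱ++_)
  open import Data.List.Relation.Binary.Prefix.Heterogeneous using ([]; _∷_)
  open import Data.List.Relation.Unary.All as All using (All; []; _∷_)
  open import Data.List.Relation.Unary.AllPairs using ([]; _∷_)
  import Data.List.Relation.Unary.Any as Any
  open import Data.List.Relation.Unary.Unique.Propositional using (Unique)
  open import Data.List.Properties using (++-assoc; length-++; ∷-injectiveʳ)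
  open import Data.Nat.Base using (suc; _+_)
  open import Data.Nat.Properties using (+-suc)
  open import Data.Product.Base using (∃₂; ∃-syntax; _×_; _,_)
  open import Data.Sum.Base using (_⊎_; inj₁; inj₂)
  open import Relation.Binary.PropositionalEquality using (_≡_; _≢_; refl; sym; trans; cong; subst; subst₂)
  open import Relation.Nullary.Negation using (¬_)
  open import Data.List.Relation.Unary.Unique.Propositional.Properties as Unique using ()
  import Data.List.Relation.Unary.All.Properties as All
  open import Data.List.Relation.Binary.Disjoint.Propositional using (Disjoint)

  private variable
    A C : Set
    a b c x y : A
    xs ys zs : List A

  Next : A → A → List A → Set
  Next a b xs = Infix _≡_ (a ∷ b ∷ []) xs

  pattern first = here (refl ∷ refl ∷ [])

  SamePair : A → A → A → A → Set
  SamePair a b x y = (a ≡ x × b ≡ y) ⊎ (a ≡ y × b ≡ x)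

  next-mid : ∀ (xs : List A) → Next a b (xs ++ a ∷ b ∷ ys)
  next-mid xs = xs ++ⁱ first

  next-∈ˡ : Next a b xs → a ∈ xs
  next-∈ˡ first     = Any.here refl
  next-∈ˡ (there i) = Any.there (next-∈ˡ i)

  next-∈ʳ : Next a b xs → b ∈ xs
  next-∈ʳ first     = Any.there (Any.here refl)
  next-∈ʳ (there i) = Any.there (next-∈ʳ i)

  next-map⁺ : ∀ (f : A → C) → Next a b xs → Next (f a) (f b) (map f xs)
  next-map⁺ f first     = first
  next-map⁺ f (there i) = there (next-map⁺ f i)

  next-map⁻ : ∀ (f : A → C) xs → Next x y (map f xs) → ∃₂ λ a b → Next a b xs × x ≡ f a × y ≡ f b
  next-map⁻ f (a ∷ b ∷ xs) first     = a , b , first , refl , refl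
  next-map⁻ f (a ∷ xs)     (there i) with next-map⁻ f xs i
  ... | a′ , b′ , j , p , q = a′ , b′ , there j , p , q
  next-map⁻ f (a ∷ [])     (here (_ ∷ ()))
  next-map⁻ f []           (here ())

  StartsWith EndsWith : A → List A → Set
  StartsWith a xs = ∃[ ys ] xs ≡ a ∷ ys
  EndsWith   a xs = ∃[ ys ] xs ≡ ys ++ a ∷ []

  next-++⁻ : ∀ (xs : List A) → Next a b (xs ++ ys) →
             Next a b xs ⊎ Next a b ys ⊎ (EndsWith a xs × StartsWith b ys)
  next-++⁻ []           i         = inj₂ (inj₁ i)
  next-++⁻ {ys = _ ∷ _} (x ∷ []) first     = inj₂ (inj₂ (([] , refl) , (_ , refl)))
  next-++⁻ {ys = []}    (x ∷ []) (here (_ ∷ ()))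
  next-++⁻ (x ∷ x′ ∷ xs) first    = inj₁ first
  next-++⁻ (x ∷ xs)     (there i) with next-++⁻ xs i
  ... | inj₁ j        = inj₁ (there j)
  ... | inj₂ (inj₁ j) = inj₂ (inj₁ j)
  ... | inj₂ (inj₂ ((ws , refl) , s)) = inj₂ (inj₂ ((x ∷ ws , refl) , s))

  next-insert⁺ : ∀ (xs : List A) ws → Next x y (xs ++ a ∷ b ∷ ys) →
                 (x ≡ a × y ≡ b) ⊎ Next x y (xs ++ a ∷ ws ++ b ∷ ys)
  next-insert⁺ []            ws first     = inj₁ (refl , refl)
  next-insert⁺ []            ws (there i) = inj₂ (there (ws ++ⁱ i))
  next-insert⁺ (x ∷ [])      ws first     = inj₂ first
  next-insert⁺ (x ∷ x′ ∷ xs) ws first     = inj₂ first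
  next-insert⁺ (x ∷ xs)      ws (there i) with next-insert⁺ xs ws i
  ... | inj₁ e = inj₁ e
  ... | inj₂ j = inj₂ (there j)

  next-insert⁻ : ∀ (xs : List A) ws → Next x y (xs ++ a ∷ ws ++ b ∷ ys) →
                 (x ≡ a × StartsWith y (ws ++ b ∷ ys)) ⊎ Next x y ws ⊎ (EndsWith x ws × y ≡ b)
                 ⊎ Next x y (xs ++ a ∷ b ∷ ys)
  next-insert⁻ [] (_ ∷ _) first = inj₁ (refl , _ , refl)
  next-insert⁻ [] []      first = inj₁ (refl , _ , refl)
  next-insert⁻ [] ws (there i) with next-++⁻ ws i
  ... | inj₁ j = inj₂ (inj₁ j)
  ... | inj₂ (inj₁ j) = inj₂ (inj₂ (inj₂ (there j)))
  ... | inj₂ (inj₂ (e , _ , refl)) = inj₂ (inj₂ (inj₁ (e , refl)))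
  next-insert⁻ (x ∷ []) ws first = inj₂ (inj₂ (inj₂ first))
  next-insert⁻ (x ∷ x′ ∷ xs) ws first = inj₂ (inj₂ (inj₂ first))
  next-insert⁻ (x ∷ xs) ws (there i) with next-insert⁻ xs ws i
  ... | inj₁ e = inj₁ e
  ... | inj₂ (inj₁ e) = inj₂ (inj₁ e)
  ... | inj₂ (inj₂ (inj₁ e)) = inj₂ (inj₂ (inj₁ e))
  ... | inj₂ (inj₂ (inj₂ j)) = inj₂ (inj₂ (inj₂ (there j)))

  next-≢ : Unique xs → Next a b xs → a ≢ b
  next-≢ ((a≢b ∷ _) ∷ _) first     = a≢b
  next-≢ (_ ∷ u)         (there i) = next-≢ u i

  -- If the pair is not the whole path, then the edge after it (when the pair comes first) or the
  -- first edge of the path (when it comes later) has an end outside `{a, b}`, because the vertices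
  -- are distinct.
  singleEdge⊎otherEdge : Unique xs → Next a b xs →
    xs ≡ a ∷ b ∷ [] ⊎ ∃₂ λ x y → Next x y xs × ¬ SamePair a b x y
  singleEdge⊎otherEdge {xs = a ∷ b ∷ []} _ first = inj₁ refl
  singleEdge⊎otherEdge {xs = a ∷ b ∷ c ∷ _} ((a≢b ∷ a≢c ∷ _) ∷ _) first =
    inj₂ (b , c , there first , λ { (inj₁ (e , _)) → a≢b e ; (inj₂ (e , _)) → a≢c e })
  singleEdge⊎otherEdge {xs = x ∷ y ∷ _} (x≢ ∷ _) (there i) =
    inj₂ (x , y , first , λ { (inj₁ (e , _)) → All.lookup x≢ (next-∈ˡ i) (sym e)
                            ; (inj₂ (_ , e)) → All.lookup x≢ (next-∈ʳ i) (sym e) })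
  singleEdge⊎otherEdge {xs = x ∷ []} _ (there (here ()))

  ∈-insert⁺ : ∀ (xs : List A) ws → x ∈ xs ++ a ∷ ys → x ∈ xs ++ a ∷ ws ++ ys
  ∈-insert⁺ xs ws x∈ with ∈-++⁻ xs x∈
  ... | inj₁ m               = ∈-++⁺ˡ m
  ... | inj₂ (Any.here e)    = ∈-++⁺ʳ xs (Any.here e)
  ... | inj₂ (Any.there m)   = ∈-++⁺ʳ xs (Any.there (∈-++⁺ʳ ws m))

  ∈-inserted : ∀ (xs : List A) {ws} → x ∈ ws → x ∈ xs ++ a ∷ ws ++ ys
  ∈-inserted xs m = ∈-++⁺ʳ xs (Any.there (∈-++⁺ˡ m))

  ∈-insert⁻ : ∀ (xs : List A) ws → x ∈ xs ++ a ∷ ws ++ ys → x ∈ ws ⊎ x ∈ xs ++ a ∷ ys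
  ∈-insert⁻ xs ws x∈ with ∈-++⁻ xs x∈
  ... | inj₁ m            = inj₂ (∈-++⁺ˡ m)
  ... | inj₂ (Any.here e) = inj₂ (∈-++⁺ʳ xs (Any.here e))
  ... | inj₂ (Any.there m) with ∈-++⁻ ws m
  ...   | inj₁ n = inj₁ n
  ...   | inj₂ n = inj₂ (∈-++⁺ʳ xs (Any.there n))

  unique-insert : ∀ (xs : List A) {ws} → Unique (xs ++ a ∷ ys) → Unique ws → Disjoint ws (xs ++ a ∷ ys) →
                  Unique (xs ++ a ∷ ws ++ ys)
  unique-insert [] (a≢ ∷ U) W d =
    All.++⁺ (All.tabulate λ m e → d (m , Any.here (sym e))) a≢ ∷ Unique.++⁺ W U λ
        { (m , n) → d (m , Any.there n) }
  unique-insert (x ∷ xs) {ws} (x≢ ∷ U) W d = All.tabulate (λ m → distinct (∈-insert⁻ xs ws m)) ∷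
    unique-insert xs U W λ { (m , n) → d (m , Any.there n) }
    where
    distinct : ∀ {y} → y ∈ ws ⊎ y ∈ xs ++ _ ∷ _ → x ≢ y
    distinct (inj₁ m) refl = d (m , Any.here refl)
    distinct (inj₂ m) e    = All.lookup x≢ m e

  next-inserted : ∀ (xs : List A) {ws} → Next x y ws → Next x y (xs ++ a ∷ ws ++ ys)
  next-inserted xs i = xs ++ⁱ there (i ⁱ++ _)

  endsWith-insert : ∀ (xs : List A) ws → EndsWith x (xs ++ a ∷ b ∷ ys) → EndsWith x (xs ++ a ∷ ws ++ b ∷ ys)
  endsWith-insert {b = b} {ys = ys} xs ws e = endsWith-++ xs _
      (endsWith-++ (_ ∷ ws) _ (endsWith-drop b ys xs e))
    where
    endsWith-++ : ∀ (us vs : List A) → EndsWith x vs → EndsWith x (us ++ vs)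
    endsWith-++ us vs (ws , refl) = us ++ ws , sym (++-assoc us ws _)
    endsWith-tail : ∀ {z w : A} {vs} → EndsWith x (z ∷ w ∷ vs) → EndsWith x (w ∷ vs)
    endsWith-tail (_ ∷ us , eq) = us , ∷-injectiveʳ eq
    endsWith-drop : ∀ {z} (b : A) ys us → EndsWith x (us ++ z ∷ b ∷ ys) → EndsWith x (b ∷ ys)
    endsWith-drop b ys []           e = endsWith-tail e
    endsWith-drop b ys (u ∷ [])     e = endsWith-drop b ys [] (endsWith-tail e)
    endsWith-drop b ys (u ∷ u′ ∷ us) e = endsWith-drop b ys (u′ ∷ us) (endsWith-tail e)

  length-insert : ∀ (xs : List A) ws → length (xs ++ a ∷ ws ++ ys) ≡ length ws + length (xs ++ a ∷ ys)
  length-insert {a = a} {ys = ys} [] ws = trans (cong suc (length-++ ws)) (sym (+-suc (length ws) (length ys)))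
  length-insert (x ∷ xs) ws = trans (cong suc (length-insert xs ws)) (sym (+-suc (length ws) _))

  next-∷⁻ : Next a b (x ∷ xs) → (a ≡ x × StartsWith b xs) ⊎ Next a b xs
  next-∷⁻ {xs = _ ∷ _} first     = inj₁ (refl , _ , refl)
  next-∷⁻ {xs = []}    (here (_ ∷ ()))
  next-∷⁻              (there i) = inj₂ i

  startsWith-prefix : ∀ (xs : List A) → StartsWith x (xs ++ a ∷ ys) → StartsWith x (xs ++ a ∷ zs)
  startsWith-prefix []      (_ , refl) = _ , refl
  startsWith-prefix (_ ∷ _) (_ , refl) = _ , refl

  sameStart : ∀ (us : List A) → StartsWith b (us ++ a ∷ xs) → StartsWith c (us ++ a ∷ ys) → b ≡ c
  sameStart []      (_ , refl) (_ , refl) = refl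
  sameStart (_ ∷ _) (_ , refl) (_ , refl) = refl

  nonEmpty-start : ∀ (us : List A) → ∃[ b ] StartsWith b (us ++ a ∷ xs)
  nonEmpty-start []      = _ , _ , refl
  nonEmpty-start (u ∷ _) = u , _ , refl

  lastElement : ∀ (z : A) zs → ∃[ a ] EndsWith a (z ∷ zs)
  lastElement z []        = z , [] , refl
  lastElement z (z′ ∷ zs) with lastElement z′ zs
  ... | a , us , eq = a , z ∷ us , cong (z ∷_) eq

  junction : ∀ (xs : List A) → EndsWith a xs → StartsWith b ys → Next a b (xs ++ ys)
  junction {a = a} _ (us , refl) (vs , refl) = subst (Next a _) (sym (++-assoc us (a ∷ []) _)) (next-mid us)

  next-map-injective : ∀ {f : A → C} → (∀ {x y} → f x ≡ f y → x ≡ y) → ∀ xs → Next (f a) (f b) (map f xs) → Next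
      a b xs
  next-map-injective {f = f} inj xs i with next-map⁻ f xs i
  ... | _ , _ , j , e , e′ = subst₂ (λ a b → Next a b xs) (sym (inj e)) (sym (inj e′)) j

-- The lower bound n - 1 by counting the places next to a vertex

module LowerBound where

  open ConsecutivePairs
  open import Defs
  open import Data.Bool.Base using (if_then_else_)
  open import Data.Empty using (⊥-elim)
  open import Data.Fin.Base using (Fin; zero; suc; combine; remQuot)
  open import Data.Fin.Properties
    using (combine-injective; combine-remQuot; injective⇒≤; suc-injective) renaming (_≟_ to _≟ᶠ_)
  open import Data.List.Base using (List; []; _∷_; length; lookup)
  open import Data.List.Relation.Unary.All as All using (All; []; _∷_)
  import Data.List.Relation.Unary.All.Properties as All
  open import Data.List.Relation.Unary.AllPairs using ([]; _∷_)
  import Data.List.Relation.Unary.Any as Any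
  open import Data.List.Relation.Unary.Any.Properties using (lookup-index)
  open import Data.List.Relation.Unary.Unique.Propositional using (Unique)
  open import Data.List.Relation.Binary.Infix.Heterogeneous using (here; there)
  open import Data.List.Relation.Binary.Prefix.Heterogeneous using ([]; _∷_)
  open import Data.List.Membership.Propositional.Properties using (∈-lookup)
  open import Data.Maybe.Base using (Maybe; just; nothing; fromMaybe; _<∣>_)
  open import Data.Nat.Base using (ℕ; zero; suc; _+_; _*_; _≤_)
  open import Data.Nat.Properties using (*-cancelʳ-≤)
  open import Data.Product.Base using (∃₂; ∃-syntax; _×_; _,_; proj₁; proj₂)
  open import Data.Sum.Base using (_⊎_; inj₁; inj₂)
  open import Relation.Binary.PropositionalEquality using (_≡_; _≢_; refl; sym; trans; cong; cong₂; ≢-sym)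
  open import Data.Product.Properties using (×-≡,≡→≡)
  open import Relation.Nullary.Decidable using (yes; no; does)
  open import Relation.Nullary.Negation using (¬_)

  module _ {n : ℕ} where

    succOf predOf : Fin n → List (Fin n) → Maybe (Fin n)
    succOf v (x ∷ y ∷ xs) = if does (x ≟ᶠ v) then just y else succOf v (y ∷ xs)
    succOf v _            = nothing
    predOf v (x ∷ y ∷ xs) = if does (y ≟ᶠ v) then just x else predOf v (y ∷ xs)
    predOf v _            = nothing

    succOf-next : ∀ {v u xs} → Unique xs → Next v u xs → succOf v xs ≡ just u
    succOf-next {v} {xs = x ∷ y ∷ xs} (x≢ ∷ U) i with x ≟ᶠ v | i
    ... | yes refl | first   = refl
    ... | yes refl | there j = ⊥-elim (All.lookup x≢ (next-∈ˡ j) refl)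
    ... | no x≢v   | first   = ⊥-elim (x≢v refl)
    ... | no _     | there j = succOf-next U j
    succOf-next {xs = []} _ (here ())
    succOf-next {xs = _ ∷ []} _ (here (_ ∷ ()))
    succOf-next {xs = _ ∷ []} _ (there (here ()))

    predOf-next : ∀ {v u xs} → Unique xs → Next u v xs → predOf v xs ≡ just u
    predOf-next {v} {xs = x ∷ y ∷ xs} (x≢ ∷ U) i with y ≟ᶠ v | i
    ... | yes refl | first   = refl
    ... | yes refl | there j = ⊥-elim (noPred U j)
      where
      noPred : ∀ {v u xs} → Unique (v ∷ xs) → ¬ Next u v (v ∷ xs)
      noPred ([] ∷ _) (here (_ ∷ ()))
      noPred ([] ∷ _) (there (here ()))
      noPred ((v≢v ∷ _) ∷ _) first     = v≢v refl
      noPred (v≢ ∷ _)        (there i) = All.lookup v≢ (next-∈ʳ i) refl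
    ... | no y≢v   | first   = ⊥-elim (y≢v refl)
    ... | no _     | there j = predOf-next U j
    predOf-next {xs = []} _ (here ())
    predOf-next {xs = _ ∷ []} _ (here (_ ∷ ()))
    predOf-next {xs = _ ∷ []} _ (there (here ()))

    -- The two slots are the places after and before `v`. When `v` is an end of the path, the
    -- missing place falls back on the other one, so that both slots of a one-edge path belong to
    -- its edge. The value `v` itself means that `v` has no neighbour on the path.
    neighbour : Fin n → List (Fin n) → Fin 2 → Fin n
    neighbour v xs zero       = fromMaybe v (succOf v xs <∣> predOf v xs)
    neighbour v xs (suc zero) = fromMaybe v (predOf v xs <∣> succOf v xs)

    side : ∀ {v u xs} → Unique xs → Next v u xs ⊎ Next u v xs → ∃[ s ] neighbour v xs s ≡ u
    side {v} {u} {xs} U (inj₁ i) = zero , cong (λ z → fromMaybe v (z <∣> predOf v xs)) (succOf-next U i)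
    side {v} {u} {xs} U (inj₂ i) = suc zero , cong (λ z → fromMaybe v (z <∣> succOf v xs)) (predOf-next U i)

    bothSides : ∀ {v u xs} → v ≢ u → xs ≡ v ∷ u ∷ [] ⊎ xs ≡ u ∷ v ∷ [] → ∀ s → neighbour v xs s ≡ u
    bothSides {v} {u} v≢u (inj₁ refl) zero with v ≟ᶠ v | u ≟ᶠ v
    ... | no v≢v | _       = ⊥-elim (v≢v refl)
    ... | yes _  | yes u≡v = ⊥-elim (v≢u (sym u≡v))
    ... | yes _  | no _    = refl
    bothSides {v} {u} v≢u (inj₁ refl) (suc zero) with v ≟ᶠ v | u ≟ᶠ v
    ... | no v≢v | _       = ⊥-elim (v≢v refl)
    ... | yes _  | yes u≡v = ⊥-elim (v≢u (sym u≡v))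
    ... | yes _  | no _    = refl
    bothSides {v} {u} v≢u (inj₂ refl) zero with v ≟ᶠ v | u ≟ᶠ v
    ... | no v≢v | _       = ⊥-elim (v≢v refl)
    ... | yes _  | yes u≡v = ⊥-elim (v≢u (sym u≡v))
    ... | yes _  | no _    = refl
    bothSides {v} {u} v≢u (inj₂ refl) (suc zero) with v ≟ᶠ v | u ≟ᶠ v
    ... | no v≢v | _       = ⊥-elim (v≢v refl)
    ... | yes _  | yes u≡v = ⊥-elim (v≢u (sym u≡v))
    ... | yes _  | no _    = refl

  -- If only one path contains the edge {0, u}, then that path has no other edge,
  -- and the slots on both sides of 0 are assigned to this edge.
  lowerBound : ∀ m 𝒫 → IsStrongSeparating (K (3 + m)) 𝒫 → 2 + m ≤ length 𝒫
  lowerBound m 𝒫 (strongSeparating paths separates) =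
    *-cancelʳ-≤ _ _ 2 (injective⇒≤ {f = code} code-injective)
    where
    n = 3 + m

    unique : ∀ i → Unique (lookup 𝒫 i)
    unique i = IsPath.distinct (All.lookup paths (∈-lookup i))

    nb : Fin (length 𝒫) → Fin 2 → Fin n
    nb i = neighbour zero (lookup 𝒫 i)

    separator : ∀ u x y → u ≢ zero → x ≢ y → ¬ SamePair zero u x y →
      ∃[ i ] ((Next zero u (lookup 𝒫 i) ⊎ Next u zero (lookup 𝒫 i)) × ¬ (Next x y (lookup 𝒫 i)))
    separator u x y u≢0 x≢y ¬same = Any.index any , e∈p , λ i → f∉p (inj₁ i)
      where
      any = separates (edge zero u (≢-sym u≢0)) (edge x y x≢y) ¬same
      e∈p = proj₁ (lookup-index any)
      f∉p = proj₂ (lookup-index any)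

    other : ∀ (u : Fin n) → ∃[ x ] (x ≢ zero × x ≢ u)
    other (suc zero)    = suc (suc zero) , (λ ()) , (λ ())
    other (suc (suc u)) = suc zero , (λ ()) , (λ ())
    other zero          = suc zero , (λ ()) , (λ ())

    TwoSlots : Fin n → Set
    TwoSlots u = ∃₂ λ (p q : Fin (length 𝒫) × Fin 2) →
      p ≢ q × nb (proj₁ p) (proj₂ p) ≡ u × nb (proj₁ q) (proj₂ q) ≡ u

    twoPaths : ∀ {u} i j → Next zero u (lookup 𝒫 i) ⊎ Next u zero (lookup 𝒫 i) →
               Next zero u (lookup 𝒫 j) ⊎ Next u zero (lookup 𝒫 j) → i ≢ j → TwoSlots u
    twoPaths i j p q i≢j with side (unique i) p | side (unique j) q
    ... | s , es | t , et = (i , s) , (j , t) , (λ e → i≢j (cong proj₁ e)) , es , et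

    onePath : ∀ {u} i → u ≢ zero → lookup 𝒫 i ≡ zero ∷ u ∷ [] ⊎ lookup 𝒫 i ≡ u ∷ zero ∷ [] → TwoSlots u
    onePath i u≢0 e = (i , zero) , (i , suc zero) , (λ ()) ,
      bothSides (≢-sym u≢0) e zero , bothSides (≢-sym u≢0) e (suc zero)

    -- Separating `{0, u}` from an edge `{u, x}` yields some path through `{0, u}`; this takes a
    -- third vertex. If that path has another edge, separating `{0, u}` from this edge yields a
    -- second path.
    twoSlots : ∀ u → u ≢ zero → TwoSlots u
    twoSlots u u≢0 with other u
    ... | x , x≢0 , x≢u with separator u u x u≢0 (≢-sym x≢u)
                               (λ { (inj₁ (e , _)) → u≢0 (sym e) ; (inj₂ (e , _)) → x≢0 (sym e) })
    ... | i , inj₁ e , _ with singleEdge⊎otherEdge (unique i) e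
    ...   | inj₁ single = onePath i u≢0 (inj₁ single)
    ...   | inj₂ (x , y , f , ¬same) with separator u x y u≢0 (next-≢ (unique i) f) ¬same
    ...     | j , e′ , ¬f = twoPaths i j (inj₁ e) e′ (λ { refl → ¬f f })
    twoSlots u u≢0 | x , _ , _ | i , inj₂ e , _ with singleEdge⊎otherEdge (unique i) e
    ...   | inj₁ single = onePath i u≢0 (inj₂ single)
    ...   | inj₂ (x , y , f , ¬same) with separator u x y u≢0 (next-≢ (unique i) f)
                 (λ { (inj₁ (p , q)) → ¬same (inj₂ (q , p)) ; (inj₂ (p , q)) → ¬same (inj₁ (q , p)) })
    ...     | j , e′ , ¬f = twoPaths i j (inj₂ e) e′ (λ { refl → ¬f f })

    slot : Fin (2 + m) → Fin 2 → Fin (length 𝒫) × Fin 2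
    slot u zero       = proj₁ (twoSlots (suc u) λ ())
    slot u (suc zero) = proj₁ (proj₂ (twoSlots (suc u) λ ()))

    nb-slot : ∀ u b → nb (proj₁ (slot u b)) (proj₂ (slot u b)) ≡ suc u
    nb-slot u zero       = proj₁ (proj₂ (proj₂ (proj₂ (twoSlots (suc u) λ ()))))
    nb-slot u (suc zero) = proj₂ (proj₂ (proj₂ (proj₂ (twoSlots (suc u) λ ()))))

    -- `nb` recovers the vertex from a slot, so different vertices own different slots; the two
    -- slots of one vertex differ by construction.
    slot-injective : ∀ u b v c → slot u b ≡ slot v c → u ≡ v × b ≡ c
    slot-injective u b v c eq with suc-injective
      (trans (sym (nb-slot u b)) (trans (cong (λ s → nb (proj₁ s) (proj₂ s)) eq) (nb-slot v c)))
    slot-injective u zero       u zero       eq | refl = refl , refl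
    slot-injective u (suc zero) u (suc zero) eq | refl = refl , refl
    slot-injective u zero       u (suc zero) eq | refl =
      ⊥-elim (proj₁ (proj₂ (proj₂ (twoSlots (suc u) λ ()))) eq)
    slot-injective u (suc zero) u zero       eq | refl =
      ⊥-elim (proj₁ (proj₂ (proj₂ (twoSlots (suc u) λ ()))) (sym eq))

    slotOf : Fin ((2 + m) * 2) → Fin (length 𝒫) × Fin 2
    slotOf k = slot (proj₁ (remQuot {2 + m} 2 k)) (proj₂ (remQuot {2 + m} 2 k))

    code : Fin ((2 + m) * 2) → Fin (length 𝒫 * 2)
    code k = combine (proj₁ (slotOf k)) (proj₂ (slotOf k))

    code-injective : ∀ {k l} → code k ≡ code l → k ≡ l
    code-injective {k} {l} eq
      with ei , es ← combine-injective (proj₁ (slotOf k)) (proj₂ (slotOf k)) (proj₁ (slotOf l))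
          (proj₂ (slotOf l)) eq
      with eu , eb ← slot-injective (proj₁ (remQuot {2 + m} 2 k)) (proj₂ (remQuot {2 + m} 2 k))
                       (proj₁ (remQuot {2 + m} 2 l)) (proj₂ (remQuot {2 + m} 2 l)) (×-≡,≡→≡ (ei , es))
      = trans (sym (combine-remQuot {2 + m} 2 k)) (trans (cong₂ combine eu eb) (combine-remQuot {2 + m} 2 l))

-- Arithmetic modulo N = 30k + 1

module Residues where

  open import Data.Fin.Base using (Fin; toℕ; fromℕ<)
  open import Data.Fin.Properties using (toℕ<n; toℕ-injective; toℕ-fromℕ<)
  open import Data.Integer.Base using (ℤ; +_; -_; _+_; _-_; _*_; ∣_∣; 0ℤ)
  open import Data.Integer.DivMod using (_%ℕ_; _/ℕ_; n%ℕd<d; a≡a%ℕn+[a/ℕn]*n)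
  open import Data.Integer.Divisibility.Signed using (_∣_; divides; ∣⇒∣ᵤ; ∣m∣n⇒∣m+n; ∣n⇒∣m*n)
  open import Data.Integer.Properties
    using (i≡j⇒i-j≡0; m-n≡m⊖n; ∣m⊝n∣≤m⊔n; ∣i∣≡0⇒i≡0; i-j≡0⇒i≡j; +-injective; pos-*; pos-+; +-identityʳ; *-identityˡ)
  open import Data.Integer.Tactic.RingSolver using (solve)
  open import Data.List.Base using ([]; _∷_)
  import Data.Nat.Base as ℕ
  open import Data.Nat.Base using (ℕ; zero; suc; z<s)
  import Data.Nat.Divisibility as ℕ
  import Data.Nat.Properties as ℕ
  open import Relation.Binary.PropositionalEquality using (_≡_; refl; sym; trans; cong; subst)
  open import Data.Empty using (⊥-elim)

  -- 2, 3 and 5 are invertible modulo N.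
  module Mod (k : ℕ) where

    N : ℕ
    N = suc (30 ℕ.* k)

    infix 4 _≈_
    record _≈_ (a b : ℤ) : Set where
      constructor mod
      field divisible : + N ∣ a - b

    -- Congruences are proved by writing `a - b` as an explicit linear combination of the
    -- differences in the hypotheses; the coefficients are supplied and the ring solver checks the
    -- identity.
    lin₁ : ∀ c {a b a₁ b₁} → a₁ ≈ b₁ → a - b ≡ c * (a₁ - b₁) → a ≈ b
    lin₁ c (mod h) eq = mod (subst (+ N ∣_) (sym eq) (∣n⇒∣m*n c h))

    lin₂ : ∀ c₁ c₂ {a b a₁ b₁ a₂ b₂} → a₁ ≈ b₁ → a₂ ≈ b₂ →
           a - b ≡ c₁ * (a₁ - b₁) + c₂ * (a₂ - b₂) → a ≈ b
    lin₂ c₁ c₂ (mod h₁) (mod h₂) eq =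
      mod (subst (+ N ∣_) (sym eq) (∣m∣n⇒∣m+n (∣n⇒∣m*n c₁ h₁) (∣n⇒∣m*n c₂ h₂)))

    lin₃ : ∀ c₁ c₂ c₃ {a b a₁ b₁ a₂ b₂ a₃ b₃} → a₁ ≈ b₁ → a₂ ≈ b₂ → a₃ ≈ b₃ →
           a - b ≡ c₁ * (a₁ - b₁) + c₂ * (a₂ - b₂) + c₃ * (a₃ - b₃) → a ≈ b
    lin₃ c₁ c₂ c₃ (mod h₁) (mod h₂) (mod h₃) eq =
      mod (subst (+ N ∣_) (sym eq)
        (∣m∣n⇒∣m+n (∣m∣n⇒∣m+n (∣n⇒∣m*n c₁ h₁) (∣n⇒∣m*n c₂ h₂)) (∣n⇒∣m*n c₃ h₃)))

    lin₄ : ∀ c₁ c₂ c₃ c₄ {a b a₁ b₁ a₂ b₂ a₃ b₃ a₄ b₄} → a₁ ≈ b₁ → a₂ ≈ b₂ → a₃ ≈ b₃ → a₄ ≈ b₄ →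
           a - b ≡ c₁ * (a₁ - b₁) + c₂ * (a₂ - b₂) + c₃ * (a₃ - b₃) + c₄ * (a₄ - b₄) → a ≈ b
    lin₄ c₁ c₂ c₃ c₄ (mod h₁) (mod h₂) (mod h₃) (mod h₄) eq =
      mod (subst (+ N ∣_) (sym eq)
        (∣m∣n⇒∣m+n (∣m∣n⇒∣m+n (∣m∣n⇒∣m+n (∣n⇒∣m*n c₁ h₁) (∣n⇒∣m*n c₂ h₂)) (∣n⇒∣m*n c₃ h₃)) (∣n⇒∣m*n c₄ h₄)))

    ≡⇒≈ : ∀ {a b} → a ≡ b → a ≈ b
    ≡⇒≈ eq = mod (divides 0ℤ (i≡j⇒i-j≡0 eq))

    ≈-refl : ∀ {a} → a ≈ a
    ≈-refl = ≡⇒≈ refl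

    ≈-sym : ∀ {a b} → a ≈ b → b ≈ a
    ≈-sym {a} {b} h = lin₁ (- + 1) h (solve (a ∷ b ∷ []))

    ≈-trans : ∀ {a b c} → a ≈ b → b ≈ c → a ≈ c
    ≈-trans {a} {b} {c} h h′ = lin₂ (+ 1) (+ 1) h h′ (solve (a ∷ b ∷ c ∷ []))

    N≡ : + N ≡ + 1 + + 30 * + k
    N≡ = trans (pos-+ 1 (30 ℕ.* k)) (cong (λ z → + 1 + z) (pos-* 30 k))

    N≈0 : + N ≈ 0ℤ
    N≈0 = mod (divides (+ 1) (trans (+-identityʳ (+ N)) (sym (*-identityˡ (+ N)))))

    -- With N = 30k + 1, 60 · 15k² + (1 - 30k) N = 1.
    cancel₆₀ : ∀ {x y} → + 60 * x ≈ + 60 * y → x ≈ y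
    cancel₆₀ {x} {y} h = go (+ k) N≡ N≈0
      where
      go : ∀ κ {n} → n ≡ + 1 + + 30 * κ → n ≈ 0ℤ → x ≈ y
      go κ refl n≈0 = lin₂ (+ 15 * κ * κ) ((+ 1 - + 30 * κ) * (x - y)) h n≈0 (solve (x ∷ y ∷ κ ∷ []))

    -- Every divisor of `60` is invertible along with `60`. The number is the least common multiple
    -- of `1, …, 6`, the multipliers that occur in the comparison of seven equally spaced starting
    -- points.
    cancel : ∀ c c′ {x y} → c′ * c ≡ + 60 → c * x ≈ c * y → x ≈ y
    cancel c c′ {x} {y} eq h = cancel₆₀ (lin₁ c′ h (trans (cong (λ z → z * x - z * y) (sym eq))
        (solve (c ∷ c′ ∷ x ∷ y ∷ []))))

    abstract
      ι : Fin N → ℤ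
      ι x = + toℕ x

      ι≡ : ∀ x → ι x ≡ + toℕ x
      ι≡ x = refl

      ρ : ℤ → Fin N
      ρ z = fromℕ< (n%ℕd<d z N)

      ι-ρ : ∀ z → ι (ρ z) ≈ z
      ι-ρ z = ≈-sym (mod (divides (z /ℕ N) (begin
        z - ι (ρ z)                                   ≡⟨ cong (λ m → z - + m) (toℕ-fromℕ< (n%ℕd<d z N)) ⟩
        z - + (z %ℕ N)                                ≡⟨ cong (_- + (z %ℕ N)) (a≡a%ℕn+[a/ℕn]*n z N) ⟩
        + (z %ℕ N) + (z /ℕ N) * + N - + (z %ℕ N)      ≡⟨ go (+ (z %ℕ N)) ((z /ℕ N) * + N) ⟩
        (z /ℕ N) * + N                                ∎)))
        where
        open Relation.Binary.PropositionalEquality.≡-Reasoning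
        go : ∀ a b → a + b - a ≡ b
        go a b = solve (a ∷ b ∷ [])

    ≈⇒≡ : ∀ {m n} → m ℕ.< N → n ℕ.< N → + m ≈ + n → m ≡ n
    ≈⇒≡ {m} {n} m<N n<N (mod h) = +-injective (i-j≡0⇒i≡j _ _ (∣i∣≡0⇒i≡0 (zero-or-big (∣⇒∣ᵤ h) small)))
      where
      small : ∣ + m - + n ∣ ℕ.< N
      small = ℕ.≤-<-trans (subst (λ z → ∣ z ∣ ℕ.≤ m ℕ.⊔ n) (sym (m-n≡m⊖n m n)) (∣m⊝n∣≤m⊔n m n))
          (ℕ.⊔-lub m<N n<N)
      zero-or-big : ∀ {d} → N ℕ.∣ d → d ℕ.< N → d ≡ 0
      zero-or-big {zero}  _   _   = refl
      zero-or-big {suc d} N∣d d<N = ⊥-elim (ℕ.<⇒≱ d<N (ℕ.∣⇒≤ N∣d))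

    ι-injective : ∀ {x y} → ι x ≈ ι y → x ≡ y
    ι-injective {x} {y} h = toℕ-injective (≈⇒≡ (toℕ<n x) (toℕ<n y)
        (≈-trans (≡⇒≈ (sym (ι≡ x))) (≈-trans h (≡⇒≈ (ι≡ y)))))

    ι-zero : ∀ {x} → ι x ≈ 0ℤ → toℕ x ≡ 0
    ι-zero {x} h = ≈⇒≡ (toℕ<n x) z<s (≈-trans (≡⇒≈ (sym (ι≡ x))) h)

    ι-toℕ : ∀ {x m} → toℕ x ≡ m → ι x ≈ + m
    ι-toℕ {x} eq = ≡⇒≈ (trans (ι≡ x) (cong +_ eq))

    ι-cong : ∀ {x y} → x ≡ y → ι x ≈ ι y
    ι-cong eq = ≡⇒≈ (cong ι eq)

    ρ≡ : ∀ {z x} → z ≈ ι x → ρ z ≡ x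
    ρ≡ {z} h = ι-injective (≈-trans (ι-ρ z) h)

    abstract
      dbl : Fin N → Fin N
      dbl x = ρ (+ 2 * ι x)

      ι-dbl : ∀ x → ι (dbl x) ≈ + 2 * ι x
      ι-dbl x = ι-ρ (+ 2 * ι x)

    dbl-injective : ∀ {x y} → dbl x ≡ dbl y → x ≡ y
    dbl-injective {x} {y} eq = ι-injective (cancel (+ 2) (+ 30) refl
      (≈-trans (≈-sym (ι-dbl x)) (≈-trans (ι-cong eq) (ι-dbl y))))

    abstract
      -- The factor `- 10k` is the inverse of 3, because `3 * (- 10k) = 1 - N`.
      third : ℤ → Fin N
      third z = ρ (- (+ 10 * + k) * z)

      ι-third : ∀ z → + 3 * ι (third z) ≈ z
      ι-third z = ≈-trans (go₁ (ι-ρ _)) (go₂ (+ k) N≡ N≈0)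
        where
        go₁ : ∀ {x y} → x ≈ y → + 3 * x ≈ + 3 * y
        go₁ {x} {y} h = lin₁ (+ 3) h (solve (x ∷ y ∷ []))
        go₂ : ∀ κ {n} → n ≡ + 1 + + 30 * κ → n ≈ 0ℤ → + 3 * (- (+ 10 * κ) * z) ≈ z
        go₂ κ refl n≈0 = lin₁ (- z) n≈0 (solve (z ∷ κ ∷ []))

-- The cycles of doubling

module DoublingOrbits where

  open ConsecutivePairs
  open Residues
  open import Data.Fin.Base as Fin using (Fin; toℕ)
  open import Data.Fin.Properties using (pigeonhole) renaming (_≟_ to _≟ᶠ_)
  open import Data.List.Base using (List; []; _∷_; length)
  open import Data.List.Membership.Propositional using (_∈_)
  open import Data.List.Relation.Unary.All as All using (All; []; _∷_)
  import Data.List.Relation.Unary.All.Properties as All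
  open import Data.List.Relation.Unary.AllPairs using ([]; _∷_)
  open import Data.List.Relation.Unary.Any using (here; there)
  open import Data.List.Relation.Unary.Unique.Propositional using (Unique)
  open import Data.List.Relation.Binary.Infix.Heterogeneous as Inf using ()
  open import Data.List.Relation.Binary.Prefix.Heterogeneous using ([]; _∷_)
  open import Data.Nat.Base using (ℕ; zero; suc; _+_; _∸_; _<_; s≤s; z<s; s<s)
  open import Data.Nat.Properties
  open import Data.Product.Base using (∃-syntax; _×_; _,_; proj₁; proj₂)
  open import Relation.Binary.PropositionalEquality using (_≡_; _≢_; refl; sym; trans; cong; subst)
  open import Relation.Nullary.Decidable using (yes; no)
  open import Relation.Nullary.Negation using (¬_)
  open import Relation.Unary using (Pred; Decidable)
  open import Level using (0ℓ)

  leastWitness : ∀ {P : Pred ℕ 0ℓ} → Decidable P → ∀ m → P m → ∃[ l ] (P l × (∀ {j} → j < l → ¬ P j))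
  leastWitness P? zero    p = zero , p , λ ()
  leastWitness P? (suc m) p with P? zero
  ... | yes p₀ = zero , p₀ , λ ()
  ... | no ¬p₀ with leastWitness (λ j → P? (suc j)) m p
  ...   | l , pl , l-least = suc l , pl , λ { {zero} _ p₀ → ¬p₀ p₀ ; {suc j} (s≤s j<l) pj → l-least j<l pj }

  module Orbits (k : ℕ) where
    open Mod k

    iter : ℕ → Fin N → Fin N
    iter zero    x = x
    iter (suc i) x = iter i (dbl x)

    iter-dbl : ∀ i x → iter i (dbl x) ≡ dbl (iter i x)
    iter-dbl zero    x = refl
    iter-dbl (suc i) x = iter-dbl i (dbl x)

    iter-injective : ∀ i {x y} → iter i x ≡ iter i y → x ≡ y
    iter-injective zero    eq = eq
    iter-injective (suc i) eq = dbl-injective (iter-injective i eq)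

    iter-+ : ∀ i j x → iter (i + j) x ≡ iter i (iter j x)
    iter-+ i zero    x = cong (λ m → iter m x) (+-identityʳ i)
    iter-+ i (suc j) x = trans (cong (λ m → iter m x) (+-suc i j)) (iter-+ i j (dbl x))

    -- Two of the first `N + 1` iterates agree, and injectivity of doubling strips off the steps
    -- that they have in common.
    someReturn : ∀ x → ∃[ p ] iter (suc p) x ≡ x
    someReturn x with pigeonhole {N} {suc N} ≤-refl (λ i → iter (toℕ i) x)
    ... | i , j , i<j , eq = d , iter-injective (toℕ i) (trans (sym (iter-+ (toℕ i) (suc d) x))
           (trans (cong (λ m → iter m x) (trans (+-suc (toℕ i) d) (m+[n∸m]≡n i<j))) (sym eq)))
      where d = toℕ j ∸ suc (toℕ i)

    abstract
      period : ∀ x → ∃[ p ] (iter (suc p) x ≡ x × (∀ {j} → j < p → iter (suc j) x ≢ x))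
      period x = leastWitness (λ j → iter (suc j) x ≟ᶠ x) (proj₁ (someReturn x)) (proj₂ (someReturn x))

    trajectory : ℕ → Fin N → List (Fin N)
    trajectory zero    x = []
    trajectory (suc l) x = x ∷ trajectory l (dbl x)

    trajectory-length : ∀ l x → length (trajectory l x) ≡ l
    trajectory-length zero    x = refl
    trajectory-length (suc l) x = cong suc (trajectory-length l (dbl x))

    trajectory-next : ∀ {a b} l x → Next a b (trajectory l x) → b ≡ dbl a
    trajectory-next (suc (suc l)) x first         = refl
    trajectory-next (suc l)       x (Inf.there i) = trajectory-next l (dbl x) i
    trajectory-next zero          x (Inf.here ())
    trajectory-next (suc zero)    x (Inf.here (_ ∷ ()))

    ∈-trajectory⁻ : ∀ {y} l x → y ∈ trajectory l x → ∃[ i ] (i < l × y ≡ iter i x)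
    ∈-trajectory⁻ (suc l) x (here eq) = 0 , z<s , eq
    ∈-trajectory⁻ (suc l) x (there m) with ∈-trajectory⁻ l (dbl x) m
    ... | i , i<l , eq = suc i , s<s i<l , eq

    ∈-trajectory⁺ : ∀ {l i} x → i < l → iter i x ∈ trajectory l x
    ∈-trajectory⁺ {suc l} {zero}  x _         = here refl
    ∈-trajectory⁺ {suc l} {suc i} x (s≤s i<l) = there (∈-trajectory⁺ (dbl x) i<l)

    trajectory-step : ∀ {l i} x → suc i < l → Next (iter i x) (iter (suc i) x) (trajectory l x)
    trajectory-step {suc (suc l)} {zero}  x _         = first
    trajectory-step {suc l}       {suc i} x (s≤s i<l) = Inf.there (trajectory-step (dbl x) i<l)
    trajectory-step {suc zero}    {zero}  x (s≤s ())

    trajectory-last : ∀ l x → EndsWith (iter l x) (trajectory (suc l) x)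
    trajectory-last zero    x = [] , refl
    trajectory-last (suc l) x with trajectory-last l (dbl x)
    ... | ys , eq = x ∷ ys , cong (x ∷_) eq

    -- Only returns to the first element have to be excluded: a later repetition can be pulled back
    -- to one, since doubling is injective.
    trajectory-unique : ∀ l x → (∀ {j} → suc j < l → iter (suc j) x ≢ x) → Unique (trajectory l x)
    trajectory-unique zero    x ¬return = []
    trajectory-unique (suc l) x ¬return = All.tabulate x∉ ∷
      trajectory-unique l (dbl x) λ {j} j<l eq →
        ¬return (m<n⇒m<1+n j<l) (dbl-injective (trans (sym (iter-dbl (suc j) x)) eq))
      where
      x∉ : ∀ {y} → y ∈ trajectory l (dbl x) → x ≢ y
      x∉ y∈ x≡y with ∈-trajectory⁻ l (dbl x) y∈
      ... | i , i<l , eq = ¬return (s<s i<l) (sym (trans x≡y eq))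

    -- The cycle is cut behind `x`, so it reads `2x, …, x`. Inserted behind some `v` it adds just
    -- the two pairs `v, 2x` and `x, 2v`.
    orbit : Fin N → List (Fin N)
    orbit x = trajectory (suc (proj₁ (period x))) (dbl x)

    orbit-unique : ∀ x → Unique (orbit x)
    orbit-unique x = trajectory-unique _ (dbl x) λ {j} j<p eq →
      proj₂ (proj₂ (period x)) (≤-pred j<p) (dbl-injective (trans (sym (iter-dbl (suc j) x)) eq))

    orbit-start : ∀ x → StartsWith (dbl x) (orbit x)
    orbit-start x = _ , refl

    orbit-end : ∀ x → EndsWith x (orbit x)
    orbit-end x = subst (λ y → EndsWith y (orbit x)) (proj₁ (proj₂ (period x)))
        (trajectory-last (proj₁ (period x)) (dbl x))

    orbit-next : ∀ {a b} x → Next a b (orbit x) → b ≡ dbl a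
    orbit-next x = trajectory-next _ (dbl x)

    ∈-orbit⁻ : ∀ {y} x → y ∈ orbit x → ∃[ i ] y ≡ iter i x
    ∈-orbit⁻ x y∈ with ∈-trajectory⁻ _ (dbl x) y∈
    ... | i , _ , eq = suc i , eq

    x∈orbit : ∀ x → x ∈ orbit x
    x∈orbit x = subst (_∈ orbit x) (proj₁ (proj₂ (period x))) (∈-trajectory⁺ (dbl x) ≤-refl)

    orbit-step : ∀ {y} x → y ∈ orbit x → y ≢ x → Next y (dbl y) (orbit x)
    orbit-step x y∈ y≢x with ∈-trajectory⁻ _ (dbl x) y∈
    ... | i , s≤s i≤p , refl = subst (λ z → Next (iter i (dbl x)) z (orbit x)) (iter-dbl i (dbl x))
            (trajectory-step (dbl x) (s<s (≤∧≢⇒< i≤p λ { refl → y≢x (proj₁ (proj₂ (period x))) })))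

    orbit-closed : ∀ {y} x → y ∈ orbit x → dbl y ∈ orbit x
    orbit-closed {y} x y∈ with y ≟ᶠ x
    ... | yes refl = here refl
    ... | no y≢x   = next-∈ʳ (orbit-step x y∈ y≢x)

    module _ {B : List (Fin N)} (closed : ∀ {x} → x ∈ B → dbl x ∈ B) where

      closed-iter : ∀ i {x} → x ∈ B → iter i x ∈ B
      closed-iter zero    x∈ = x∈
      closed-iter (suc i) x∈ = closed-iter i (closed x∈)

      -- Doubling permutes a finite set, so halving is an iterate of doubling: going on from `dbl x`
      -- for the rest of the period arrives at `x`.
      closed-half : ∀ {x} → dbl x ∈ B → x ∈ B
      closed-half {x} d∈ with period x
      ... | p , eq , _ = subst (_∈ B) eq (closed-iter p d∈)

      closed-half-iter : ∀ i {x} → iter i x ∈ B → x ∈ B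
      closed-half-iter zero    x∈ = x∈
      closed-half-iter (suc i) x∈ = closed-half (closed-half-iter i x∈)

-- Splicing the doubling cycles into a single one

module MergedCycle where

  open ConsecutivePairs
  open Residues
  open DoublingOrbits
  open import Data.Empty using (⊥-elim)
  open import Data.Fin.Base as Fin using (Fin; toℕ; fromℕ<)
  open import Data.Fin.Properties using (toℕ-injective; toℕ-fromℕ<) renaming (_≟_ to _≟ᶠ_)
  import Data.Integer.Base as ℤ
  open import Data.Integer.Base using (ℤ; +_; 0ℤ)
  import Data.Integer.Properties as ℤ
  open import Data.Integer.Divisibility.Signed using (∣⇒∣ᵤ)
  open import Data.Integer.Tactic.RingSolver using (solve)
  open import Data.List.Base using (List; []; _∷_; _++_; length)
  open import Data.List.Properties using (∷ʳ-injectiveʳ)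
  open import Data.List.Membership.Propositional using (_∈_; _∉_)
  open import Data.List.Membership.Propositional.Properties using (∈-∃++; ∈-++⁺ʳ)
  import Data.List.Membership.DecPropositional as DecMembership
  open import Data.List.Relation.Unary.Any using (here; there)
  open import Data.List.Relation.Unary.Unique.Propositional using (Unique)
  open import Data.Nat.Base
    using (ℕ; zero; suc; _+_; _*_; _∸_; _^_; _≤_; _<_; z≤n; s≤s; z<s; s<s; >-nonZero; NonZero)
  open import Data.Nat.Divisibility using (_∣_; divides; ∣-trans; m∣m*n; ∣n⇒∣m*n; *-monoˡ-∣)
  open import Data.Nat.Properties
  open import Data.Nat.Tactic.RingSolver using () renaming (solve to solveℕ)
  open import Data.Product.Base using (∃-syntax; _×_; _,_; proj₁; proj₂)
  open import Data.Sum.Base using (_⊎_; inj₁; inj₂)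
  open import Relation.Binary.PropositionalEquality using (_≡_; _≢_; refl; sym; trans; cong; cong₂; subst)
  open import Relation.Nullary.Decidable using (yes; no)
  open import Relation.Nullary.Negation using (¬_)

  -- A multiple of 2 ^ p ∸ 1 for 0 < p ≤ l, so that it annihilates every residue of
  -- period at most l under doubling.
  mersenneProduct : ℕ → ℕ
  mersenneProduct zero    = 1
  mersenneProduct (suc l) = (2 ^ suc l ∸ 1) * mersenneProduct l

  mersenne∣product : ∀ {p l} → p < l → 2 ^ suc p ∸ 1 ∣ mersenneProduct l
  mersenne∣product {p} {suc l} p<1+l with m≤n⇒m<n∨m≡n (≤-pred p<1+l)
  ... | inj₁ p<l  = ∣n⇒∣m*n (2 ^ suc l ∸ 1) (mersenne∣product p<l)
  ... | inj₂ refl = m∣m*n (mersenneProduct l)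

  evenOdd : ∀ n → ∃[ m ] (n ≡ 2 * m ⊎ n ≡ suc (2 * m))
  evenOdd zero = 0 , inj₁ refl
  evenOdd (suc n) with evenOdd n
  ... | m , inj₁ refl = m , inj₂ refl
  ... | m , inj₂ refl = suc m , inj₁ (cong suc (sym (+-suc m (m + 0))))

  mersenneProduct≢0 : ∀ l → NonZero (mersenneProduct l)
  mersenneProduct≢0 zero    = _
  mersenneProduct≢0 (suc l) = m*n≢0 (2 ^ suc l ∸ 1) (mersenneProduct l)
    ⦃ >-nonZero (m<n⇒0<n∸m (<-≤-trans (s<s z<s) (*-monoʳ-≤ 2 (m^n>0 2 l)))) ⦄ ⦃ mersenneProduct≢0 l ⦄

  module Construction (k′ : ℕ) (L : ℕ) where
    open Mod (suc k′)
    open Orbits (suc k′)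
    open DecMembership (_≟ᶠ_ {N}) using (_∈?_)

    N-odd : N ≡ suc (2 * (15 * suc k′))
    N-odd = cong suc (*-assoc 2 15 (suc k′))

    abstract
      elem : ∀ {m} → m < N → Fin N
      elem m<N = fromℕ< m<N

      toℕ-elem : ∀ {m} (m<N : m < N) → toℕ (elem m<N) ≡ m
      toℕ-elem m<N = toℕ-fromℕ< m<N

    one : Fin N
    one = elem {1} (s<s z<s)

    dbl-elem : ∀ {m n} (m<N : m < N) (n<N : n < N) → ∀ c → n + c * N ≡ 2 * m → dbl (elem m<N) ≡ elem n<N
    dbl-elem {m} {n} m<N n<N c eq = ι-injective (≈-trans (ι-dbl (elem m<N))
        (go {c = + c} (ι-toℕ (toℕ-elem m<N)) (ι-toℕ (toℕ-elem n<N))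
      (trans (sym (trans (ℤ.pos-+ n (c * N)) (cong (λ z → + n ℤ.+ z) (ℤ.pos-* c N))))
          (trans (cong +_ eq) (ℤ.pos-* 2 m))) N≈0))
      where
      go : ∀ {x y m n c N} → x ≈ m → y ≈ n → n ℤ.+ c ℤ.* N ≡ + 2 ℤ.* m → N ≈ 0ℤ → + 2 ℤ.* x ≈ y
      go {x} {y} {m} {n} {c} {N} h h′ eq h″ = lin₄ (+ 2) (ℤ.- + 1) c (ℤ.- + 1) h h′ h″ (≡⇒≈ eq)
        (solve (x ∷ y ∷ m ∷ n ∷ c ∷ N ∷ []))

    iter-nonzero : ∀ i {x} → toℕ x ≢ 0 → toℕ (iter i x) ≢ 0
    iter-nonzero zero    x≢0 = x≢0
    iter-nonzero (suc i) {x} x≢0 = iter-nonzero i λ d≡0 → x≢0 (ι-zero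
      (cancel (+ 2) (+ 30) refl (≈-trans (≈-sym (ι-dbl x)) (ι-toℕ d≡0))))

    ι-iter : ∀ i x → ι (iter i x) ≈ + (2 ^ i) ℤ.* ι x
    ι-iter zero    x = ≡⇒≈ (sym (ℤ.*-identityˡ (ι x)))
    ι-iter (suc i) x = ≈-trans (ι-iter i (dbl x)) (go (+ (2 ^ i)) (ℤ.pos-* 2 (2 ^ i)) (ι-dbl x))
      where
      go : ∀ c {c′ x y} → c′ ≡ + 2 ℤ.* c → y ≈ + 2 ℤ.* x → c ℤ.* y ≈ c′ ℤ.* x
      go c {_} {x} {y} refl h = lin₁ c h (solve (c ∷ x ∷ y ∷ []))

    returning : ∀ q x → iter q x ≡ x → N ∣ (2 ^ q ∸ 1) * toℕ x
    returning q x eq = subst (N ∣_) abs≡ (∣⇒∣ᵤ (_≈_.divisible (≈-trans (≈-sym (ι-iter q x)) (ι-cong eq))))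
      where
      go : ∀ c x → c ℤ.* x ℤ.- x ≡ (c ℤ.- + 1) ℤ.* x
      go c x = solve (c ∷ x ∷ [])
      abs≡ : ℤ.∣ + (2 ^ q) ℤ.* ι x ℤ.- ι x ∣ ≡ (2 ^ q ∸ 1) * toℕ x
      abs≡ = trans (cong ℤ.∣_∣ (go (+ (2 ^ q)) (ι x))) (trans (ℤ.abs-* (+ (2 ^ q) ℤ.- + 1) (ι x))
        (cong₂ (λ z w → ℤ.∣ z ∣ * ℤ.∣ w ∣) (trans (ℤ.m-n≡m⊖n (2 ^ q) 1) (ℤ.⊖-≥ (m^n>0 2 q))) (ι≡ x)))

    shortOrbit : ∀ x → proj₁ (period x) < L → N ∣ mersenneProduct L * toℕ x
    shortOrbit x p<L = ∣-trans (returning (suc (proj₁ (period x))) x (proj₁ (proj₂ (period x))))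
        (*-monoˡ-∣ (toℕ x) (mersenne∣product p<L))

    -- The edges v → 2w = 2v + 2 and w → 2v = 2w - 2 that arise when the cycle of w is
    -- spliced in behind v = w - 1; w is odd, because it is the least element of its cycle.
    data Link (a b : Fin N) : Set where
      up   : ∀ m → toℕ a ≡ 2 * m       → 2 * toℕ a < N → ι b ≈ + 2 ℤ.* ι a ℤ.+ + 2 → Link a b
      down : ∀ m → toℕ a ≡ suc (2 * m) → 2 * toℕ a < N → ι b ≈ + 2 ℤ.* ι a ℤ.- + 2 → Link a b

    -- `B` is merged from the doubling cycles of `1, …, v` and cut behind `one`, whence `start`,
    -- `end` and the exception made for `one` in `intact`. By `closed` it consists of whole cycles,
    -- so the cycle of a residue outside `B` is disjoint from `B`.
    record Stage (v : ℕ) : Set where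
      field
        B       : List (Fin N)
        links   : List (Fin N × Fin N)
        unique  : Unique B
        nonzero : ∀ {x} → x ∈ B → toℕ x ≢ 0
        closed  : ∀ {x} → x ∈ B → dbl x ∈ B
        covers  : ∀ {x} → toℕ x ≢ 0 → toℕ x ≤ v → x ∈ B
        pairs   : ∀ {a b} → Next a b B → b ≡ dbl a ⊎ (a , b) ∈ links
        linked  : ∀ {a b} → (a , b) ∈ links → Link a b
        intact  : ∀ {a} → a ∈ B → a ≢ one → (∃[ b ] (a , b) ∈ links) ⊎ Next a (dbl a) B
        start   : StartsWith (dbl one) B
        end     : EndsWith one B
        -- The numbers of spliced cycles of length at most L and of greater length.  If the
        -- cycle of w is short, then N divides mersenneProduct L * w, whence short#.
        short long : ℕ
        links#  : length links ≡ 2 * (short + long)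
        short#  : short * N ≤ mersenneProduct L * v
        long#   : long * L ≤ length B

    toℕ≡1⇒one : ∀ {x} → toℕ x ≡ 1 → x ≡ one
    toℕ≡1⇒one eq = toℕ-injective (trans eq (sym (toℕ-elem {1} (s<s z<s))))

    stage₁ : Stage 1
    stage₁ = record
      { B = orbit one ; links = []
      ; unique = orbit-unique one
      ; nonzero = λ {x} x∈ eq → let (i , e) = ∈-orbit⁻ one x∈ in
          iter-nonzero i {one} (λ e → 1+n≢0 (trans (sym (toℕ-elem {1} (s<s z<s))) e))
              (trans (cong toℕ (sym e)) eq)
      ; closed = orbit-closed one
      ; covers = λ x≢0 x≤1 → subst (_∈ orbit one) (sym (toℕ≡1⇒one (≤-antisym x≤1 (n≢0⇒n>0 x≢0)))) (x∈orbit one)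
      ; pairs = λ i → inj₁ (orbit-next one i)
      ; linked = λ ()
      ; intact = λ a∈ a≢1 → inj₂ (orbit-step one a∈ a≢1)
      ; start = orbit-start one ; end = orbit-end one
      ; short = 0 ; long = 0 ; links# = refl ; short# = z≤n ; long# = z≤n
      }

    private variable
      v : ℕ

    module Step (S : Stage v) (v≥1 : 1 ≤ v) (w<N : suc v < N) where
      open Stage S

      w : Fin N
      w = elem w<N

      v<N : v < N
      v<N = <-trans ≤-refl w<N

      v̂ : Fin N
      v̂ = elem v<N

      elem∈B : ∀ {m} (m<N : m < N) → 1 ≤ m → m ≤ v → elem m<N ∈ B
      elem∈B m<N 1≤m m≤v = covers (λ e → n≮0 (subst (1 ≤_) (trans (sym (toℕ-elem m<N)) e) 1≤m))
                                  (subst (_≤ v) (sym (toℕ-elem m<N)) m≤v)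

      covers-suc : ∀ {B′ : List (Fin N)} → (∀ {x} → x ∈ B → x ∈ B′) → w ∈ B′ →
                   ∀ {x} → toℕ x ≢ 0 → toℕ x ≤ suc v → x ∈ B′
      covers-suc old new {x} x≢0 x≤ with m≤n⇒m<n∨m≡n x≤
      ... | inj₁ x<w = old (covers x≢0 (≤-pred x<w))
      ... | inj₂ x≡w = subst (_∈ _) (toℕ-injective (trans (toℕ-elem w<N) (sym x≡w))) new

      short#-suc : short * N ≤ mersenneProduct L * suc v
      short#-suc = ≤-trans short# (*-monoʳ-≤ (mersenneProduct L) (n≤1+n v))

      skip : w ∈ B → Stage (suc v)
      skip w∈B = record
        { Stage S hiding (covers; short#)
        ; covers = covers-suc (λ x∈ → x∈) w∈B ; short# = short#-suc }

      module Insert (w∉B : w ∉ B) where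

        -- An even w is the double of a smaller number, and if 2w > N then
        -- 2w - N < w is the double of w.
        v-even : ∃[ m ] v ≡ 2 * m
        v-even with evenOdd v
        ... | m , inj₁ eq = m , eq
        ... | m , inj₂ eq = ⊥-elim (w∉B (subst (_∈ B)
                (dbl-elem 1+m<N w<N 0 (trans (+-identityʳ (suc v))
                    (trans (cong suc eq) (cong suc (sym (+-suc m (m + 0)))))))
                (closed (elem∈B 1+m<N z<s (subst (suc m ≤_) (sym eq) (s≤s (m≤m+n m (m + 0))))))))
          where
          1+m<N : suc m < N
          1+m<N = ≤-<-trans (≤-trans (s≤s (m≤m+n m (m + 0))) (≤-trans (≤-reflexive (sym eq)) (n≤1+n v))) w<N

        2w<N : 2 * suc v < N
        2w<N with 2 * suc v <? N
        ... | yes p = p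
        ... | no ¬p = ⊥-elim (w∉B (closed-half closed (subst (_∈ B) (sym (dbl-elem w<N e<N 1 eq))
            (elem∈B e<N e≥1 e≤v))))
          where
          e = 2 * suc v ∸ N
          N≤2w : N ≤ 2 * suc v
          N≤2w = ≮⇒≥ ¬p
          eq : e + 1 * N ≡ 2 * suc v
          eq = trans (cong (λ z → e + z) (*-identityˡ N)) (m∸n+n≡m N≤2w)
          e≥1 : 1 ≤ e
          e≥1 = m<n⇒0<n∸m (≤∧≢⇒< N≤2w λ N≡2w → even≢odd (suc v) (15 * suc k′) (trans (sym N≡2w) N-odd))
          e≤v : e ≤ v
          e≤v = +-cancelʳ-≤ N e v (subst (_≤ v + N) (sym (trans (cong (λ z → e + z) (sym (*-identityˡ N))) eq))
            (subst (_≤ v + N) (cong (λ z → suc v + z) (sym (*-identityˡ (suc v))))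
               (subst (_≤ v + N) (+-suc v (suc v)) (+-monoʳ-≤ v w<N))))
          e<N : e < N
          e<N = ≤-<-trans e≤v v<N

        2v<N : 2 * v < N
        2v<N = <-trans (*-monoʳ-< 2 ≤-refl) 2w<N

        v̂∈B : v̂ ∈ B
        v̂∈B = elem∈B v<N v≥1 ≤-refl

        v̂≢one : v̂ ≢ one
        v̂≢one eq with v-even
        ... | m , v≡2m = even≢odd m 0 (trans (sym v≡2m) (trans (sym (toℕ-elem v<N))
            (trans (cong toℕ eq) (toℕ-elem {1} (s<s z<s)))))

        ι-w : ι w ≈ ι v̂ ℤ.+ + 1
        ι-w = ≈-trans (ι-toℕ (toℕ-elem w<N)) (≈-trans (≡⇒≈ (trans (cong +_ (+-comm 1 v)) (ℤ.pos-+ v 1)))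
                (go (ι-toℕ (toℕ-elem v<N))))
          where
          go : ∀ {x y} → x ≈ y → y ℤ.+ + 1 ≈ x ℤ.+ + 1
          go {x} {y} h = lin₁ (ℤ.- + 1) h (solve (x ∷ y ∷ []))

        up-link : Link v̂ (dbl w)
        up-link = up (proj₁ v-even) (trans (toℕ-elem v<N) (proj₂ v-even))
            (subst (λ z → 2 * z < N) (sym (toℕ-elem v<N)) 2v<N)
          (go {v = ι v̂} (ι-dbl w) ι-w)
          where
          go : ∀ {d w v} → d ≈ + 2 ℤ.* w → w ≈ v ℤ.+ + 1 → d ≈ + 2 ℤ.* v ℤ.+ + 2
          go {d} {w} {v} h h′ = lin₂ (+ 1) (+ 2) h h′ (solve (d ∷ w ∷ v ∷ []))

        down-link : Link w (dbl v̂)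
        down-link = down (proj₁ v-even) (trans (toℕ-elem w<N) (cong suc (proj₂ v-even)))
            (subst (λ z → 2 * z < N) (sym (toℕ-elem w<N)) 2w<N)
          (go {v = ι v̂} (ι-dbl v̂) ι-w)
          where
          go : ∀ {d w v} → d ≈ + 2 ℤ.* v → w ≈ v ℤ.+ + 1 → d ≈ + 2 ℤ.* w ℤ.- + 2
          go {d} {w} {v} h h′ = lin₂ (+ 1) (ℤ.- (+ 2)) h h′ (solve (d ∷ w ∷ v ∷ []))

        -- A link of type `up` out of `v̂` would lead to `2w`, which would put `w` into the closed
        -- set `B`; a link of type `down` starts at an odd number, but `v` is even. So `v̂` has not
        -- been used for splicing, and its double still stands behind it.
        no-link : ∀ {b} → Link v̂ b → b ∉ B
        no-link (up _ _ _ h) b∈B = w∉B (closed-half closed (subst (_∈ B)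
            (ι-injective (≈-trans h (go {v = ι v̂} (ι-dbl w) ι-w))) b∈B))
          where
          go : ∀ {d w v} → d ≈ + 2 ℤ.* w → w ≈ v ℤ.+ + 1 → + 2 ℤ.* v ℤ.+ + 2 ≈ d
          go {d} {w} {v} h h′ = lin₂ (ℤ.- (+ 1)) (ℤ.- (+ 2)) h h′ (solve (d ∷ w ∷ v ∷ []))
        no-link (down m odd _ _) _ with v-even
        ... | m′ , even = even≢odd m′ m (trans (sym even) (trans (sym (toℕ-elem v<N)) odd))

        splitting : ∃[ ys ] ∃[ zs ] B ≡ ys ++ v̂ ∷ dbl v̂ ∷ zs
        splitting with ∈-∃++ v̂∈B
        ... | ys , [] , eq with end
        -- `v̂` cannot be the last element: that is `one`, and `v` is even.
        ...   | cs , eq′ = ⊥-elim (v̂≢one (∷ʳ-injectiveʳ ys cs (trans (sym eq) eq′)))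
        splitting | ys , b ∷ zs , eq with pairs (subst (Next v̂ b) (sym eq) (next-mid ys))
        ... | inj₁ refl = ys , zs , eq
        ... | inj₂ l    = ⊥-elim (no-link (linked l) (subst (b ∈_) (sym eq) (∈-++⁺ʳ ys (there (here refl)))))

        O : List (Fin N)
        O = orbit w

        extend : ∀ {ys zs} → B ≡ ys ++ v̂ ∷ dbl v̂ ∷ zs → Stage (suc v)
        extend {ys} {zs} refl = record
          { B = B′ ; links = links′
          ; unique = unique-insert ys unique (orbit-unique w) disjoint
          ; nonzero = λ x∈ → nonzero′ (∈-insert⁻ ys O x∈)
          ; closed = λ x∈ → closed′ (∈-insert⁻ ys O x∈)
          ; covers = covers-suc (∈-insert⁺ ys O) (∈-inserted ys (x∈orbit w))
          ; pairs = λ i → pairs′ (next-insert⁻ ys O i)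
          ; linked = linked′
          ; intact = λ a∈ a≢1 → intact′ (∈-insert⁻ ys O a∈) a≢1
          ; start = startsWith-prefix ys start
          ; end = end′
          ; short = proj₁ (proj₁ counts) ; long = proj₂ (proj₁ counts)
          ; links# = proj₁ (proj₂ counts)
          ; short# = proj₁ (proj₂ (proj₂ counts)) ; long# = proj₂ (proj₂ (proj₂ counts)) }
          where
          B′ = ys ++ v̂ ∷ O ++ dbl v̂ ∷ zs
          links′ = (v̂ , dbl w) ∷ (w , dbl v̂) ∷ links

          disjoint : ∀ {x} → ¬ (x ∈ O × x ∈ B)
          disjoint (x∈O , x∈B) with ∈-orbit⁻ w x∈O
          ... | i , refl = w∉B (closed-half-iter closed i x∈B)

          w≢0 : toℕ w ≢ 0
          w≢0 eq = 1+n≢0 (trans (sym (toℕ-elem w<N)) eq)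

          nonzero′ : ∀ {x} → x ∈ O ⊎ x ∈ B → toℕ x ≢ 0
          nonzero′ (inj₁ x∈) with ∈-orbit⁻ w x∈
          ... | i , refl = iter-nonzero i w≢0
          nonzero′ (inj₂ x∈) = nonzero x∈

          closed′ : ∀ {x} → x ∈ O ⊎ x ∈ B → dbl x ∈ B′
          closed′ (inj₁ x∈) = ∈-inserted ys (orbit-closed w x∈)
          closed′ (inj₂ x∈) = ∈-insert⁺ ys O (closed x∈)

          pairs′ : ∀ {a b} → (a ≡ v̂ × StartsWith b (O ++ dbl v̂ ∷ zs)) ⊎ Next a b O ⊎
              (EndsWith a O × b ≡ dbl v̂) ⊎ Next a b B →
                   b ≡ dbl a ⊎ (a , b) ∈ links′
          pairs′ (inj₁ (refl , _ , refl)) = inj₂ (here refl)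
          pairs′ (inj₂ (inj₁ i)) = inj₁ (orbit-next w i)
          pairs′ (inj₂ (inj₂ (inj₁ ((as , eq) , refl)))) with orbit-end w
          ... | bs , eq′ with refl ← ∷ʳ-injectiveʳ as bs (trans (sym eq) eq′) = inj₂ (there (here refl))
          pairs′ (inj₂ (inj₂ (inj₂ i))) with pairs i
          ... | inj₁ eq = inj₁ eq
          ... | inj₂ l  = inj₂ (there (there l))

          linked′ : ∀ {a b} → (a , b) ∈ links′ → Link a b
          linked′ (here refl)         = up-link
          linked′ (there (here refl)) = down-link
          linked′ (there (there l))   = linked l

          intact′ : ∀ {a} → a ∈ O ⊎ a ∈ B → a ≢ one → (∃[ b ] (a , b) ∈ links′) ⊎ Next a (dbl a) B′
          intact′ {a} (inj₁ a∈) _ with a ≟ᶠ w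
          ... | yes refl = inj₁ (_ , there (here refl))
          ... | no a≢w   = inj₂ (next-inserted ys (orbit-step w a∈ a≢w))
          intact′ {a} (inj₂ a∈) a≢1 with intact a∈ a≢1
          ... | inj₁ (b , l) = inj₁ (b , there (there l))
          ... | inj₂ i with next-insert⁺ ys O i
          ...   | inj₁ (refl , _) = inj₁ (_ , here refl)
          ...   | inj₂ j          = inj₂ j

          end′ : EndsWith one B′
          end′ = endsWith-insert ys O end

          length-B′ : length B′ ≡ length O + length B
          length-B′ = length-insert ys O

          counts : ∃[ sl ] (length links′ ≡ 2 * (proj₁ sl + proj₂ sl) × proj₁ sl * N ≤ mersenneProduct L * suc v
              × proj₂ sl * L ≤ length B′)
          counts with L ≤? proj₁ (period w)
          -- The number stored in `period` is one less than the length of the cycle, so this cycle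
          -- contributes more than `L` vertices to `B′`.
          ... | yes L≤p = (short , suc long) ,
            trans (cong (λ z → 2 + z) links#) (solveℕ (short ∷ long ∷ [])) , short#-suc ,
            subst (L + long * L ≤_) (sym length-B′) (+-mono-≤
                (subst (L ≤_) (sym (trajectory-length (suc (proj₁ (period w))) (dbl w)))
                    (≤-trans L≤p (n≤1+n _))) long#)
          ... | no L≰p = (suc short , long) , trans (cong (λ z → 2 + z) links#) (solveℕ (short ∷ long ∷ [])) ,
            one-more (shortOrbit w (≰⇒> L≰p)) ,
            ≤-trans long# (subst (length B ≤_) (sym length-B′) (m≤n+m (length B) (length O)))
            where
            -- Each short cycle uses up a new multiple of `N`: the old bound puts `short * N` at
            -- most at `mersenneProduct L * v`, strictly below `mersenneProduct L * w = q * N`.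
            -- Hence `short < q`.
            one-more : N ∣ mersenneProduct L * toℕ w → suc short * N ≤ mersenneProduct L * suc v
            one-more (divides q eq) = subst (suc short * N ≤_)
                (trans (sym eq) (cong (mersenneProduct L *_) (toℕ-elem w<N)))
              (*-monoˡ-≤ N (*-cancelʳ-< N short q (≤-<-trans short# (subst (mersenneProduct L * v <_)
                 (trans (cong (mersenneProduct L *_) (sym (toℕ-elem w<N))) eq)
                     (*-monoʳ-< (mersenneProduct L) ⦃ mersenneProduct≢0 L ⦄ ≤-refl)))))

      step : Stage (suc v)
      step with w ∈? B
      ... | yes w∈B = skip w∈B
      ... | no w∉B with Insert.splitting w∉B
      ...   | _ , _ , eq = Insert.extend w∉B eq

    stage : ∀ v → suc v < N → Stage (suc v)
    stage zero    _   = stage₁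
    stage (suc v) v<N = Step.step (stage v (<-trans ≤-refl v<N)) z<s v<N

-- Two paths that have only edges of a given difference in common

module ChainPaths where

  open ConsecutivePairs
  open import Data.Empty using (⊥-elim)
  open import Data.List.Base using (List; []; _∷_; _++_; concatMap; upTo; downFrom; applyUpTo)
  open import Data.List.Properties using (∷-injectiveʳ)
  open import Data.List.Membership.Propositional using (_∈_)
  open import Data.List.Membership.Propositional.Properties
    using (∈-++⁺ʳ; ∈-++⁻; ∈-upTo⁺; ∈-upTo⁻; ∈-downFrom⁺; ∈-downFrom⁻)
  open import Data.List.Relation.Unary.All as All using (All; []; _∷_)
  open import Data.List.Relation.Unary.AllPairs using ([]; _∷_)
  open import Data.List.Relation.Unary.Any using (here; there)
  open import Data.List.Relation.Unary.Unique.Propositional using (Unique)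
  import Data.List.Relation.Unary.Unique.Propositional.Properties as Unique
  open import Data.List.Relation.Binary.Infix.Heterogeneous as Inf using ()
  open import Data.List.Relation.Binary.Prefix.Heterogeneous using ([]; _∷_)
  open import Data.Nat.Base
  open import Data.Nat.DivMod using (_%_; _/_; m≡m%n+[m/n]*n; [m+kn]%n≡m%n; m<n⇒m%n≡m; m%n<n; m%n≤m)
  open import Data.Nat.Properties
  open import Data.Product.Base using (∃-syntax; _×_; _,_; proj₁; proj₂)
  open import Data.Sum.Base using (_⊎_; inj₁; inj₂)
  open import Relation.Binary.PropositionalEquality using (_≡_; refl; sym; trans; cong; subst)
  open import Relation.Nullary.Decidable using (yes; no)

  module Chain (n s : ℕ) .⦃ s≢0 : NonZero s ⦄ where

    chainFrom : ℕ → ℕ → List ℕ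
    chainFrom zero       j = []
    chainFrom (suc fuel) j with j <? n
    ... | yes _ = j ∷ chainFrom fuel (j + s)
    ... | no _  = []

    chainFrom-∈ : ∀ fuel j {x} → x ∈ chainFrom fuel j → x < n × j ≤ x × ∃[ i ] x ≡ j + i * s
    chainFrom-∈ (suc fuel) j x∈ with j <? n
    chainFrom-∈ (suc fuel) j (here refl) | yes j<n = j<n , ≤-refl , 0 , sym (+-identityʳ j)
    chainFrom-∈ (suc fuel) j (there x∈)  | yes j<n with chainFrom-∈ fuel (j + s) x∈
    ... | x<n , j+s≤x , i , eq = x<n , ≤-trans (m≤m+n j s) j+s≤x , suc i , trans eq (+-assoc j s (i * s))
    chainFrom-∈ (suc fuel) j () | no _

    chainFrom-start : ∀ fuel {j b ys} → chainFrom fuel j ≡ b ∷ ys → b ≡ j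
    chainFrom-start (suc fuel) {j} eq with j <? n
    chainFrom-start (suc fuel) refl | yes _ = refl

    chainFrom-unique : ∀ fuel j → Unique (chainFrom fuel j)
    chainFrom-unique zero       j = []
    chainFrom-unique (suc fuel) j with j <? n
    ... | yes _ = All.tabulate (λ x∈ → <⇒≢ (<-≤-trans (m<m+n j (>-nonZero⁻¹ s))
        (proj₁ (proj₂ (chainFrom-∈ fuel (j + s) x∈))))) ∷ chainFrom-unique fuel (j + s)
    ... | no _  = []

    chainFrom-next : ∀ fuel j {a b} → Next a b (chainFrom fuel j) → b ≡ a + s
    chainFrom-next zero       j (Inf.here ())
    chainFrom-next (suc fuel) j i with j <? n
    chainFrom-next (suc fuel) j (Inf.here ()) | no _
    chainFrom-next (suc fuel) j i | yes _ with next-∷⁻ i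
    ... | inj₁ (refl , ys , eq) = chainFrom-start fuel eq
    ... | inj₂ i′               = chainFrom-next fuel (j + s) i′

    Suffices : ℕ → ℕ → Set
    Suffices fuel j = n ≤ fuel + j

    suffices-suc : ∀ {fuel j} → Suffices (suc fuel) j → Suffices fuel (j + s)
    suffices-suc {fuel} {j} h = ≤-trans h (≤-trans (≤-reflexive (sym (+-suc fuel j)))
      (+-monoʳ-≤ fuel (≤-trans (≤-reflexive (+-comm 1 j)) (+-monoʳ-≤ j (>-nonZero⁻¹ s)))))

    chainFrom-end : ∀ fuel j {a} → Suffices fuel j → EndsWith a (chainFrom fuel j) → n ≤ a + s
    chainFrom-end zero j h ([] , ())
    chainFrom-end zero j h (_ ∷ _ , ())
    chainFrom-end (suc fuel) j h e with j <? n
    chainFrom-end (suc fuel) j h ([] , ()) | no _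
    chainFrom-end (suc fuel) j h (_ ∷ _ , ()) | no _
    chainFrom-end (suc fuel) j h e | yes _ with chainFrom fuel (j + s) in eq
    chainFrom-end (suc fuel) j h ([] , refl) | yes _ | [] with n ≤? j + s
    ... | yes p = p
    ... | no ¬p with fuel | suffices-suc {fuel} {j} h
    ...   | zero | q = ⊥-elim (¬p q)
    ...   | suc fuel′ | _ with j + s <? n
    ...     | no ¬q = ⊥-elim (¬p (≮⇒≥ ¬q))
    chainFrom-end (suc fuel) j h (_ ∷ [] , ()) | yes _ | []
    chainFrom-end (suc fuel) j h (_ ∷ _ ∷ _ , ()) | yes _ | []
    chainFrom-end (suc fuel) j h ([] , ()) | yes _ | _ ∷ _
    chainFrom-end (suc fuel) j h (_ ∷ ws , eq′) | yes _ | _ ∷ _ = chainFrom-end fuel (j + s)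
        (suffices-suc {fuel} h) (ws , trans eq (∷-injectiveʳ eq′))

    chainFrom-step : ∀ fuel j i → Suffices fuel j → j + i * s + s < n → Next (j + i * s) (j + i * s + s)
        (chainFrom fuel j)
    chainFrom-step zero j i h lt = ⊥-elim (<⇒≱ lt (≤-trans h (≤-trans (m≤m+n j (i * s)) (m≤m+n _ s))))
    chainFrom-step (suc fuel) j i h lt with j <? n
    ... | no ¬p = ⊥-elim (¬p (≤-<-trans (≤-trans (m≤m+n j (i * s)) (m≤m+n _ s)) lt))
    chainFrom-step (suc fuel) j (suc i) h lt | yes _ =
      Inf.there (subst (λ z → Next z (z + s) (chainFrom fuel (j + s))) (+-assoc j s (i * s))
        (chainFrom-step fuel (j + s) i (suffices-suc {fuel} h)
            (subst (λ z → z + s < n) (sym (+-assoc j s (i * s))) lt)))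
    chainFrom-step (suc zero) j zero h lt | yes _ = ⊥-elim (<⇒≱ (subst (λ z → z + s < n) (+-identityʳ j) lt)
        (suffices-suc {zero} {j} h))
    chainFrom-step (suc (suc fuel)) j zero h lt | yes _ with j + s <? n
    ... | yes _ rewrite +-identityʳ j = first
    ... | no ¬p = ⊥-elim (¬p (subst (λ z → z + s < n) (+-identityʳ j) lt))

    chain : ℕ → List ℕ
    chain = chainFrom n

    suffices : ∀ j → Suffices n j
    suffices j = m≤m+n n j

    mod-chain : ∀ {x j} → j < s → x ∈ chain j → x % s ≡ j
    mod-chain {x} {j} j<s x∈ with chainFrom-∈ n j x∈
    ... | _ , _ , i , refl = trans ([m+kn]%n≡m%n j i s) (m<n⇒m%n≡m j<s)

    rows : List ℕ → List ℕ
    rows = concatMap chain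

    ∈-rows : ∀ js {x} → (∀ {j} → j ∈ js → j < s) → x ∈ rows js → x < n × x % s ∈ js
    ∈-rows (j ∷ js) js<s x∈ with ∈-++⁻ (chain j) x∈
    ... | inj₁ m = proj₁ (chainFrom-∈ n j m) , here (mod-chain (js<s (here refl)) m)
    ... | inj₂ m with ∈-rows js (λ j∈ → js<s (there j∈)) m
    ...   | x<n , m′ = x<n , there m′

    rows-unique : ∀ js → (∀ {j} → j ∈ js → j < s) → Unique js → Unique (rows js)
    rows-unique []       _    _        = []
    rows-unique (j ∷ js) js<s (j≢ ∷ U) = Unique.++⁺ (chainFrom-unique n j)
        (rows-unique js (λ j∈ → js<s (there j∈)) U)
      λ { (m , m′) → All.lookup j≢ (proj₂ (∈-rows js (λ j∈ → js<s (there j∈)) m′))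
          (sym (mod-chain (js<s (here refl)) m)) }

    -- A pair that is not a step of length `s` joins the top of a row to the bottom of the next one.
    -- The inequalities say that `a` is a top and that `b` is not; so the same edge cannot be a
    -- joint in the reverse direction elsewhere. Every row listed has a second element, hence none
    -- is empty and no joint skips a row.
    rows-next : ∀ js {a b} → (∀ {j} → j ∈ js → j < s × j + s < n) → Next a b (rows js) →
                b ≡ a + s ⊎ (n ≤ a + s × b + s < n × Next (a % s) b js)
    rows-next [] ok (Inf.here ())
    rows-next (j ∷ js) ok i with next-++⁻ (chain j) i
    ... | inj₁ i′ = inj₁ (chainFrom-next n j i′)
    ... | inj₂ (inj₁ i′) with rows-next js (λ j∈ → ok (there j∈)) i′
    ...   | inj₁ eq = inj₁ eq
    ...   | inj₂ (le , lt , i″) = inj₂ (le , lt , Inf.there i″)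
    rows-next (j ∷ []) ok i | inj₂ (inj₂ (_ , _ , ()))
    rows-next (j ∷ j′ ∷ js) {a} {b} ok i | inj₂ (inj₂ ((ws , eq) , ys , eq′)) = inj₂
        (chainFrom-end n j (suffices j) (ws , eq) ,
      subst (λ z → z + s < n) (sym b≡j′) (proj₂ (ok (there (here refl)))) ,
      subst (λ z → Next z b (j ∷ j′ ∷ js)) (sym (mod-chain (proj₁ (ok (here refl)))
          (subst (a ∈_) (sym eq) (∈-++⁺ʳ ws (here refl)))))
        (subst (λ z → Next j z (j ∷ j′ ∷ js)) (sym b≡j′) first))
      where
      startRows : ∀ {ys} → chain j′ ++ rows js ≡ b ∷ ys → b ≡ j′
      startRows eq with chain j′ in eqc
      startRows refl | _ ∷ _ = chainFrom-start n eqc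
      startRows eq | [] with () ← subst (j′ + 0 * s ∈_) eqc (next-∈ˡ
          (chainFrom-step n j′ 0 (suffices j′) (subst (λ z → z + s < n) (sym (+-identityʳ j′))
              (proj₂ (ok (there (here refl)))))))
      b≡j′ : b ≡ j′
      b≡j′ = startRows eq′

    rows-step : ∀ js {a} → a + s < n → a % s ∈ js → Next a (a + s) (rows js)
    rows-step (j ∷ js) {a} lt (here eq) = subst (λ z → Next z (z + s) (chain j)) (sym a≡) step Inf.ⁱ++ rows js
      where
      a≡ : a ≡ j + (a / s) * s
      a≡ = trans (m≡m%n+[m/n]*n a s) (cong (_+ (a / s) * s) eq)
      step = chainFrom-step n j (a / s) (suffices j) (subst (λ z → z + s < n) a≡ lt)
    rows-step (j ∷ js) lt (there m) = chain j Inf.++ⁱ rows-step js lt m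

    -- Only the rows j < s ⊓ (n ∸ s) have a second element.
    rowCount : ℕ
    rowCount = s ⊓ (n ∸ s)

    upNext : ∀ {a b} m → Next a b (upTo m) → b ≡ suc a
    upNext = go (λ j → j) (λ _ → refl)
      where
      go : ∀ f → (∀ j → f (suc j) ≡ suc (f j)) → ∀ {a b} m → Next a b (applyUpTo f m) → b ≡ suc a
      go f step (suc (suc m)) first         = step 0
      go f step (suc m)       (Inf.there i) = go (λ j → f (suc j)) (λ j → step (suc j)) m i
      go f step (suc zero)    (Inf.here (_ ∷ ()))
      go f step zero          (Inf.here ())

    downNext : ∀ {a b} m → Next a b (downFrom m) → a ≡ suc b
    downNext (suc (suc m)) first         = refl
    downNext (suc m)       (Inf.there i) = downNext m i
    downNext (suc zero)    (Inf.here (_ ∷ ()))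
    downNext zero          (Inf.here ())

    module _ (s<n : s < n) where

      row-ok : ∀ {j} → j < rowCount → j < s × j + s < n
      row-ok {j} lt = m≤n⊓o⇒m≤n s (n ∸ s) lt , m≤o∸n⇒m+n≤o (suc j) (<⇒≤ s<n) (m≤n⊓o⇒m≤o s (n ∸ s) lt)

      upRows downRows : List ℕ
      upRows   = rows (upTo rowCount)
      downRows = rows (downFrom rowCount)

      up-ok : ∀ {j} → j ∈ upTo rowCount → j < s × j + s < n
      up-ok j∈ = row-ok (∈-upTo⁻ j∈)

      down-ok : ∀ {j} → j ∈ downFrom rowCount → j < s × j + s < n
      down-ok j∈ = row-ok (∈-downFrom⁻ j∈)

      up-∈ : ∀ {x} → x ∈ upRows → x < n
      up-∈ x∈ = proj₁ (∈-rows (upTo rowCount) (λ j∈ → proj₁ (up-ok j∈)) x∈)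

      down-∈ : ∀ {x} → x ∈ downRows → x < n
      down-∈ x∈ = proj₁ (∈-rows (downFrom rowCount) (λ j∈ → proj₁ (down-ok j∈)) x∈)

      up-unique : Unique upRows
      up-unique = rows-unique (upTo rowCount) (λ j∈ → proj₁ (up-ok j∈)) (Unique.upTo⁺ rowCount)

      down-unique : Unique downRows
      down-unique = rows-unique (downFrom rowCount) (λ j∈ → proj₁ (down-ok j∈)) (Unique.downFrom⁺ rowCount)

      row-< : ∀ {a} → a + s < n → a % s < rowCount
      row-< {a} lt = ⊓-glb (m%n<n a s) (m+n≤o⇒m≤o∸n (suc (a % s)) (≤-<-trans (+-monoˡ-≤ s (m%n≤m a s)) lt))

      up-step : ∀ {a} → a + s < n → Next a (a + s) upRows
      up-step lt = rows-step (upTo rowCount) lt (∈-upTo⁺ (row-< lt))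

      down-step : ∀ {a} → a + s < n → Next a (a + s) downRows
      down-step lt = rows-step (downFrom rowCount) lt (∈-downFrom⁺ (row-< lt))

      -- A link of upRows goes from the top of row j to the bottom of row j + 1,
      -- a link of downRows from the top of row j + 1 to the bottom of row j.
      common : ∀ {a b} → Next a b upRows ⊎ Next b a upRows → Next a b downRows ⊎ Next b a downRows →
               b ≡ a + s ⊎ a ≡ b + s
      common (inj₁ i) (inj₁ i′) with rows-next (upTo rowCount) up-ok i | rows-next (downFrom rowCount) down-ok
          i′
      ... | inj₁ eq | _ = inj₁ eq
      ... | inj₂ _ | inj₁ eq = inj₁ eq
      ... | inj₂ (_ , _ , l) | inj₂ (_ , _ , l′) = ⊥-elim (m≢1+n+m _
          (trans (upNext _ l) (cong suc (downNext _ l′))))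
      common (inj₂ i) (inj₂ i′) with common (inj₁ i) (inj₁ i′)
      ... | inj₁ eq = inj₂ eq
      ... | inj₂ eq = inj₁ eq
      common (inj₁ i) (inj₂ i′) with rows-next (upTo rowCount) up-ok i | rows-next (downFrom rowCount) down-ok
          i′
      ... | inj₁ eq | _ = inj₁ eq
      ... | inj₂ _ | inj₁ eq = inj₂ eq
      ... | inj₂ (_ , lt , _) | inj₂ (le , _ , _) = ⊥-elim (<⇒≱ lt le)
      common (inj₂ i) (inj₁ i′) with common (inj₁ i) (inj₂ i′)
      ... | inj₁ eq = inj₂ eq
      ... | inj₂ eq = inj₁ eq

-- Cutting a cycle elsewhere, and inserting marked elements

module Rerouting where

  open ConsecutivePairs
  open import Data.Empty using (⊥-elim)
  open import Data.List.Base using (List; []; _∷_; _++_)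
  open import Data.List.Membership.Propositional using (_∈_; _∉_)
  open import Data.List.Membership.Propositional.Properties using (∈-++⁺ʳ)
  open import Data.List.Properties using (++-assoc)
  open import Data.List.Relation.Binary.Infix.Heterogeneous as Inf using (_++ⁱ_; _ⁱ++_)
  open import Data.List.Relation.Binary.Permutation.Propositional using (_↭_; ↭-trans; ↭-reflexive; ↭⇒↭ₛ)
  open import Data.List.Relation.Binary.Permutation.Propositional.Properties using (++-comm)
  import Data.List.Relation.Binary.Permutation.Setoid.Properties as Perm
  open import Data.List.Relation.Binary.Prefix.Heterogeneous using ([]; _∷_)
  open import Data.List.Relation.Unary.All as All using (All; []; _∷_)
  import Data.List.Relation.Unary.All.Properties as All
  open import Data.List.Relation.Unary.AllPairs using ([]; _∷_)
  open import Data.List.Relation.Unary.Any using (here; there)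
  open import Data.List.Relation.Unary.Unique.Propositional using (Unique)
  import Data.List.Relation.Unary.Unique.Propositional.Properties as Unique
  open import Data.Maybe.Base using (Maybe; just; nothing)
  open import Data.Product.Base using (∃-syntax; _×_; _,_)
  open import Data.Sum.Base using (_⊎_; inj₁; inj₂)
  open import Relation.Binary.PropositionalEquality using (_≡_; _≢_; refl; sym; subst; setoid)
  open import Relation.Nullary.Negation using (¬_)

  module _ {A : Set} {a : A} where

    -- The list stands for a cycle, which is cut behind `a` instead of behind its last element.
    rotation-↭ : ∀ ys zs → ys ++ a ∷ zs ↭ zs ++ ys ++ a ∷ []
    rotation-↭ ys zs = ↭-trans (↭-reflexive (sym (++-assoc ys (a ∷ []) zs))) (++-comm (ys ++ a ∷ []) zs)

    rotation-unique : ∀ ys zs → Unique (ys ++ a ∷ zs) → Unique (zs ++ ys ++ a ∷ [])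
    rotation-unique ys zs = Perm.Unique-resp-↭ (setoid A) (↭⇒↭ₛ (rotation-↭ ys zs))

    rotation-next⁺ : ∀ ys zs {x y} → x ≢ a → Next x y (ys ++ a ∷ zs) → Next x y (zs ++ ys ++ a ∷ [])
    rotation-next⁺ ys zs x≢a i with next-++⁻ ys i
    ... | inj₁ j = zs ++ⁱ (j ⁱ++ (a ∷ []))
    ... | inj₂ (inj₂ ((us , refl) , _ , refl)) = zs ++ⁱ subst (Next _ _) (sym (++-assoc us (_ ∷ []) (a ∷ [])))
        (next-mid us)
    ... | inj₂ (inj₁ j) with next-∷⁻ j
    ...   | inj₁ (x≡a , _) = ⊥-elim (x≢a x≡a)
    ...   | inj₂ j′        = j′ ⁱ++ (ys ++ a ∷ [])

    rotation-next⁻ : ∀ ys zs {x y} → Unique (ys ++ a ∷ zs) → Next x y (zs ++ ys ++ a ∷ []) →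
      (x ≢ a × Next x y (ys ++ a ∷ zs)) ⊎ (EndsWith x zs × StartsWith y (ys ++ a ∷ []))
    rotation-next⁻ ys zs {x} {y} U i with next-++⁻ zs i
    ... | inj₁ j        = inj₁ ((λ { refl → a∉zs ys U (next-∈ˡ j) }) , ys ++ⁱ Inf.there j)
      where
      a∉zs : ∀ ys → Unique (ys ++ a ∷ zs) → a ∉ zs
      a∉zs []       (a≢ ∷ _) m = All.lookup a≢ m refl
      a∉zs (_ ∷ ys) (_ ∷ U)  m = a∉zs ys U m
    ... | inj₂ (inj₂ e) = inj₂ e
    ... | inj₂ (inj₁ j) with next-++⁻ ys j
    ...   | inj₁ k               = inj₁ ((λ { refl → a∉ys ys U (next-∈ˡ k) }) , k ⁱ++ (a ∷ zs))
      where
      a∉ys : ∀ ys → Unique (ys ++ a ∷ zs) → a ∉ ys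
      a∉ys (_ ∷ ys) (y≢ ∷ _) (here refl) = All.lookup y≢ (∈-++⁺ʳ ys (here refl)) refl
      a∉ys (_ ∷ ys) (_ ∷ U)  (there m)   = a∉ys ys U m
    ...   | inj₂ (inj₁ (Inf.here (_ ∷ ())))
    ...   | inj₂ (inj₁ (Inf.there (Inf.here ())))
    ...   | inj₂ (inj₂ ((us , refl) , _ , refl)) = inj₁ (x≢a us U , subst (Next _ _)
        (sym (++-assoc us (_ ∷ []) (a ∷ zs))) (next-mid us))
      where
      x≢a : ∀ us → Unique ((us ++ x ∷ []) ++ a ∷ zs) → x ≢ a
      x≢a []       ((x≢a ∷ _) ∷ _) = x≢a
      x≢a (_ ∷ us) (_ ∷ U)         = x≢a us U

  module Weaving {A I : Set} (mark : A → Maybe I) where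

    tag : Maybe I → List (A ⊎ I) → List (A ⊎ I)
    tag (just i) ws = inj₂ i ∷ ws
    tag nothing  ws = ws

    weave : List A → List (A ⊎ I)
    weave []       = []
    weave (a ∷ xs) = inj₁ a ∷ tag (mark a) (weave xs)

    weave-start : ∀ xs {y ys} → weave xs ≡ y ∷ ys → ∃[ b ] (y ≡ inj₁ b × StartsWith b xs)
    weave-start (b ∷ xs) refl = b , refl , xs , refl

    start-next : ∀ {a b : A} {xs} → StartsWith b xs → Next a b (a ∷ xs)
    start-next (_ , refl) = first

    weave-next₁₁⁻ : ∀ xs {a b} → Next (inj₁ a) (inj₁ b) (weave xs) → Next a b xs × mark a ≡ nothing
    weave-next₁₁⁻ [] (Inf.here ())
    weave-next₁₁⁻ (x ∷ xs) i with mark x in eq | next-∷⁻ i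
    ... | nothing | inj₁ (refl , _ , eq′) with weave-start xs eq′
    ...   | b , refl , s = start-next s , eq
    weave-next₁₁⁻ (x ∷ xs) i | just _ | inj₁ (refl , _ , ())
    weave-next₁₁⁻ (x ∷ xs) i | nothing | inj₂ j = let (k , e) = weave-next₁₁⁻ xs j in Inf.there k , e
    weave-next₁₁⁻ (x ∷ xs) i | just _  | inj₂ j with next-∷⁻ j
    ... | inj₁ (() , _)
    ... | inj₂ j′ = let (k , e) = weave-next₁₁⁻ xs j′ in Inf.there k , e

    weave-next₁₂⁻ : ∀ xs {a i} → Next (inj₁ a) (inj₂ i) (weave xs) → mark a ≡ just i
    weave-next₁₂⁻ [] (Inf.here ())
    weave-next₁₂⁻ (x ∷ xs) i with mark x in eq | next-∷⁻ i
    ... | just _  | inj₁ (refl , _ , refl) = eq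
    ... | nothing | inj₁ (refl , _ , eq′) with weave-start xs eq′
    ...   | _ , () , _
    weave-next₁₂⁻ (x ∷ xs) i | nothing | inj₂ j = weave-next₁₂⁻ xs j
    weave-next₁₂⁻ (x ∷ xs) i | just _  | inj₂ j with next-∷⁻ j
    ... | inj₁ (() , _)
    ... | inj₂ j′ = weave-next₁₂⁻ xs j′

    weave-next₂₁⁻ : ∀ xs {i b} → Next (inj₂ i) (inj₁ b) (weave xs) → ∃[ a ] (mark a ≡ just i × Next a b xs)
    weave-next₂₁⁻ [] (Inf.here ())
    weave-next₂₁⁻ (x ∷ xs) i with mark x in eq | next-∷⁻ i
    ... | _ | inj₁ (() , _)
    ... | nothing | inj₂ j = let (a , e , k) = weave-next₂₁⁻ xs j in a , e , Inf.there k
    ... | just _  | inj₂ j with next-∷⁻ j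
    ...   | inj₂ j′ = let (a , e , k) = weave-next₂₁⁻ xs j′ in a , e , Inf.there k
    ...   | inj₁ (refl , _ , eq′) with weave-start xs eq′
    ...     | b , refl , s = x , eq , start-next s

    weave-next₂₂⁻ : ∀ xs {i j} → ¬ Next (inj₂ i) (inj₂ j) (weave xs)
    weave-next₂₂⁻ [] (Inf.here ())
    weave-next₂₂⁻ (x ∷ xs) i with mark x | next-∷⁻ i
    ... | _       | inj₁ (() , _)
    ... | nothing | inj₂ j = weave-next₂₂⁻ xs j
    ... | just _  | inj₂ j with next-∷⁻ j
    ...   | inj₂ j′ = weave-next₂₂⁻ xs j′
    ...   | inj₁ (refl , _ , eq′) with weave-start xs eq′
    ...     | _ , () , _

    tag⁺ : ∀ m {x y ws} → Next x y ws → Next x y (tag m ws)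
    tag⁺ (just _) i = Inf.there i
    tag⁺ nothing  i = i

    weave-next₁₁⁺ : ∀ {xs a b} → mark a ≡ nothing → Next a b xs → Next (inj₁ a) (inj₁ b) (weave xs)
    weave-next₁₁⁺ {a ∷ b ∷ xs} eq first rewrite eq = first
    weave-next₁₁⁺ {x ∷ xs} eq (Inf.there i) = Inf.there (tag⁺ (mark x) (weave-next₁₁⁺ eq i))
    weave-next₁₁⁺ {_ ∷ []} eq (Inf.here (_ ∷ ()))

    weave-next₁₂⁺ : ∀ {xs a b i} → mark a ≡ just i → Next a b xs → Next (inj₁ a) (inj₂ i) (weave xs)
    weave-next₁₂⁺ {a ∷ b ∷ xs} eq first rewrite eq = first
    weave-next₁₂⁺ {x ∷ xs} eq (Inf.there i) = Inf.there (tag⁺ (mark x) (weave-next₁₂⁺ eq i))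
    weave-next₁₂⁺ {_ ∷ []} eq (Inf.here (_ ∷ ()))

    weave-next₂₁⁺ : ∀ {xs a b i} → mark a ≡ just i → Next a b xs → Next (inj₂ i) (inj₁ b) (weave xs)
    weave-next₂₁⁺ {a ∷ b ∷ xs} eq first rewrite eq = Inf.there first
    weave-next₂₁⁺ {x ∷ xs} eq (Inf.there i) = Inf.there (tag⁺ (mark x) (weave-next₂₁⁺ eq i))
    weave-next₂₁⁺ {_ ∷ []} eq (Inf.here (_ ∷ ()))

    ∈-weave₁ : ∀ xs {a} → inj₁ a ∈ weave xs → a ∈ xs
    ∈-weave₁ (x ∷ xs) (here refl) = here refl
    ∈-weave₁ (x ∷ xs) (there m) with mark x
    ∈-weave₁ (x ∷ xs) (there m)         | nothing = there (∈-weave₁ xs m)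
    ∈-weave₁ (x ∷ xs) (there (there m)) | just _  = there (∈-weave₁ xs m)

    ∈-weave₂ : ∀ xs {i} → inj₂ i ∈ weave xs → ∃[ a ] (a ∈ xs × mark a ≡ just i)
    ∈-weave₂ (x ∷ xs) (there m) with mark x in eq
    ∈-weave₂ (x ∷ xs) (there (here refl)) | just _  = x , here refl , eq
    ∈-weave₂ (x ∷ xs) (there (there m))   | just _  = let (a , a∈ , e) = ∈-weave₂ xs m in a , there a∈ , e
    ∈-weave₂ (x ∷ xs) (there m)           | nothing = let (a , a∈ , e) = ∈-weave₂ xs m in a , there a∈ , e

    -- The hypothesis says that every element of `I` is attached to at most one element of `A`, so
    -- it is inserted no more than once.
    weave-unique : (∀ {a b i} → mark a ≡ just i → mark b ≡ just i → a ≡ b) → ∀ {xs} → Unique xs → Unique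
        (weave xs)
    weave-unique inj {[]}     _        = []
    weave-unique inj {x ∷ xs} (x≢ ∷ U) with mark x in eq
    ... | nothing = All.tabulate x∉ ∷ weave-unique inj U
      where
      x∉ : ∀ {y} → y ∈ weave xs → inj₁ x ≢ y
      x∉ m refl = All.lookup x≢ (∈-weave₁ xs m) refl
    ... | just i = ((λ ()) ∷ All.tabulate x∉) ∷ All.tabulate i∉ ∷ weave-unique inj U
      where
      x∉ : ∀ {y} → y ∈ weave xs → inj₁ x ≢ y
      x∉ m refl = All.lookup x≢ (∈-weave₁ xs m) refl
      i∉ : ∀ {y} → y ∈ weave xs → inj₂ i ≢ y
      i∉ m refl with ∈-weave₂ xs m
      ... | a , a∈ , eq′ = All.lookup x≢ a∈ (inj eq eq′)

-- Spoiled differences and the base path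

module TranslatedPath where

  open ConsecutivePairs
  open Residues
  open DoublingOrbits
  open MergedCycle
  open Rerouting
  open import Data.Empty using (⊥-elim)
  open import Data.Fin.Base as Fin using (Fin; zero; suc; toℕ; fromℕ<)
  open import Data.Fin.Properties using (toℕ<n; toℕ-injective; toℕ-fromℕ<; any?) renaming (_≟_ to _≟ᶠ_)
  import Data.Integer.Base as ℤ
  open import Data.Integer.Base using (ℤ; +_; 0ℤ)
  import Data.Integer.Properties as ℤ
  open import Data.Integer.Tactic.RingSolver using (solve)
  open import Data.List.Base using (List; []; _∷_; _++_; length; map; allFin)
  open import Data.List.Properties using (∷ʳ-injectiveʳ; ++-assoc)
  open import Data.List.Membership.Propositional using (_∈_; _∉_)
  open import Data.List.Membership.Propositional.Properties using (∈-∃++; ∈-++⁺ˡ; ∈-++⁺ʳ; ∈-map⁺; ∈-allFin)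
  open import Data.List.Relation.Unary.Any using (here; there)
  open import Data.List.Relation.Unary.Unique.Propositional using (Unique)
  import Data.List.Relation.Unary.Unique.Propositional.Properties as Unique
  open import Data.Maybe.Base using (Maybe; just; nothing)
  open import Data.Nat.Base using (ℕ; zero; suc; _+_; _*_; _^_; _≤_; _<_; z≤n; z<s; s<s; >-nonZero)
  open import Data.Nat.Properties
  open import Data.Product.Base using (∃-syntax; _×_; _,_; proj₁; proj₂)
  open import Data.Sum.Base using (_⊎_; inj₁; inj₂)
  import Data.Sum.Properties as Sum
  open import Function.Base using (_∘_)
  open import Relation.Binary.Definitions using (tri<; tri≈; tri>)
  open import Relation.Binary.PropositionalEquality using (_≡_; _≢_; refl; sym; trans; cong; subst)
  open import Relation.Nullary.Decidable using (Dec; yes; no)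
  open import Relation.Nullary.Negation using (¬_)

  module Conflicts (k′ L : ℕ) (S : Construction.Stage k′ L (30 * suc k′)) where
    open Mod (suc k′)
    open Construction k′ L
    open Stage S

    links-double : ∀ {a b} → (a , b) ∈ links → ∃[ c ] ((c ≡ + 2 ⊎ c ≡ ℤ.- + 2) × ι b ≈ + 2 ℤ.* ι a ℤ.+ c)
    links-double l with linked l
    ... | up _ _ _ h   = _ , inj₁ refl , h
    ... | down _ _ _ h = _ , inj₂ refl , h

    links-small : ∀ {a b} → (a , b) ∈ links → 2 * toℕ a < N
    links-small l with linked l
    ... | up _ _ h _   = h
    ... | down _ _ h _ = h

    -- If b = 2a + c with c ∈ {0, 2, -2}, then a = (b - a) - c and
    -- b = -2 (a - b) - c: an edge with difference δ starts at one of six vertices.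
    slope offset : Fin 6 → ℤ
    slope zero                = + 1
    slope (suc zero)          = + 1
    slope (suc (suc zero))    = + 1
    slope (suc (suc (suc _))) = ℤ.- + 2
    offset zero                               = + 0
    offset (suc zero)                         = + 2
    offset (suc (suc zero))                   = ℤ.- + 2
    offset (suc (suc (suc zero)))             = + 0
    offset (suc (suc (suc (suc zero))))       = + 2
    offset (suc (suc (suc (suc (suc zero))))) = ℤ.- + 2

    candidate : Fin 6 → ℤ → ℤ
    candidate j δ = slope j ℤ.* δ ℤ.+ offset j

    forward : ∀ {a b} c → b ≈ + 2 ℤ.* a ℤ.+ c → a ≈ + 1 ℤ.* (b ℤ.- a) ℤ.+ ℤ.- c
    forward {a} {b} c h = lin₁ (ℤ.- + 1) h (solve (a ∷ b ∷ c ∷ []))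

    backward : ∀ {a b} c → a ≈ + 2 ℤ.* b ℤ.+ c → a ≈ ℤ.- + 2 ℤ.* (b ℤ.- a) ℤ.+ ℤ.- c
    backward {a} {b} c h = lin₁ (ℤ.- + 1) h (solve (a ∷ b ∷ c ∷ []))

    plus0 : ∀ {a b} → b ≈ + 2 ℤ.* a → b ≈ + 2 ℤ.* a ℤ.+ + 0
    plus0 {a} {b} h = lin₁ (+ 1) h (solve (a ∷ b ∷ []))

    Linked : Fin N → Fin N → Set
    Linked a b = (a , b) ∈ links ⊎ (b , a) ∈ links

    linked-candidate : ∀ {a b} → Linked a b → ∃[ j ] ι a ≈ candidate j (ι b ℤ.- ι a)
    linked-candidate {a} {b} (inj₁ l) with links-double l
    ... | _ , inj₁ refl , h = suc (suc zero) , forward {ι a} {ι b} (+ 2) h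
    ... | _ , inj₂ refl , h = suc zero , forward {ι a} {ι b} (ℤ.- + 2) h
    linked-candidate {a} {b} (inj₂ l) with links-double l
    ... | _ , inj₁ refl , h = suc (suc (suc (suc (suc zero)))) , backward {ι a} {ι b} (+ 2) h
    ... | _ , inj₂ refl , h = suc (suc (suc (suc zero))) , backward {ι a} {ι b} (ℤ.- + 2) h

    -- An edge with the same difference as the link `x, y` starts at one of the six candidates, and
    -- `gap` is the distance of that start from `x`. If it equals `3d` or `-3d`, then two translates
    -- that are `3d` apart may share a copy of the link. Six candidates, two signs and two
    -- orientations make 24 conflicts per link.
    gap : Fin N × Fin N → Fin 6 → ℤ
    gap (x , y) j = candidate j (ι y ℤ.- ι x) ℤ.- ι x

    conflictsOf : Fin N × Fin N → List (Fin N)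
    conflictsOf e = map (λ j → third (gap e j)) (allFin 6) ++ map (λ j → third (ℤ.- gap e j)) (allFin 6)

    swap : Fin N × Fin N → Fin N × Fin N
    swap (x , y) = y , x

    conflictList : List (Fin N × Fin N) → List (Fin N)
    conflictList []       = []
    conflictList (e ∷ es) = (conflictsOf e ++ conflictsOf (swap e)) ++ conflictList es

    conflicts : List (Fin N)
    conflicts = conflictList links

    length-conflicts : length conflicts ≡ length links * 24
    length-conflicts = go links
      where
      go : ∀ es → length (conflictList es) ≡ length es * 24
      go []       = refl
      go (e ∷ es) = cong (λ m → 24 + m) (go es)

    ∈-conflicts : ∀ {x y d} → Linked x y → d ∈ conflictsOf (x , y) → d ∈ conflicts
    ∈-conflicts {x} {y} {d} (inj₁ l) d∈ = go links l
      where
      go : ∀ es → (x , y) ∈ es → d ∈ conflictList es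
      go (_ ∷ es) (here refl) = ∈-++⁺ˡ {xs = conflictsOf (x , y) ++ conflictsOf (y , x)}
          (∈-++⁺ˡ {xs = conflictsOf (x , y)} d∈)
      go (e ∷ es) (there m)   = ∈-++⁺ʳ (conflictsOf e ++ conflictsOf (swap e)) (go es m)
    ∈-conflicts {x} {y} {d} (inj₂ l) d∈ = go links l
      where
      go : ∀ es → (y , x) ∈ es → d ∈ conflictList es
      go (_ ∷ es) (here refl) = ∈-++⁺ˡ {xs = conflictsOf (y , x) ++ conflictsOf (x , y)}
          (∈-++⁺ʳ (conflictsOf (y , x)) d∈)
      go (e ∷ es) (there m)   = ∈-++⁺ʳ (conflictsOf e ++ conflictsOf (swap e)) (go es m)

    third-unique : ∀ {z d} → + 3 ℤ.* ι d ≈ z → d ≡ third z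
    third-unique {z} h = ι-injective (cancel (+ 3) (+ 20) refl (≈-trans h (≈-sym (ι-third z))))

    conflict⁺ : ∀ {x y d} j → Linked x y → + 3 ℤ.* ι d ≈ gap (x , y) j → d ∈ conflicts
    conflict⁺ {x} {y} j l h = ∈-conflicts l (subst (_∈ conflictsOf (x , y)) (sym (third-unique h))
      (∈-++⁺ˡ (∈-map⁺ (λ j → third (gap (x , y) j)) (∈-allFin j))))

    conflict⁻ : ∀ {x y d} j → Linked x y → + 3 ℤ.* ι d ≈ ℤ.- gap (x , y) j → d ∈ conflicts
    conflict⁻ {x} {y} j l h = ∈-conflicts l (subst (_∈ conflictsOf (x , y)) (sym (third-unique h))
      (∈-++⁺ʳ (map (λ j → third (gap (x , y) j)) (allFin 6))
          (∈-map⁺ (λ j → third (ℤ.- gap (x , y) j)) (∈-allFin j))))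

  -- The numbers `3 ^ i * D` are the vertices behind which the cycle is broken. `small` keeps them
  -- below `N / 2`, so they are distinct residues and no two add up to zero. `D∉links` makes the
  -- broken edges doubling edges, and `D∉conflicts` lets these numbers serve as differences `d` when
  -- translates that are `3d` apart are compared.
  module Translates (k′ L r D : ℕ) (S : Construction.Stage k′ L (30 * suc k′)) (D≥3 : 3 ≤ D)
    (small : 2 * (3 ^ r * D) < Mod.N (suc k′))
    (D∉links : ∀ {i} → i ≤ r → ∀ {a b} → (a , b) ∈ Construction.Stage.links S → toℕ a ≢ 3 ^ i * D)
    (D∉conflicts : ∀ {i} → i ≤ r → ∀ {a} → a ∈ Conflicts.conflicts k′ L S → toℕ a ≢ 3 ^ i * D)
    where
    open Mod (suc k′)
    open Construction k′ L
    open Stage S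
    open Conflicts k′ L S

    Vertex : Set
    Vertex = Fin N ⊎ Fin r

    toℕ-ρ : ∀ {m} → m < N → toℕ (ρ (+ m)) ≡ m
    toℕ-ρ m<N = ≈⇒≡ (toℕ<n _) m<N (≈-trans (≈-sym (ι-toℕ refl)) (ι-ρ (+ _)))

    abstract
      P : ℕ → Fin N
      P i = ρ (+ (3 ^ i * D))

      P≡ : ∀ i → P i ≡ ρ (+ (3 ^ i * D))
      P≡ i = refl

    power-small : ∀ {i} → i ≤ r → 2 * (3 ^ i * D) < N
    power-small i≤r = ≤-<-trans (*-monoʳ-≤ 2 (*-monoˡ-≤ D (^-monoʳ-≤ 3 i≤r))) small

    toℕ-P : ∀ {i} → i ≤ r → toℕ (P i) ≡ 3 ^ i * D
    toℕ-P {i} i≤r = trans (cong toℕ (P≡ i)) (toℕ-ρ (≤-<-trans (m≤n*m _ 2) (power-small i≤r)))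

    2P<N : ∀ {i} → i ≤ r → 2 * toℕ (P i) < N
    2P<N i≤r = subst (λ z → 2 * z < N) (sym (toℕ-P i≤r)) (power-small i≤r)

    P≥3 : ∀ {i} → i ≤ r → 3 ≤ toℕ (P i)
    P≥3 {i} i≤r = subst (3 ≤_) (sym (toℕ-P i≤r)) (≤-trans D≥3 (m≤n*m D (3 ^ i) ⦃ m^n≢0 3 i ⦄))

    P≢0 : ∀ {i} → i ≤ r → ¬ ι (P i) ≈ 0ℤ
    P≢0 {i} i≤r h = n≮0 (subst (3 ≤_) (ι-zero h) (P≥3 i≤r))

    P-injective : ∀ {i j} → i ≤ r → j ≤ r → P i ≡ P j → i ≡ j
    P-injective {i} {j} i≤r j≤r eq = ^-injective i j (*-cancelʳ-≡ (3 ^ i) (3 ^ j) D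
        ⦃ >-nonZero (<-≤-trans z<s D≥3) ⦄
      (trans (sym (toℕ-P i≤r)) (trans (cong toℕ eq) (toℕ-P j≤r))))
      where
      ^-injective : ∀ i j → 3 ^ i ≡ 3 ^ j → i ≡ j
      ^-injective i j eq with <-cmp i j
      ... | tri< i<j _ _ = ⊥-elim (<⇒≢ (^-monoʳ-< 3 (s<s z<s) i<j) eq)
      ... | tri≈ _ i≡j _ = i≡j
      ... | tri> _ _ j<i = ⊥-elim (<⇒≢ (^-monoʳ-< 3 (s<s z<s) j<i) (sym eq))

    ι-P : ∀ i → ι (P i) ≈ + (3 ^ i * D)
    ι-P i = ≈-trans (ι-cong (P≡ i)) (ι-ρ _)

    P-suc : ∀ i → ι (P (suc i)) ≈ + 3 ℤ.* ι (P i)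
    P-suc i = go (trans (cong +_ (*-assoc 3 (3 ^ i) D)) (ℤ.pos-* 3 (3 ^ i * D))) (ι-P (suc i)) (ι-P i)
      where
      go : ∀ {p q m n} → m ≡ + 3 ℤ.* n → p ≈ m → q ≈ n → p ≈ + 3 ℤ.* q
      go {p} {q} {_} {n} refl h h′ = lin₂ (+ 1) (ℤ.- + 3) h h′ (solve (p ∷ q ∷ n ∷ []))

    P∉links : ∀ {i b} → i ≤ r → (P i , b) ∉ links
    P∉links i≤r l = D∉links i≤r l (toℕ-P i≤r)

    P∉conflicts : ∀ {i} → i ≤ r → P i ∉ conflicts
    P∉conflicts i≤r m = D∉conflicts i≤r m (toℕ-P i≤r)

    -- The i-th extra vertex is inserted behind P (i + 1), and the cycle is cut behind P 0.
    at : Fin r → Fin N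
    at i = P (suc (toℕ i))

    mark? : ∀ a → Dec (∃[ i ] at i ≡ a)
    mark? a = any? (λ i → at i ≟ᶠ a)

    abstract
      mark : Fin N → Maybe (Fin r)
      mark a with mark? a
      ... | yes (i , _) = just i
      ... | no _        = nothing

      mark-just : ∀ {a i} → mark a ≡ just i → a ≡ at i
      mark-just {a} eq with mark? a
      mark-just refl | yes (i , e) = sym e

      mark-at : ∀ i → mark (at i) ≡ just i
      mark-at i with mark? (at i)
      ... | yes (j , e) = cong just (toℕ-injective (suc-injective (P-injective (toℕ<n j) (toℕ<n i) e)))
      ... | no ¬e       = ⊥-elim (¬e (i , refl))

      mark-nothing⁺ : ∀ {a} → (∀ {i} → i ≤ r → P i ≢ a) → mark a ≡ nothing
      mark-nothing⁺ {a} ¬P with mark? a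
      ... | yes (i , e) = ⊥-elim (¬P (toℕ<n i) e)
      ... | no _        = refl

    mark-nothing⁻ : ∀ {a i} → mark a ≡ nothing → at i ≢ a
    mark-nothing⁻ {i = i} eq refl with () ← trans (sym eq) (mark-at i)

    open Weaving mark

    covered : ∀ {a} → toℕ a ≢ 0 → a ∈ B
    covered {a} a≢0 = covers a≢0 (≤-pred (toℕ<n a))

    P₀∈B : P 0 ∈ B
    P₀∈B = covered (λ e → n≮0 (subst (3 ≤_) e (P≥3 z≤n)))

    abstract
      before after : List (Fin N)
      before = proj₁ (∈-∃++ P₀∈B)
      after  = proj₁ (proj₂ (∈-∃++ P₀∈B))

      B≡ : B ≡ before ++ P 0 ∷ after
      B≡ = proj₂ (proj₂ (∈-∃++ P₀∈B))

    rotated : List (Fin N)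
    rotated = after ++ before ++ P 0 ∷ []

    P₀≢one : P 0 ≢ one
    P₀≢one e = <⇒≱ (s<s z<s) (≤-trans (P≥3 z≤n) (≤-reflexive (trans (cong toℕ e) (toℕ-elem {1} (s<s z<s)))))

    after-end : ∀ {a} → EndsWith a after → a ≡ one
    after-end (us , eq) with end
    ... | cs , eq′ = ∷ʳ-injectiveʳ (before ++ P 0 ∷ us) cs (trans
        (sym (trans B≡ (trans (cong (λ z → before ++ P 0 ∷ z) eq) (sym (++-assoc before (P 0 ∷ us) _))))) eq′)

    before-start : ∀ {b} → StartsWith b (before ++ P 0 ∷ []) → b ≡ dbl one
    before-start s = sameStart before s (subst (StartsWith (dbl one)) B≡ start)

    -- The new cut heals the old one, where `B` ended in `one` and began with `dbl one`. The part
    -- `after` is not empty, since `B` would end in `P 0` otherwise.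
    closing : Next one (dbl one) rotated
    closing = junction after (after-ends after refl) (before-starts (nonEmpty-start before))
      where
      after-ends : ∀ zs → after ≡ zs → EndsWith one zs
      after-ends []       eq = ⊥-elim (P₀≢one (∷ʳ-injectiveʳ before (proj₁ end)
          (trans (sym (trans B≡ (cong (λ z → before ++ P 0 ∷ z) eq))) (proj₂ end))))
      after-ends (z ∷ zs) eq with lastElement z zs
      ... | a , us , e = subst (λ a → EndsWith a (z ∷ zs)) (after-end (us , trans eq e)) (us , e)
      before-starts : (∃[ b ] StartsWith b (before ++ P 0 ∷ [])) → StartsWith (dbl one) (before ++ P 0 ∷ [])
      before-starts (b , s) = subst (λ b → StartsWith b (before ++ P 0 ∷ [])) (before-start s) s

    rotated-next⁻ : ∀ {a b} → Next a b rotated → (b ≡ dbl a × a ≢ P 0) ⊎ (a , b) ∈ links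
    rotated-next⁻ {a} {b} i with rotation-next⁻ before after (subst Unique B≡ unique) i
    ... | inj₂ (e , s) with refl ← after-end e | refl ← before-start s = inj₁ (refl , P₀≢one ∘ sym)
    ... | inj₁ (a≢ , j) with pairs (subst (Next a b) (sym B≡) j)
    ...   | inj₁ eq = inj₁ (eq , a≢)
    ...   | inj₂ l  = inj₂ l

    rotated-next⁺ : ∀ {a} → toℕ a ≢ 0 → a ≢ P 0 → (∀ {b} → (a , b) ∉ links) → Next a (dbl a) rotated
    rotated-next⁺ {a} a≢0 a≢P₀ ¬l with a ≟ᶠ one
    ... | yes refl = closing
    ... | no a≢1 with intact (covered a≢0) a≢1
    ...   | inj₁ (_ , l) = ⊥-elim (¬l l)
    ...   | inj₂ i       = rotation-next⁺ before after a≢P₀ (subst (Next a (dbl a)) B≡ i)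

    abstract
      base : List Vertex
      base = weave rotated

      base≡ : base ≡ weave rotated
      base≡ = refl

    onBase : ∀ {x y} → Next x y (weave rotated) → Next x y base
    onBase {x} {y} = subst (Next x y) (sym base≡)

    offBase : ∀ {x y} → Next x y base → Next x y (weave rotated)
    offBase {x} {y} = subst (Next x y) base≡

    base-unique : Unique base
    base-unique = subst Unique (sym base≡) (weave-unique (λ e e′ → trans (mark-just e) (sym (mark-just e′)))
                    (rotation-unique before after (subst Unique B≡ unique)))

    -- Of the doubling edges on the merged cycle, `base` lacks those that start at some `P i`: the
    -- cut removes the one at `P 0`, and an inserted vertex replaces each of the others.
    Unbroken : Fin N → Set
    Unbroken a = ∀ {i} → i ≤ r → P i ≢ a

    base₁₁⁻ : ∀ {a b} → Next (inj₁ a) (inj₁ b) base → (b ≡ dbl a × Unbroken a) ⊎ (a , b) ∈ links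
    base₁₁⁻ {a} i with weave-next₁₁⁻ rotated (offBase i)
    ... | j , m with rotated-next⁻ j
    ...   | inj₂ l = inj₂ l
    ...   | inj₁ (eq , a≢P₀) = inj₁ (eq , unbroken)
      where
      unbroken : Unbroken a
      unbroken {zero}  _   e = a≢P₀ (sym e)
      unbroken {suc i} i<r e = mark-nothing⁻ {i = fromℕ< i<r} m (trans (cong (P ∘ suc) (toℕ-fromℕ< i<r)) e)

    base₁₁⁺ : ∀ {a} → toℕ a ≢ 0 → Unbroken a → (∀ {b} → (a , b) ∉ links) → Next (inj₁ a) (inj₁ (dbl a)) base
    base₁₁⁺ a≢0 unbroken ¬l = onBase (weave-next₁₁⁺ (mark-nothing⁺ unbroken)
        (rotated-next⁺ a≢0 (λ e → unbroken z≤n (sym e)) ¬l))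

    base₁₂⁻ : ∀ {a i} → Next (inj₁ a) (inj₂ i) base → a ≡ at i
    base₁₂⁻ j = mark-just (weave-next₁₂⁻ rotated (offBase j))

    base₂₁⁻ : ∀ {b i} → Next (inj₂ i) (inj₁ b) base → b ≡ dbl (at i)
    base₂₁⁻ {i = i} j with weave-next₂₁⁻ rotated (offBase j)
    ... | a , m , j′ with refl ← mark-just m with rotated-next⁻ j′
    ...   | inj₁ (eq , _) = eq
    ...   | inj₂ l        = ⊥-elim (P∉links (toℕ<n i) l)

    base₂₂⁻ : ∀ {i j} → ¬ Next (inj₂ i) (inj₂ j) base
    base₂₂⁻ j = weave-next₂₂⁻ rotated (offBase j)

    at-next : ∀ i → Next (at i) (dbl (at i)) rotated
    at-next i = rotated-next⁺ (λ e → n≮0 (subst (3 ≤_) e (P≥3 (toℕ<n i)))) at≢P₀ (P∉links (toℕ<n i))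
      where
      at≢P₀ : at i ≢ P 0
      at≢P₀ e = 1+n≢0 (P-injective (toℕ<n i) z≤n e)

    base₁₂⁺ : ∀ i → Next (inj₁ (at i)) (inj₂ i) base
    base₁₂⁺ i = onBase (weave-next₁₂⁺ (mark-at i) (at-next i))

    base₂₁⁺ : ∀ i → Next (inj₂ i) (inj₁ (dbl (at i))) base
    base₂₁⁺ i = onBase (weave-next₂₁⁺ (mark-at i) (at-next i))

-- Separation by translates of the base path

module SeparatingTranslates where

  open ConsecutivePairs
  open Residues
  open DoublingOrbits
  open MergedCycle
  open Rerouting
  open TranslatedPath
  open import Data.Empty using (⊥; ⊥-elim)
  open import Data.Fin.Base as Fin using (Fin; zero; suc; toℕ)
  open import Data.Fin.Properties using (toℕ<n; toℕ-injective; pigeonhole) renaming (_≟_ to _≟ᶠ_)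
  import Data.Integer.Base as ℤ
  open import Data.Integer.Base using (ℤ; +_; 0ℤ)
  import Data.Integer.Properties as ℤ
  open import Data.Integer.Tactic.RingSolver using (solve)
  open import Data.List.Base using (List; []; _∷_; _++_; map; upTo)
  open import Data.List.Membership.Propositional using (_∈_; _∉_)
  open import Data.List.Membership.Propositional.Properties using (∈-++⁺ˡ; ∈-++⁺ʳ; ∈-map⁺; ∈-upTo⁺)
  open import Data.List.Relation.Binary.Infix.Heterogeneous.Properties using (infix?)
  open import Data.Nat.Base using (ℕ; zero; suc; _+_; _*_; _∸_; _^_; _≤_; _<_; z≤n; s≤s; z<s)
  open import Data.Nat.Properties
  open import Data.Product.Base using (∃-syntax; ∃₂; _×_; _,_; proj₁; proj₂)
  open import Data.Sum.Base using (_⊎_; inj₁; inj₂)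
  import Data.Sum.Properties as Sum
  open import Function.Base using (_∘_)
  open import Relation.Binary.PropositionalEquality
    using (_≡_; _≢_; refl; sym; trans; cong; cong₂; subst; subst₂)
  open import Relation.Nullary.Decidable using (Dec; yes; no; _⊎-dec_)
  open import Relation.Nullary.Negation using (¬_)

  module Congruences (k : ℕ) where
    open Mod k

    module _ (a b a′ b′ d : ℤ) (same : b ℤ.- a ≈ b′ ℤ.- a′) (dist : a′ ℤ.- a ≈ + 3 ℤ.* d) where

      -- Of the four orientations of two doubling edges with the same difference
      -- only the mixed ones can start at different vertices.
      forward-forward : b ≈ + 2 ℤ.* a → b′ ≈ + 2 ℤ.* a′ → d ≈ 0ℤ
      forward-forward h h′ = cancel (+ 3) (+ 20) refl (lin₄ (+ 1) (ℤ.- + 1) (ℤ.- + 1) (ℤ.- + 1) h h′ same dist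
          (solve (a ∷ b ∷ a′ ∷ b′ ∷ d ∷ [])))

      backward-backward : a ≈ + 2 ℤ.* b → a′ ≈ + 2 ℤ.* b′ → d ≈ 0ℤ
      backward-backward h h′ = cancel (+ 3) (+ 20) refl (lin₄ (+ 1) (ℤ.- + 1) (+ 2) (ℤ.- + 1) h h′ same dist
          (solve (a ∷ b ∷ a′ ∷ b′ ∷ d ∷ [])))

      forward-backward : b ≈ + 2 ℤ.* a → a′ ≈ + 2 ℤ.* b′ → a ≈ ℤ.- d × b ≈ ℤ.- + 2 ℤ.* d × b′ ≈ d
      forward-backward h h′ = a≈ , b≈ , lin₃ (+ 1) (+ 1) (ℤ.- + 1) b≈ dist same
          (solve (a ∷ b ∷ a′ ∷ b′ ∷ d ∷ []))
        where
        a≈ : a ≈ ℤ.- d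
        a≈ = cancel (+ 3) (+ 20) refl (lin₄ (ℤ.- + 2) (ℤ.- + 1) (+ 2) (ℤ.- + 1) h h′ same dist
            (solve (a ∷ b ∷ a′ ∷ b′ ∷ d ∷ [])))
        b≈ : b ≈ ℤ.- + 2 ℤ.* d
        b≈ = lin₂ (+ 1) (+ 2) h a≈ (solve (a ∷ b ∷ d ∷ []))

      backward-forward : a ≈ + 2 ℤ.* b → b′ ≈ + 2 ℤ.* a′ → a ≈ ℤ.- + 2 ℤ.* d × b ≈ ℤ.- d × a′ ≈ d
      backward-forward h h′ = a≈ , b≈ , lin₂ (+ 1) (+ 1) a≈ dist (solve (a ∷ b ∷ a′ ∷ b′ ∷ d ∷ []))
        where
        b≈ : b ≈ ℤ.- d
        b≈ = cancel (+ 3) (+ 20) refl (lin₄ (ℤ.- + 2) (ℤ.- + 1) (ℤ.- + 1) (ℤ.- + 1) h h′ same dist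
            (solve (a ∷ b ∷ a′ ∷ b′ ∷ d ∷ [])))
        a≈ : a ≈ ℤ.- + 2 ℤ.* d
        a≈ = lin₂ (+ 1) (+ 2) h b≈ (solve (a ∷ b ∷ d ∷ []))

      gap-left : ∀ s o → a′ ≈ s ℤ.* (b′ ℤ.- a′) ℤ.+ o → + 3 ℤ.* d ≈ s ℤ.* (b ℤ.- a) ℤ.+ o ℤ.- a
      gap-left s o h = lin₃ (ℤ.- + 1) (+ 1) (ℤ.- s) dist h same (solve (a ∷ b ∷ a′ ∷ b′ ∷ d ∷ s ∷ o ∷ []))

      gap-right : ∀ s o → a ≈ s ℤ.* (b ℤ.- a) ℤ.+ o → + 3 ℤ.* d ≈ ℤ.- (s ℤ.* (b′ ℤ.- a′) ℤ.+ o ℤ.- a′)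
      gap-right s o h = lin₃ (ℤ.- + 1) (ℤ.- + 1) (ℤ.- s) dist h same (solve (a ∷ b ∷ a′ ∷ b′ ∷ d ∷ s ∷ o ∷ []))

    difference : ∀ {t u x y a b a′ b′} → ι x ≈ ι t ℤ.+ ι a → ι y ≈ ι t ℤ.+ ι b → ι x ≈ ι u ℤ.+ ι a′ → ι y ≈ ι u
        ℤ.+ ι b′ →
                 ι b ℤ.- ι a ≈ ι b′ ℤ.- ι a′
    difference {t} {u} {x} {y} {a} {b} {a′} {b′} = go (ι t) (ι u) (ι x) (ι y) (ι a) (ι b) (ι a′) (ι b′)
      where
      go : ∀ t u x y a b a′ b′ → x ≈ t ℤ.+ a → y ≈ t ℤ.+ b → x ≈ u ℤ.+ a′ → y ≈ u ℤ.+ b′ → b ℤ.- a ≈ b′ ℤ.- a′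
      go t u x y a b a′ b′ h₁ h₂ h₃ h₄ = lin₄ (+ 1) (ℤ.- + 1) (ℤ.- + 1) (+ 1) h₁ h₂ h₃ h₄
          (solve (t ∷ u ∷ x ∷ y ∷ a ∷ b ∷ a′ ∷ b′ ∷ []))

    distance : ∀ {t u x a a′ z} → ι x ≈ ι t ℤ.+ ι a → ι x ≈ ι u ℤ.+ ι a′ → ι t ℤ.- ι u ≈ z → ι a′ ℤ.- ι a ≈ z
    distance {t} {u} {x} {a} {a′} {z} = go (ι t) (ι u) (ι x) (ι a) (ι a′) z
      where
      go : ∀ t u x a a′ z → x ≈ t ℤ.+ a → x ≈ u ℤ.+ a′ → t ℤ.- u ≈ z → a′ ℤ.- a ≈ z
      go t u x a a′ z h₁ h₂ h₃ = lin₃ (+ 1) (ℤ.- + 1) (+ 1) h₁ h₂ h₃ (solve (t ∷ u ∷ x ∷ a ∷ a′ ∷ z ∷ []))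

    offsetDifference : ∀ {m n s x y d} → n ≡ m ℤ.+ s → x ≈ m → y ≈ n → d ≈ s → y ℤ.- x ≈ d
    offsetDifference {m} {_} {s} {x} {y} {d} refl h h′ h″ =
      lin₃ (ℤ.- + 1) (+ 1) (ℤ.- + 1) h h′ h″ (solve (m ∷ s ∷ x ∷ y ∷ d ∷ []))

  module Separation (k′ L r D : ℕ) (S : Construction.Stage k′ L (30 * suc k′)) (D≥3 : 3 ≤ D)
    (small : 2 * (3 ^ r * D) < Mod.N (suc k′))
    (D∉links : ∀ {i} → i ≤ r → ∀ {a b} → (a , b) ∈ Construction.Stage.links S → toℕ a ≢ 3 ^ i * D)
    (D∉conflicts : ∀ {i} → i ≤ r → ∀ {a} → a ∈ Conflicts.conflicts k′ L S → toℕ a ≢ 3 ^ i * D)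
    where
    open Mod (suc k′)
    open Construction k′ L
    open Stage S
    open Conflicts k′ L S
    open Translates k′ L r D S D≥3 small D∉links D∉conflicts
    open Congruences (suc k′)

    In : Vertex → Vertex → List Vertex → Set
    In x y p = Next x y p ⊎ Next y x p

    In-sym : ∀ {x y p} → In x y p → In y x p
    In-sym (inj₁ i) = inj₂ i
    In-sym (inj₂ i) = inj₁ i

    _≟ᵛ_ : (x y : Vertex) → Dec (x ≡ y)
    _≟ᵛ_ = Sum.≡-dec _≟ᶠ_ _≟ᶠ_

    In? : ∀ x y p → Dec (In x y p)
    In? x y p = infix? _≟ᵛ_ (x ∷ y ∷ []) p ⊎-dec infix? _≟ᵛ_ (y ∷ x ∷ []) p

    Adjacent : Fin N → Fin N → Set
    Adjacent a b = In (inj₁ a) (inj₁ b) base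

    adjacent-type : ∀ {a b} → Adjacent a b → (b ≡ dbl a × Unbroken a) ⊎ (a ≡ dbl b × Unbroken b) ⊎ Linked a b
    adjacent-type (inj₁ i) with base₁₁⁻ i
    ... | inj₁ h = inj₁ h
    ... | inj₂ l = inj₂ (inj₂ (inj₁ l))
    adjacent-type (inj₂ i) with base₁₁⁻ i
    ... | inj₁ h = inj₂ (inj₁ h)
    ... | inj₂ l = inj₂ (inj₂ (inj₂ l))

    double : ∀ {a b} → b ≡ dbl a → ι b ≈ + 2 ℤ.* ι a
    double {a} refl = ι-dbl a

    adjacent-candidate : ∀ {a b} → Adjacent a b → ∃[ j ] ι a ≈ candidate j (ι b ℤ.- ι a)
    adjacent-candidate {a} {b} i with adjacent-type i
    ... | inj₁ (e , _)        = zero , forward {ι a} {ι b} (+ 0) (plus0 {ι a} (double e))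
    ... | inj₂ (inj₁ (e , _)) = suc (suc (suc zero)) , backward {ι a} {ι b} (+ 0) (plus0 {ι b} (double e))
    ... | inj₂ (inj₂ l)       = linked-candidate l

    unbroken-subst : ∀ {a d} → ι a ≈ ι d → Unbroken a → Unbroken d
    unbroken-subst h = subst Unbroken (ι-injective h)

    orthogonal : ∀ {a b a′ b′ d} → Adjacent a b → Adjacent a′ b′ → ι b ℤ.- ι a ≈ ι b′ ℤ.- ι a′ →
      ι a′ ℤ.- ι a ≈ + 3 ℤ.* ι d → ¬ ι d ≈ 0ℤ → d ∉ conflicts →
      Unbroken d × ((ι a ≈ ℤ.- ι d × ι b ≈ ℤ.- + 2 ℤ.* ι d) ⊎ (ι a ≈ ℤ.- + 2 ℤ.* ι d × ι b ≈ ℤ.- ι d))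
    orthogonal {a} {b} {a′} {b′} {d} i i′ same dist d≢0 d∉ with adjacent-type i | adjacent-type i′
    ... | inj₂ (inj₂ l) | _ = let (j , h) = adjacent-candidate i′ in
          ⊥-elim (d∉ (conflict⁺ j l (gap-left (ι a) (ι b) (ι a′) (ι b′) (ι d) same dist (slope j) (offset j)
              h)))
    ... | inj₁ _ | inj₂ (inj₂ l) = let (j , h) = adjacent-candidate i in
          ⊥-elim (d∉ (conflict⁻ j l (gap-right (ι a) (ι b) (ι a′) (ι b′) (ι d) same dist (slope j) (offset j)
              h)))
    ... | inj₂ (inj₁ _) | inj₂ (inj₂ l) = let (j , h) = adjacent-candidate i in
          ⊥-elim (d∉ (conflict⁻ j l (gap-right (ι a) (ι b) (ι a′) (ι b′) (ι d) same dist (slope j) (offset j)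
              h)))
    ... | inj₁ (e , _) | inj₁ (e′ , _) = ⊥-elim (d≢0 (forward-forward (ι a) (ι b) (ι a′) (ι b′) (ι d) same dist
        (double e) (double e′)))
    ... | inj₂ (inj₁ (e , _)) | inj₂ (inj₁ (e′ , _)) = ⊥-elim
        (d≢0 (backward-backward (ι a) (ι b) (ι a′) (ι b′) (ι d) same dist (double e) (double e′)))
    ... | inj₁ (e , _) | inj₂ (inj₁ (e′ , u)) = let (h , h′ , h″) = forward-backward (ι a) (ι b) (ι a′) (ι b′) (ι d) same dist (double e) (double e′) in
          unbroken-subst h″ u , inj₁ (h , h′)
    ... | inj₂ (inj₁ (e , _)) | inj₁ (e′ , u) = let (h , h′ , h″) = backward-forward (ι a) (ι b) (ι a′) (ι b′) (ι d) same dist (double e) (double e′) in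
          unbroken-subst h″ u , inj₂ (h , h′)

    shift : Fin N → Vertex → Vertex
    shift t (inj₁ a) = inj₁ (ρ (ι t ℤ.+ ι a))
    shift t (inj₂ i) = inj₂ i

    shift-injective : ∀ t {x y} → shift t x ≡ shift t y → x ≡ y
    shift-injective t {inj₁ a} {inj₁ b} eq = cong inj₁ (ι-injective
        (go {ι t} (ι-ρ (ι t ℤ.+ ι a)) (ι-ρ (ι t ℤ.+ ι b)) (ι-cong (Sum.inj₁-injective eq))))
      where
      go : ∀ {t a b u v} → u ≈ t ℤ.+ a → v ≈ t ℤ.+ b → u ≈ v → a ≈ b
      go {t} {a} {b} {u} {v} h h′ h″ = lin₃ (ℤ.- + 1) (+ 1) (+ 1) h h′ h″ (solve (t ∷ a ∷ b ∷ u ∷ v ∷ []))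
    shift-injective t {inj₂ i} {inj₂ j} eq = eq

    abstract
      translate : Fin N → List Vertex
      translate t = map (shift t) base

      translate≡ : ∀ t → translate t ≡ map (shift t) base
      translate≡ t = refl

    next-translate⁺ : ∀ {u v} t → Next u v base → Next (shift t u) (shift t v) (translate t)
    next-translate⁺ t i = subst (Next _ _) (sym (translate≡ t)) (next-map⁺ (shift t) i)

    next-translate⁻ : ∀ {x y} t → Next x y (translate t) → ∃₂ λ u v → Next u v base × x ≡ shift t u × y ≡ shift
        t v
    next-translate⁻ {x} {y} t i = next-map⁻ (shift t) base (subst (Next x y) (translate≡ t) i)

    shift≡ : ∀ {t a x} → ι x ≈ ι t ℤ.+ ι a → shift t (inj₁ a) ≡ inj₁ x
    shift≡ h = cong inj₁ (ρ≡ (≈-sym h))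

    shift⁻ : ∀ {t x u} → inj₁ x ≡ shift t u → ∃[ a ] (u ≡ inj₁ a × ι x ≈ ι t ℤ.+ ι a)
    shift⁻ {t} {u = inj₁ a} refl = a , refl , ι-ρ (ι t ℤ.+ ι a)

    shift₂⁻ : ∀ {t i u} → inj₂ i ≡ shift t u → u ≡ inj₂ i
    shift₂⁻ {u = inj₂ _} refl = refl

    finite⁺ : ∀ {x y t a b} → Adjacent a b → ι x ≈ ι t ℤ.+ ι a → ι y ≈ ι t ℤ.+ ι b → In (inj₁ x) (inj₁ y)
        (translate t)
    finite⁺ {t = t} (inj₁ i) h h′ = inj₁ (subst₂ (λ u v → Next u v (translate t)) (shift≡ h) (shift≡ h′)
        (next-translate⁺ t i))
    finite⁺ {t = t} (inj₂ i) h h′ = inj₂ (subst₂ (λ u v → Next u v (translate t)) (shift≡ h′) (shift≡ h)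
        (next-translate⁺ t i))

    finite⁻ : ∀ {x y t} → In (inj₁ x) (inj₁ y) (translate t) → ∃₂ λ a b → Adjacent a b × ι x ≈ ι t ℤ.+ ι a × ι y
        ≈ ι t ℤ.+ ι b
    finite⁻ {t = t} (inj₁ i) with next-translate⁻ t i
    ... | _ , _ , j , e , e′ with shift⁻ e | shift⁻ e′
    ...   | a , refl , h | b , refl , h′ = a , b , inj₁ j , h , h′
    finite⁻ (inj₂ i) with finite⁻ (inj₁ i)
    ... | b , a , j , h′ , h = a , b , In-sym j , h , h′

    extra⁺₁ : ∀ {x i t} → ι x ≈ ι t ℤ.+ ι (at i) → In (inj₁ x) (inj₂ i) (translate t)
    extra⁺₁ {i = i} {t} h = inj₁ (subst (λ u → Next u (inj₂ i) (translate t)) (shift≡ h)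
        (next-translate⁺ t (base₁₂⁺ i)))

    extra⁺₂ : ∀ {x i t} → ι x ≈ ι t ℤ.+ ι (dbl (at i)) → In (inj₁ x) (inj₂ i) (translate t)
    extra⁺₂ {i = i} {t} h = inj₂ (subst (λ u → Next (inj₂ i) u (translate t)) (shift≡ h)
        (next-translate⁺ t (base₂₁⁺ i)))

    extra⁻ : ∀ {x i t} → In (inj₁ x) (inj₂ i) (translate t) → ι x ≈ ι t ℤ.+ ι (at i) ⊎ ι x ≈ ι t ℤ.+ ι
        (dbl (at i))
    extra⁻ {t = t} (inj₁ j) with next-translate⁻ t j
    ... | _ , _ , j′ , e , e′ with shift⁻ e | shift₂⁻ e′
    ...   | a , refl , h | refl with refl ← base₁₂⁻ j′ = inj₁ h
    extra⁻ {t = t} (inj₂ j) with next-translate⁻ t j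
    ... | _ , _ , j′ , e , e′ with shift₂⁻ e | shift⁻ e′
    ...   | refl | b , refl , h with refl ← base₂₁⁻ j′ = inj₂ h

    extras⁻ : ∀ {i j t} → ¬ In (inj₂ i) (inj₂ j) (translate t)
    extras⁻ {t = t} (inj₁ n) with next-translate⁻ t n
    ... | _ , _ , n′ , e , e′ with refl ← shift₂⁻ e | refl ← shift₂⁻ e′ = base₂₂⁻ n′
    extras⁻ (inj₂ n) = extras⁻ (inj₁ n)

    Separated : Vertex → Vertex → Vertex → Vertex → Set
    Separated x y x′ y′ = ∃[ t ] (In x y (translate t) × ¬ In x′ y′ (translate t))

    byTwo : ∀ {x y x′ y′} t u → In x y (translate t) → In x y (translate u) →
            ¬ (In x′ y′ (translate t) × In x′ y′ (translate u)) → Separated x y x′ y′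
    byTwo {x′ = x′} {y′} t u i j ¬both with In? x′ y′ (translate t)
    ... | no ¬t  = t , i , ¬t
    ... | yes t∋ = u , j , λ u∋ → ¬both (t∋ , u∋)

    neg : Fin N → Fin N
    neg a = ρ (ℤ.- ι a)

    bad : List (Fin N)
    bad = conflicts ++ (map proj₁ links ++ map (neg ∘ proj₁) links) ++
        (map P (upTo (suc r)) ++ map (neg ∘ P) (upTo (suc r)))

    neg-neg : ∀ {a d} → neg d ≡ a → d ≡ neg a
    neg-neg {a} {d} refl = ι-injective (go (ι-ρ (ℤ.- ι d)) (ι-ρ (ℤ.- ι (neg d))))
      where
      go : ∀ {d a b} → a ≈ ℤ.- d → b ≈ ℤ.- a → d ≈ b
      go {d} {a} {b} h h′ = lin₂ (+ 1) (ℤ.- + 1) h h′ (solve (d ∷ a ∷ b ∷ []))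

    module Good {d} (d∉ : d ∉ bad) where

      notConflict : d ∉ conflicts
      notConflict m = d∉ (∈-++⁺ˡ m)

      notLink : ∀ {b} → (d , b) ∉ links
      notLink l = d∉ (∈-++⁺ʳ conflicts (∈-++⁺ˡ (∈-++⁺ˡ (∈-map⁺ proj₁ l))))

      notNegLink : ∀ {b} → (neg d , b) ∉ links
      notNegLink l = d∉ (∈-++⁺ʳ conflicts (∈-++⁺ˡ (∈-++⁺ʳ (map proj₁ links)
          (subst (_∈ map (neg ∘ proj₁) links) (sym (neg-neg refl)) (∈-map⁺ (neg ∘ proj₁) l)))))

      unbroken : Unbroken d
      unbroken i≤r refl = d∉ (∈-++⁺ʳ conflicts (∈-++⁺ʳ (map proj₁ links ++ map (neg ∘ proj₁) links)
          (∈-++⁺ˡ (∈-map⁺ P (∈-upTo⁺ (s≤s i≤r))))))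

      negUnbroken : Unbroken (neg d)
      negUnbroken {i} i≤r e = d∉ (∈-++⁺ʳ conflicts (∈-++⁺ʳ (map proj₁ links ++ map (neg ∘ proj₁) links)
        (∈-++⁺ʳ (map P (upTo (suc r))) (subst (_∈ map (neg ∘ P) (upTo (suc r))) (sym (neg-neg (sym e)))
            (∈-map⁺ (neg ∘ P) (∈-upTo⁺ (s≤s i≤r)))))))

    private
      ≢0⇒≉0 : ∀ {d} → toℕ d ≢ 0 → ¬ ι d ≈ 0ℤ
      ≢0⇒≉0 {d} d≢0 h = d≢0 (ι-zero h)

      neg≢0 : ∀ {d} → toℕ d ≢ 0 → toℕ (neg d) ≢ 0
      neg≢0 {d} d≢0 e = ≢0⇒≉0 d≢0 (go (ι-ρ (ℤ.- ι d)) (ι-toℕ e))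
        where
        go : ∀ {d n} → n ≈ ℤ.- d → n ≈ + 0 → d ≈ + 0
        go {d} {n} h h′ = lin₂ (ℤ.- + 1) (+ 1) h′ h (solve (d ∷ n ∷ []))

    module GoodEdge {x y d} (y-x≈d : ι y ℤ.- ι x ≈ ι d) (d≢0 : toℕ d ≢ 0) (d∉ : d ∉ bad) where
      open Good d∉

      t u : Fin N
      t = ρ (ι x ℤ.- ι d)
      u = ρ (ι x ℤ.+ + 2 ℤ.* ι d)

      t∋e : In (inj₁ x) (inj₁ y) (translate t)
      t∋e = finite⁺ (inj₁ (base₁₁⁺ d≢0 unbroken notLink)) (go₁ {d = ι d} (ι-ρ _))
          (go₂ {x = ι x} {d = ι d} (ι-ρ _) (ι-dbl d) y-x≈d)
        where
        go₁ : ∀ {x d t} → t ≈ x ℤ.- d → x ≈ t ℤ.+ d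
        go₁ {x} {d} {t} h = lin₁ (ℤ.- + 1) h (solve (x ∷ d ∷ t ∷ []))
        go₂ : ∀ {x y d e t} → t ≈ x ℤ.- d → e ≈ + 2 ℤ.* d → y ℤ.- x ≈ d → y ≈ t ℤ.+ e
        go₂ {x} {y} {d} {e} {t} h h′ h″ = lin₃ (ℤ.- + 1) (ℤ.- + 1) (+ 1) h h′ h″
            (solve (x ∷ y ∷ d ∷ e ∷ t ∷ []))

      u∋e : In (inj₁ x) (inj₁ y) (translate u)
      u∋e = finite⁺ (inj₂ (base₁₁⁺ (neg≢0 d≢0) negUnbroken notNegLink))
          (go₁ {d = ι d} {n = ι (neg d)} (ι-ρ _) (ι-dbl (neg d)) (ι-ρ _))
              (go₂ {x = ι x} {d = ι d} (ι-ρ _) (ι-ρ _) y-x≈d)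
        where
        go₁ : ∀ {x d u n m} → u ≈ x ℤ.+ + 2 ℤ.* d → m ≈ + 2 ℤ.* n → n ≈ ℤ.- d → x ≈ u ℤ.+ m
        go₁ {x} {d} {u} {n} {m} h h′ h″ = lin₃ (ℤ.- + 1) (ℤ.- + 1) (ℤ.- + 2) h h′ h″
            (solve (x ∷ d ∷ u ∷ n ∷ m ∷ []))
        go₂ : ∀ {x y d u n} → u ≈ x ℤ.+ + 2 ℤ.* d → n ≈ ℤ.- d → y ℤ.- x ≈ d → y ≈ u ℤ.+ n
        go₂ {x} {y} {d} {u} {n} h h′ h″ = lin₃ (ℤ.- + 1) (ℤ.- + 1) (+ 1) h h′ h″
            (solve (x ∷ y ∷ d ∷ u ∷ n ∷ []))

      u-t : ι u ℤ.- ι t ≈ + 3 ℤ.* ι d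
      u-t = go {ι x} {ι d} (ι-ρ _) (ι-ρ _)
        where
        go : ∀ {x d t u} → t ≈ x ℤ.- d → u ≈ x ℤ.+ + 2 ℤ.* d → u ℤ.- t ≈ + 3 ℤ.* d
        go {x} {d} {t} {u} h h′ = lin₂ (ℤ.- + 1) (+ 1) h h′ (solve (x ∷ d ∷ t ∷ u ∷ []))

      endpoint : ∀ {x d u y b} → y ≈ u ℤ.+ b → b ≈ ℤ.- + 2 ℤ.* d → u ≈ x ℤ.+ + 2 ℤ.* d → x ≈ y
      endpoint {x} {d} {u} {y} {b} h h′ h″ = lin₃ (ℤ.- + 1) (ℤ.- + 1) (ℤ.- + 1) h h′ h″
          (solve (x ∷ d ∷ u ∷ y ∷ b ∷ []))

      endpoint′ : ∀ {x y d u x′ a} → x′ ≈ u ℤ.+ a → a ≈ ℤ.- d → u ≈ x ℤ.+ + 2 ℤ.* d → y ℤ.- x ≈ d → y ≈ x′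
      endpoint′ {x} {y} {d} {u} {x′} {a} h h′ h″ h‴ = lin₄ (ℤ.- + 1) (ℤ.- + 1) (ℤ.- + 1) (+ 1) h h′ h″ h‴
          (solve (x ∷ y ∷ d ∷ u ∷ x′ ∷ a ∷ []))

      sameEdge : ∀ {x′ y′ a b} → ι x′ ≈ ι u ℤ.+ ι a → ι y′ ≈ ι u ℤ.+ ι b →
        (ι a ≈ ℤ.- ι d × ι b ≈ ℤ.- + 2 ℤ.* ι d) ⊎ (ι a ≈ ℤ.- + 2 ℤ.* ι d × ι b ≈ ℤ.- ι d) →
        SamePair {A = Vertex} (inj₁ x) (inj₁ y) (inj₁ x′) (inj₁ y′)
      sameEdge h h′ (inj₁ (ea , eb)) = inj₂ (cong inj₁ (ι-injective (endpoint {d = ι d} {ι u} h′ eb (ι-ρ _))) ,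
        cong inj₁ (ι-injective (endpoint′ {ι x} {d = ι d} {ι u} h ea (ι-ρ _) y-x≈d)))
      sameEdge h h′ (inj₂ (ea , eb)) = inj₁ (cong inj₁ (ι-injective (endpoint {d = ι d} {ι u} h ea (ι-ρ _))) ,
        cong inj₁ (ι-injective (endpoint′ {ι x} {d = ι d} {ι u} h′ eb (ι-ρ _) y-x≈d)))

      ¬finite : ∀ {x′ y′} → ¬ SamePair (inj₁ x) (inj₁ y) (inj₁ x′) (inj₁ y′) →
                ¬ (In (inj₁ x′) (inj₁ y′) (translate t) × In (inj₁ x′) (inj₁ y′) (translate u))
      ¬finite {x′} {y′} ¬same (i , j) = go (finite⁻ i) (finite⁻ j)
        where
        go : (∃₂ λ a b → Adjacent a b × ι x′ ≈ ι t ℤ.+ ι a × ι y′ ≈ ι t ℤ.+ ι b) →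
             (∃₂ λ a b → Adjacent a b × ι x′ ≈ ι u ℤ.+ ι a × ι y′ ≈ ι u ℤ.+ ι b) → ⊥
        go (a , b , A , h , h′) (a′ , b′ , A′ , k , k′) = ¬same (sameEdge k k′
          (proj₂ (orthogonal {d = d} A′ A (difference k k′ h h′) (distance k h u-t) (≢0⇒≉0 d≢0) notConflict)))

      -- The neighbours of the extra vertex on `base` are `P (i + 1)` and its double. A common edge
      -- makes them `3d` or `-3d` apart unless `d` vanishes; since `P (i + 1) = 3 * P i`, cancelling
      -- 3 gives `d = P i` or `d = - P i`.
      ¬extra : ∀ {x′ i} → ¬ (In (inj₁ x′) (inj₂ i) (translate t) × In (inj₁ x′) (inj₂ i) (translate u))
      ¬extra {x′} {i} (n , n′) = go (extra⁻ n) (extra⁻ n′)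
        where
        same≈0 : ∀ {t u x p d} → x ≈ t ℤ.+ p → x ≈ u ℤ.+ p → u ℤ.- t ≈ + 3 ℤ.* d → d ≈ + 0
        same≈0 {t} {u} {x} {p} {d} h h′ h″ = cancel (+ 3) (+ 20) refl
            (lin₃ (+ 1) (ℤ.- + 1) (ℤ.- + 1) h h′ h″ (solve (t ∷ u ∷ x ∷ p ∷ d ∷ [])))
        go₁ : ∀ {t u x p q} → x ≈ t ℤ.+ q → x ≈ u ℤ.+ p → q ≈ + 2 ℤ.* p → p ≈ u ℤ.- t
        go₁ {t} {u} {x} {p} {q} h h′ h″ = lin₃ (ℤ.- + 1) (+ 1) (ℤ.- + 1) h h′ h″
            (solve (t ∷ u ∷ x ∷ p ∷ q ∷ []))
        go₂ : ∀ {t u x p q d} → x ≈ t ℤ.+ p → x ≈ u ℤ.+ q → q ≈ + 2 ℤ.* p → u ℤ.- t ≈ + 3 ℤ.* d → p ≈ + 3 ℤ.*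
            ℤ.- d
        go₂ {t} {u} {x} {p} {q} {d} h h′ h″ h‴ = lin₄ (+ 1) (ℤ.- + 1) (ℤ.- + 1) (ℤ.- + 1) h h′ h″ h‴
            (solve (t ∷ u ∷ x ∷ p ∷ q ∷ d ∷ []))
        go : ι x′ ≈ ι t ℤ.+ ι (at i) ⊎ ι x′ ≈ ι t ℤ.+ ι (dbl (at i)) →
             ι x′ ≈ ι u ℤ.+ ι (at i) ⊎ ι x′ ≈ ι u ℤ.+ ι (dbl (at i)) → ⊥
        go (inj₁ h) (inj₁ h′) = ≢0⇒≉0 d≢0 (same≈0 {ι t} {ι u} {p = ι (at i)} h h′ u-t)
        go (inj₂ h) (inj₂ h′) = ≢0⇒≉0 d≢0 (same≈0 {ι t} {ι u} {p = ι (dbl (at i))} h h′ u-t)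
        go (inj₂ h) (inj₁ h′) = unbroken (<⇒≤ (toℕ<n i)) (ι-injective (cancel (+ 3) (+ 20) refl
          (≈-trans (≈-sym (P-suc (toℕ i))) (≈-trans (go₁ {ι t} {ι u} {p = ι (at i)} {ι (dbl (at i))} h h′
              (ι-dbl (at i))) u-t))))
        go (inj₁ h) (inj₂ h′) = negUnbroken (<⇒≤ (toℕ<n i)) (ι-injective (≈-trans (cancel (+ 3) (+ 20) refl
          (≈-trans (≈-sym (P-suc (toℕ i))) (go₂ {ι t} {ι u} {p = ι (at i)} {ι (dbl (at i))} {ι d} h h′
              (ι-dbl (at i)) u-t))) (≈-sym (ι-ρ _))))

      separated : ∀ {x′ y′} → ¬ SamePair (inj₁ x) (inj₁ y) x′ y′ → Separated (inj₁ x) (inj₁ y) x′ y′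
      separated {inj₁ _} {inj₁ _} ¬same = byTwo t u t∋e u∋e (¬finite ¬same)
      separated {inj₁ _} {inj₂ _} ¬same = byTwo t u t∋e u∋e ¬extra
      separated {inj₂ _} {inj₁ _} ¬same = byTwo t u t∋e u∋e λ { (i , j) → ¬extra (In-sym i , In-sym j) }
      separated {inj₂ _} {inj₂ _} ¬same = t , t∋e , extras⁻

    module ExtraEdge (v : Fin N) (i : Fin r) where

      i≤r : toℕ i ≤ r
      i≤r = <⇒≤ (toℕ<n i)

      -- These translates put the two neighbours of the extra vertex, `at i` and its double, at `v`.
      -- They are `at i = 3 * P i` apart.
      t u : Fin N
      t = ρ (ι v ℤ.- ι (at i))
      u = ρ (ι v ℤ.- + 2 ℤ.* ι (at i))

      v-t : ι v ≈ ι t ℤ.+ ι (at i)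
      v-t = go {p = ι (at i)} (ι-ρ _)
        where
        go : ∀ {v p t} → t ≈ v ℤ.- p → v ≈ t ℤ.+ p
        go {v} {p} {t} h = lin₁ (ℤ.- + 1) h (solve (v ∷ p ∷ t ∷ []))

      v-u : ι v ≈ ι u ℤ.+ ι (dbl (at i))
      v-u = go {p = ι (at i)} (ι-ρ _) (ι-dbl (at i))
        where
        go : ∀ {v p q u} → u ≈ v ℤ.- + 2 ℤ.* p → q ≈ + 2 ℤ.* p → v ≈ u ℤ.+ q
        go {v} {p} {q} {u} h h′ = lin₂ (ℤ.- + 1) (ℤ.- + 1) h h′ (solve (v ∷ p ∷ q ∷ u ∷ []))

      t-u : ι t ℤ.- ι u ≈ ι (at i)
      t-u = go {ι v} (ι-ρ _) (ι-ρ _)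
        where
        go : ∀ {v p t u} → t ≈ v ℤ.- p → u ≈ v ℤ.- + 2 ℤ.* p → t ℤ.- u ≈ p
        go {v} {p} {t} {u} h h′ = lin₂ (+ 1) (ℤ.- + 1) h h′ (solve (v ∷ p ∷ t ∷ u ∷ []))

      -- With `P i` as the difference, a common edge would require the edge from `P i` to its
      -- double, which the previous insertion or the cut has broken.
      ¬finite : ∀ {x′ y′} → ¬ (In (inj₁ x′) (inj₁ y′) (translate t) × In (inj₁ x′) (inj₁ y′) (translate u))
      ¬finite {x′} {y′} (n , n′) = go (finite⁻ n) (finite⁻ n′)
        where
        go : (∃₂ λ a b → Adjacent a b × ι x′ ≈ ι t ℤ.+ ι a × ι y′ ≈ ι t ℤ.+ ι b) →
             (∃₂ λ a b → Adjacent a b × ι x′ ≈ ι u ℤ.+ ι a × ι y′ ≈ ι u ℤ.+ ι b) → ⊥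
        go (a , b , A , h , h′) (a′ , b′ , A′ , k , k′) = proj₁
            (orthogonal A A′ (difference h h′ k k′) (≈-trans (distance h k t-u) (P-suc (toℕ i))) (P≢0 i≤r)
                (P∉conflicts i≤r)) i≤r refl

      ¬extra : ∀ {x′ j} → ¬ SamePair (inj₁ v) (inj₂ i) (inj₁ x′) (inj₂ j) →
               ¬ (In (inj₁ x′) (inj₂ j) (translate t) × In (inj₁ x′) (inj₂ j) (translate u))
      ¬extra {x′} {j} ¬same (n , n′) = go (extra⁻ n) (extra⁻ n′)
        where
        same≈0 : ∀ {x t u p} → x ≈ t ℤ.+ p → x ≈ u ℤ.+ p → t ℤ.- u ≈ + 0
        same≈0 {x} {t} {u} {p} h h′ = lin₂ (ℤ.- + 1) (+ 1) h h′ (solve (x ∷ t ∷ u ∷ p ∷ []))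
        go₁ : ∀ {x t u p q p′} → x ≈ t ℤ.+ q → x ≈ u ℤ.+ p′ → p′ ≈ + 2 ℤ.* q → t ℤ.- u ≈ p → p ≈ q
        go₁ {x} {t} {u} {p} {q} {p′} h h′ h″ h‴ = lin₄ (ℤ.- + 1) (+ 1) (+ 1) (ℤ.- + 1) h h′ h″ h‴
            (solve (x ∷ t ∷ u ∷ p ∷ q ∷ p′ ∷ []))
        go₂ : ∀ {t p q} → p ≈ q → t ℤ.+ p ≈ t ℤ.+ q
        go₂ {t} {p} {q} h = lin₁ (+ 1) h (solve (t ∷ p ∷ q ∷ []))
        go₃ : ∀ {x t u p q q′} → x ≈ t ℤ.+ q′ → x ≈ u ℤ.+ q → q′ ≈ + 2 ℤ.* q → t ℤ.- u ≈ p → p ℤ.+ q ≈ + 0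
        go₃ {x} {t} {u} {p} {q} {q′} h h′ h″ h‴ = lin₄ (ℤ.- + 1) (+ 1) (ℤ.- + 1) (ℤ.- + 1) h h′ h″ h‴
            (solve (x ∷ t ∷ u ∷ p ∷ q ∷ q′ ∷ []))
        sum<N : toℕ (at i) + toℕ (at j) < N
        sum<N = *-cancelˡ-< 2 _ _ (≤-<-trans (≤-reflexive (*-distribˡ-+ 2 (toℕ (at i)) (toℕ (at j))))
          (subst (2 * toℕ (at i) + 2 * toℕ (at j) <_) (cong (λ z → N + z) (sym (+-identityʳ N)))
              (+-mono-< (2P<N (toℕ<n i)) (2P<N (toℕ<n j)))))
        -- If one edge at the extra vertex `j` served both translates in the order opposite to that
        -- of `v` and `i`, then `at i` and `at j` would be negatives of each other; but both lie
        -- strictly between 0 and `N / 2`.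
        sum≉0 : ¬ ι (at i) ℤ.+ ι (at j) ≈ + 0
        sum≉0 h = <⇒≢ (≤-trans (s≤s z≤n) (≤-trans (P≥3 (toℕ<n i)) (m≤m+n _ _))) (sym (≈⇒≡ sum<N z<s
          (≈-trans (≡⇒≈ (trans (ℤ.pos-+ (toℕ (at i)) (toℕ (at j)))
              (cong₂ ℤ._+_ (sym (ι≡ (at i))) (sym (ι≡ (at j)))))) h)))
        go : ι x′ ≈ ι t ℤ.+ ι (at j) ⊎ ι x′ ≈ ι t ℤ.+ ι (dbl (at j)) →
             ι x′ ≈ ι u ℤ.+ ι (at j) ⊎ ι x′ ≈ ι u ℤ.+ ι (dbl (at j)) → ⊥
        go (inj₁ h) (inj₁ h′) = P≢0 (toℕ<n i) (≈-trans (≈-sym t-u) (same≈0 {t = ι t} {ι u} {p = ι (at j)} h h′))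
        go (inj₂ h) (inj₂ h′) = P≢0 (toℕ<n i) (≈-trans (≈-sym t-u)
            (same≈0 {t = ι t} {ι u} {p = ι (dbl (at j))} h h′))
        go (inj₂ h) (inj₁ h′) = sum≉0 (go₃ {t = ι t} {ι u} {ι (at i)} {ι (at j)} {ι (dbl (at j))} h h′
            (ι-dbl (at j)) t-u)
        go (inj₁ h) (inj₂ h′) = ¬same (inj₁ (cong inj₁ (ι-injective
            (≈-trans v-t (≈-trans (go₂ {ι t} at≈) (≈-sym h)))) ,
                                             cong inj₂ (toℕ-injective (suc-injective
                                                 (P-injective (toℕ<n i) (toℕ<n j) (ι-injective at≈))))))
          where
          at≈ : ι (at i) ≈ ι (at j)
          at≈ = go₁ {t = ι t} {ι u} {q = ι (at j)} {ι (dbl (at j))} h h′ (ι-dbl (at j)) t-u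

      separated : ∀ {x′ y′} → ¬ SamePair (inj₁ v) (inj₂ i) x′ y′ → Separated (inj₁ v) (inj₂ i) x′ y′
      separated {inj₁ _} {inj₁ _} ¬same = byTwo t u (extra⁺₁ v-t) (extra⁺₂ v-u) ¬finite
      separated {inj₁ _} {inj₂ _} ¬same = byTwo t u (extra⁺₁ v-t) (extra⁺₂ v-u) (¬extra ¬same)
      separated {inj₂ _} {inj₁ _} ¬same = byTwo t u (extra⁺₁ v-t) (extra⁺₂ v-u)
        λ { (n , n′) → ¬extra (λ { (inj₁ (p , q)) → ¬same (inj₂ (p , q)) ; (inj₂ (() , _)) })
            (In-sym n , In-sym n′) }
      separated {inj₂ _} {inj₂ _} ¬same = t , extra⁺₁ v-t , extras⁻

    -- The starting points of the edges of base with difference d are not invariant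
    -- under a translation by g ≠ 0: there is one (all broken edges start below N / 2,
    -- so d or - d starts an unbroken one), and there are at most six.
    module SameDifference {x y x′ y′ d} (y-x≈d : ι y ℤ.- ι x ≈ ι d) (y′-x′≈d : ι y′ ℤ.- ι x′ ≈ ι d) (d≢0 : toℕ d ≢ 0) (x≢x′ : x ≢ x′) where

      Start : ℤ → Set
      Start a = Adjacent (ρ a) (ρ (a ℤ.+ ι d))

      Start? : ∀ a → Dec (Start a)
      Start? a = In? (inj₁ (ρ a)) (inj₁ (ρ (a ℤ.+ ι d))) base

      big-unbroken : ∀ {a} → N < 2 * toℕ a → Unbroken a
      big-unbroken big i≤r refl = <⇒≱ big (<⇒≤ (2P<N i≤r))

      someStart : ∃[ a ] Start a
      someStart with N <? 2 * toℕ d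
      ... | yes big = ι d , inj₁ (subst₂ (λ a b → Next (inj₁ a) (inj₁ b) base) (sym (ρ≡ ≈-refl))
          -- When `d` exceeds `N / 2`, it is the start of an unbroken doubling edge; otherwise `- d`
          -- exceeds `N / 2`, and the edge from `- d` to `-2d` is traversed backwards.
          (sym (ρ≡ (go {ι d} (ι-dbl d))))
              (base₁₁⁺ d≢0 (big-unbroken big) (λ l → <⇒≱ big (<⇒≤ (links-small l)))))
        where
        go : ∀ {d e} → e ≈ + 2 ℤ.* d → d ℤ.+ d ≈ e
        go {d} {e} h = lin₁ (ℤ.- + 1) h (solve (d ∷ e ∷ []))
      ... | no ¬big = ℤ.- + 2 ℤ.* ι d , inj₂ (subst₂ (λ a b → Next (inj₁ a) (inj₁ b) base)
          (sym (ρ≡ (go₁ {ι d} (ι-ρ _)))) (sym (ρ≡ (go₂ {ι d} {ι (neg d)} (ι-dbl (neg d)) (ι-ρ _))))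
              (base₁₁⁺ (neg≢0 d≢0) (big-unbroken negBig) (λ l → <⇒≱ negBig (<⇒≤ (links-small l)))))
        where
        go₁ : ∀ {d n} → n ≈ ℤ.- d → ℤ.- + 2 ℤ.* d ℤ.+ d ≈ n
        go₁ {d} {n} h = lin₁ (ℤ.- + 1) h (solve (d ∷ n ∷ []))
        go₂ : ∀ {d n m} → m ≈ + 2 ℤ.* n → n ≈ ℤ.- d → ℤ.- + 2 ℤ.* d ≈ m
        go₂ {d} {n} {m} h h′ = lin₂ (ℤ.- + 1) (ℤ.- + 2) h h′ (solve (d ∷ n ∷ m ∷ []))
        toℕ-neg : toℕ (neg d) ≡ N ∸ toℕ d
        toℕ-neg = ≈⇒≡ (toℕ<n _) (∸-monoʳ-< (n≢0⇒n>0 d≢0) (<⇒≤ (toℕ<n d)))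
          (≈-trans (≈-sym (ι-toℕ refl)) (≈-trans (ι-ρ _) (go₃
              (trans (cong +_ (sym (m∸n+n≡m (<⇒≤ (toℕ<n d)))))
                  (trans (ℤ.pos-+ (N ∸ toℕ d) (toℕ d)) (cong (λ z → + (N ∸ toℕ d) ℤ.+ z) (sym (ι≡ d))))) N≈0)))
          where
          go₃ : ∀ {n m d} → n ≡ m ℤ.+ d → n ≈ + 0 → ℤ.- d ≈ m
          go₃ {_} {m} {d} refl h = lin₁ (ℤ.- + 1) h (solve (m ∷ d ∷ []))
        2d<N : 2 * toℕ d < N
        2d<N = ≤∧≢⇒< (≮⇒≥ ¬big) λ e → even≢odd (toℕ d) (15 * suc k′) (trans e N-odd)
        negBig : N < 2 * toℕ (neg d)
        negBig = subst (λ z → N < 2 * z) (sym toℕ-neg) (+-cancelʳ-< (2 * toℕ d) N (2 * (N ∸ toℕ d))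
          (subst (N + 2 * toℕ d <_) (trans (cong (λ z → N + z) (sym (+-identityʳ N)))
              (trans (cong (λ z → 2 * z) (sym (m∸n+n≡m (<⇒≤ (toℕ<n d))))) (*-distribˡ-+ 2 (N ∸ toℕ d) (toℕ d))))
            (+-monoʳ-< N 2d<N)))

      g : ℤ
      g = ι x′ ℤ.- ι x

      ¬periodic : ∀ a → ¬ (∀ (i : Fin 7) → Start (a ℤ.+ + toℕ i ℤ.* g))
      ¬periodic a all with pigeonhole {6} {7} ≤-refl (λ i → proj₁ (adjacent-candidate (all i)))
      ... | i , j , i<j , eq = impossible (toℕ j ∸ toℕ i) (m<n⇒0<n∸m i<j)
          (≤-trans (m∸n≤m (toℕ j) (toℕ i)) (≤-pred (toℕ<n j)))
             (go (+ (toℕ j ∸ toℕ i)) {+ toℕ i} {c = candidate (proj₁ (adjacent-candidate (all i))) (ι d)}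
                 (trans (cong +_ (sym (m∸n+n≡m (<⇒≤ i<j)))) (ℤ.pos-+ (toℕ j ∸ toℕ i) (toℕ i)))
                 (start≈ i) (≈-trans (start≈ j) (≡⇒≈ (cong (λ c → candidate c (ι d)) (sym eq)))))
        where
        starts : ∀ {z c e s o} → c ≈ z → e ≈ z ℤ.+ ι d → c ≈ s ℤ.* (e ℤ.- c) ℤ.+ o → z ≈ s ℤ.* ι d ℤ.+ o
        starts {z} {c} {e} {s} {o} h h′ h″ = go′ (ι d) h h′ h″
          where
          go′ : ∀ d → c ≈ z → e ≈ z ℤ.+ d → c ≈ s ℤ.* (e ℤ.- c) ℤ.+ o → z ≈ s ℤ.* d ℤ.+ o
          go′ d h h′ h″ = lin₃ (ℤ.- + 1 ℤ.- s) s (+ 1) h h′ h″ (solve (z ∷ c ∷ e ∷ s ∷ o ∷ d ∷ []))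
        start≈ : ∀ i → a ℤ.+ + toℕ i ℤ.* g ≈ candidate (proj₁ (adjacent-candidate (all i))) (ι d)
        start≈ i = starts {s = slope (proj₁ (adjacent-candidate (all i)))}
            {offset (proj₁ (adjacent-candidate (all i)))} (ι-ρ _) (ι-ρ _) (proj₂ (adjacent-candidate (all i)))
        go : ∀ m {i j c} → j ≡ m ℤ.+ i → a ℤ.+ i ℤ.* g ≈ c → a ℤ.+ j ℤ.* g ≈ c → m ℤ.* g ≈ m ℤ.* + 0
        go m {i} {_} {c} refl h h′ = go′ g h h′
          where
          go′ : ∀ g → a ℤ.+ i ℤ.* g ≈ c → a ℤ.+ (m ℤ.+ i) ℤ.* g ≈ c → m ℤ.* g ≈ m ℤ.* + 0
          go′ g h h′ = lin₂ (ℤ.- + 1) (+ 1) h h′ (solve (a ∷ i ∷ m ∷ g ∷ c ∷ []))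
        g≢0 : ¬ g ≈ + 0
        g≢0 h = x≢x′ (ι-injective (go′ h))
          where
          go′ : ∀ {x x′} → x′ ℤ.- x ≈ + 0 → x ≈ x′
          go′ {x} {x′} h = lin₁ (ℤ.- + 1) h (solve (x ∷ x′ ∷ []))
        -- Two of the seven starting points `a + i * g` are the same candidate, so `m * g` vanishes
        -- for the difference `m` of their indices. It lies between 1 and 6, hence divides 60 and
        -- can be cancelled.
        impossible : ∀ m → 0 < m → m ≤ 6 → ¬ (+ m ℤ.* g ≈ + m ℤ.* + 0)
        impossible 1 _ _ h = g≢0 (cancel (+ 1) (+ 60) refl h)
        impossible 2 _ _ h = g≢0 (cancel (+ 2) (+ 30) refl h)
        impossible 3 _ _ h = g≢0 (cancel (+ 3) (+ 20) refl h)
        impossible 4 _ _ h = g≢0 (cancel (+ 4) (+ 15) refl h)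
        impossible 5 _ _ h = g≢0 (cancel (+ 5) (+ 12) refl h)
        impossible 6 _ _ h = g≢0 (cancel (+ 6) (+ 10) refl h)
        impossible (suc (suc (suc (suc (suc (suc (suc m))))))) _ le _ = <⇒≱
            (s≤s (s≤s (s≤s (s≤s (s≤s (s≤s (s≤s z≤n))))))) le

      lastStart : ∃[ a ] (Start a × ¬ Start (a ℤ.+ g))
      lastStart with someStart
      ... | a , s = search 7 0 refl (λ i i≤0 → subst Start (trans (sym (ℤ.+-identityʳ a))
          (cong (λ z → a ℤ.+ + z ℤ.* g) (sym (n≤0⇒n≡0 i≤0)))) s)
        where
        search : ∀ fuel m → fuel + m ≡ 7 → (∀ i → i ≤ m → Start (a ℤ.+ + i ℤ.* g)) → ∃[ a ]
            (Start a × ¬ Start (a ℤ.+ g))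
        search zero       m refl all = ⊥-elim (¬periodic a λ i → all (toℕ i) (<⇒≤ (toℕ<n i)))
        search (suc fuel) m eq   all with Start? (a ℤ.+ + m ℤ.* g ℤ.+ g)
        ... | no ¬s = _ , all m ≤-refl , ¬s
        ... | yes s′ = search fuel (suc m) (trans (+-suc fuel m) eq) λ i i≤1+m → case i i≤1+m
          where
          step : ∀ b m g → b ℤ.+ m ℤ.* g ℤ.+ g ≡ b ℤ.+ (+ 1 ℤ.+ m) ℤ.* g
          step b m g = solve (b ∷ m ∷ g ∷ [])
          case : ∀ i → i ≤ suc m → Start (a ℤ.+ + i ℤ.* g)
          case i le with m≤n⇒m<n∨m≡n le
          ... | inj₁ i<1+m = all i (≤-pred i<1+m)
          ... | inj₂ refl  = subst Start (step a (+ m) g) s′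

      -- The translation that moves the start `a` to `x` puts the first edge on the path. The second
      -- edge is its shift by `g`, and would have to come from a start at `a + g`.
      separated : Separated (inj₁ x) (inj₁ y) (inj₁ x′) (inj₁ y′)
      separated = go lastStart
        where
        go : ∃[ a ] (Start a × ¬ Start (a ℤ.+ g)) → Separated (inj₁ x) (inj₁ y) (inj₁ x′) (inj₁ y′)
        go (a , s , ¬s) = t , finite⁺ s (go₁ {a = a} (ι-ρ _) (ι-ρ _))
            (go₂ {x = ι x} {a = a} {d = ι d} (ι-ρ _) (ι-ρ _) y-x≈d) , λ i → missed (finite⁻ i)
          where
          t = ρ (ι x ℤ.- a)
          go₁ : ∀ {x t a b} → t ≈ x ℤ.- a → b ≈ a → x ≈ t ℤ.+ b
          go₁ {x} {t} {a} {b} h h′ = lin₂ (ℤ.- + 1) (ℤ.- + 1) h h′ (solve (x ∷ t ∷ a ∷ b ∷ []))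
          go₂ : ∀ {x y t a c d} → t ≈ x ℤ.- a → c ≈ a ℤ.+ d → y ℤ.- x ≈ d → y ≈ t ℤ.+ c
          go₂ {x} {y} {t} {a} {c} {d} h h′ h″ = lin₃ (ℤ.- + 1) (ℤ.- + 1) (+ 1) h h′ h″
              (solve (x ∷ y ∷ t ∷ a ∷ c ∷ d ∷ []))
          go₃ : ∀ {x x′ t a b} → t ≈ x ℤ.- a → x′ ≈ t ℤ.+ b → a ℤ.+ (x′ ℤ.- x) ≈ b
          go₃ {x} {x′} {t} {a} {b} h h′ = lin₂ (+ 1) (+ 1) h h′ (solve (x ∷ x′ ∷ t ∷ a ∷ b ∷ []))
          go₄ : ∀ {x x′ y′ t a b d} → t ≈ x ℤ.- a → y′ ≈ t ℤ.+ b → y′ ℤ.- x′ ≈ d → a ℤ.+ (x′ ℤ.- x) ℤ.+ d ≈ b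
          go₄ {x} {x′} {y′} {t} {a} {b} {d} h h′ h″ = lin₃ (+ 1) (+ 1) (ℤ.- + 1) h h′ h″
              (solve (x ∷ x′ ∷ y′ ∷ t ∷ a ∷ b ∷ d ∷ []))
          missed : ¬ (∃₂ λ b c → Adjacent b c × ι x′ ≈ ι t ℤ.+ ι b × ι y′ ≈ ι t ℤ.+ ι c)
          missed (b , c , A , h , h′) = ¬s (subst₂ Adjacent (sym (ρ≡ (go₃ {ι x} {t = ι t} {a} (ι-ρ _) h)))
              (sym (ρ≡ (go₄ {ι x} {ι x′} {t = ι t} {a} {d = ι d} (ι-ρ _) h′ y′-x′≈d))) A)

-- The whole family: separation, size, and transfer to the complete graph

module StrongFamily where

  open ConsecutivePairs
  open Residues
  open DoublingOrbits
  open MergedCycle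
  open ChainPaths
  open Rerouting
  open TranslatedPath
  open SeparatingTranslates
  open import Defs
  open import Data.Empty using (⊥; ⊥-elim)
  open import Data.Fin.Base as Fin using (Fin; zero; suc; toℕ; join; splitAt)
  open import Data.Fin.Properties
    using (toℕ<n; toℕ-injective; splitAt-join; join-splitAt) renaming (_≟_ to _≟ᶠ_)
  import Data.Integer.Base as ℤ
  open import Data.Integer.Base using (ℤ; +_)
  import Data.Integer.Properties as ℤ
  open import Data.List.Base
    using (List; []; _∷_; _++_; length; map; concatMap; allFin; upTo; filter; cartesianProduct)
  open import Data.List.Properties
    using (length-map; length-++; length-tabulate; length-applyUpTo; length-filter)
  open import Data.List.Membership.Propositional using (_∈_; lose)
  open import Data.List.Membership.Propositional.Properties
    using (∈-++⁺ˡ; ∈-++⁺ʳ; ∈-map⁺; ∈-map⁻; ∈-allFin; ∈-concatMap⁺; ∈-filter⁺; ∈-filter⁻; ∈-cartesianProduct⁺)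
  import Data.List.Membership.DecPropositional as DecMembership
  open import Data.List.Relation.Unary.All as All using (All; []; _∷_)
  import Data.List.Relation.Unary.All.Properties as All
  open import Data.List.Relation.Unary.AllPairs using ([]; _∷_)
  open import Data.List.Relation.Unary.Any as Any using (Any; here; there)
  import Data.List.Relation.Unary.Any.Properties as Any
  open import Data.List.Relation.Unary.Linked.Properties using (AllPairs⇒Linked)
  open import Data.List.Relation.Unary.Unique.Propositional using (Unique)
  import Data.List.Relation.Unary.Unique.Propositional.Properties as Unique
  open import Data.List.Relation.Binary.Infix.Heterogeneous as Inf using ()
  open import Data.List.Relation.Binary.Prefix.Heterogeneous using ([]; _∷_)
  open import Data.Nat.Base using (ℕ; zero; suc; _+_; _*_; _∸_; _^_; _≤_; _<_; z≤n; z<s; NonZero; >-nonZero⁻¹)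
  open import Data.Nat.Properties
  open import Data.Nat.Tactic.RingSolver using (solve-∀)
  open import Data.Product.Base using (∃-syntax; _×_; _,_; proj₁; proj₂)
  open import Data.Sum.Base using (_⊎_; inj₁; inj₂)
  import Data.Sum.Properties as Sum
  open import Function.Base using (_∘_)
  open import Relation.Binary.Definitions using (tri<; tri≈; tri>)
  open import Relation.Binary.PropositionalEquality
    using (_≡_; _≢_; refl; sym; trans; cong; cong₂; subst; subst₂)
  open import Relation.Nullary.Decidable using (Dec; yes; no; ¬?)
  open import Relation.Nullary.Negation using (¬_)

  unique-map : ∀ {A C : Set} (f : A → C) {xs} → (∀ {x y} → x ∈ xs → y ∈ xs → f x ≡ f y → x ≡ y) → Unique xs →
      Unique (map f xs)
  unique-map f {[]}     inj []       = []
  unique-map f {x ∷ xs} inj (x≢ ∷ U) = All.tabulate distinct ∷ unique-map f (λ m m′ → inj (there m) (there m′))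
      U
    where
    distinct : ∀ {y} → y ∈ map f xs → f x ≢ y
    distinct y∈ eq with ∈-map⁻ f y∈
    ... | z , z∈ , refl = All.lookup x≢ z∈ (inj (here refl) (there z∈) eq)

  module SeparatingFamily (k′ L r D : ℕ) (S : Construction.Stage k′ L (30 * suc k′)) (D≥3 : 3 ≤ D)
    (small : 2 * (3 ^ r * D) < Mod.N (suc k′))
    (D∉links : ∀ {i} → i ≤ r → ∀ {a b} → (a , b) ∈ Construction.Stage.links S → toℕ a ≢ 3 ^ i * D)
    (D∉conflicts : ∀ {i} → i ≤ r → ∀ {a} → a ∈ Conflicts.conflicts k′ L S → toℕ a ≢ 3 ^ i * D)
    where
    open Mod (suc k′)
    open Construction k′ L using (one)
    open Construction.Stage S using (links)
    open Conflicts k′ L S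
    open Congruences (suc k′)
    open Translates k′ L r D S D≥3 small D∉links D∉conflicts
    open Separation k′ L r D S D≥3 small D∉links D∉conflicts
    open DecMembership (_≟ᶠ_ {N}) using (_∈?_)

    embed : ℕ → Vertex
    embed m = inj₁ (ρ (+ m))

    embed-toℕ : ∀ x → embed (toℕ x) ≡ inj₁ x
    embed-toℕ x = cong inj₁ (ρ≡ (≈-sym (ι-toℕ refl)))

    embed⁻ : ∀ {m x} → m < N → inj₁ x ≡ embed m → toℕ x ≡ m
    embed⁻ m<N refl = toℕ-ρ m<N

    module Rows (s : ℕ) .⦃ _ : NonZero s ⦄ (s<N : s < N) where
      open Chain N s

      up down : List Vertex
      up   = map embed (upRows s<N)
      down = map embed (downRows s<N)

      embed-unique : ∀ {xs} → (∀ {m} → m ∈ xs → m < N) → Unique xs → Unique (map embed xs)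
      embed-unique xs<N = unique-map embed λ m∈ m′∈ eq → trans (sym (toℕ-ρ (xs<N m∈)))
          (trans (cong toℕ (Sum.inj₁-injective eq)) (toℕ-ρ (xs<N m′∈)))

      ¬extraˡ : ∀ {v i} xs → ¬ Next (inj₂ i) v (map embed xs)
      ¬extraˡ xs n with next-map⁻ embed xs n
      ... | _ , _ , _ , () , _

      ¬extraʳ : ∀ {u i} xs → ¬ Next u (inj₂ i) (map embed xs)
      ¬extraʳ xs n with next-map⁻ embed xs n
      ... | _ , _ , _ , _ , ()

      rows-In⁻ : ∀ xs {x y} → (∀ {m} → m ∈ xs → m < N) → In (inj₁ x) (inj₁ y) (map embed xs) → Next (toℕ x)
          (toℕ y) xs ⊎ Next (toℕ y) (toℕ x) xs
      rows-In⁻ xs {x} {y} xs<N (inj₁ i) with next-map⁻ embed xs i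
      ... | a , b , j , e , e′ = inj₁ (subst₂ (λ a b → Next a b xs) (sym (embed⁻ (xs<N (next-∈ˡ j)) e))
          (sym (embed⁻ (xs<N (next-∈ʳ j)) e′)) j)
      rows-In⁻ xs xs<N (inj₂ i) with rows-In⁻ xs xs<N (inj₁ i)
      ... | inj₁ j = inj₂ j
      ... | inj₂ j = inj₁ j

      common-In : ∀ {x y} → In (inj₁ x) (inj₁ y) up → In (inj₁ x) (inj₁ y) down → toℕ y ≡ toℕ x + s ⊎ toℕ x ≡
          toℕ y + s
      common-In i j = common s<N (rows-In⁻ (upRows s<N) (up-∈ s<N) i) (rows-In⁻ (downRows s<N) (down-∈ s<N) j)

      step⁺ : ∀ {x y xs} → toℕ y ≡ toℕ x + s → Next (toℕ x) (toℕ x + s) xs → In (inj₁ x) (inj₁ y) (map embed xs)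
      step⁺ {x} {y} {xs} eq i = inj₁ (subst₂ (λ u v → Next u v (map embed xs)) (embed-toℕ x)
        (trans (cong embed (sym eq)) (embed-toℕ y)) (next-map⁺ embed i))

      up∋ : ∀ {x y} → toℕ y ≡ toℕ x + s → In (inj₁ x) (inj₁ y) up
      up∋ {x} {y} eq = step⁺ {xs = upRows s<N} eq (up-step s<N (subst (_< N) eq (toℕ<n y)))

      down∋ : ∀ {x y} → toℕ y ≡ toℕ x + s → In (inj₁ x) (inj₁ y) down
      down∋ {x} {y} eq = step⁺ {xs = downRows s<N} eq (down-step s<N (subst (_< N) eq (toℕ<n y)))

    -- No edge has difference 0, so the residue 0 calls for no chain paths even if it is in `bad`.
    rowPathsOf : ∀ s → s < N → List (List Vertex)
    rowPathsOf zero    _   = []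
    rowPathsOf (suc s) s<N = Rows.up (suc s) s<N ∷ Rows.down (suc s) s<N ∷ []

    rowPaths : Fin N → List (List Vertex)
    rowPaths d = rowPathsOf (toℕ d) (toℕ<n d)

    distinct? : (ij : Fin r × Fin r) → Dec (proj₁ ij ≢ proj₂ ij)
    distinct? (i , j) = ¬? (i ≟ᶠ j)

    distinctPairs : List (Fin r × Fin r)
    distinctPairs = filter distinct? (cartesianProduct (allFin r) (allFin r))

    extraPath : Fin r × Fin r → List Vertex
    extraPath (i , j) = inj₂ i ∷ inj₂ j ∷ []

    -- The last kind consists of one-edge paths. They take care of the edges between extra vertices,
    -- which lie on no translate and on no chain path.
    family : List (List Vertex)
    family = map translate (allFin N) ++ (concatMap rowPaths bad ++ map extraPath distinctPairs)

    SeparatedIn : Vertex → Vertex → Vertex → Vertex → Set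
    SeparatedIn x y x′ y′ = ∃[ p ] (p ∈ family × In x y p × ¬ In x′ y′ p)

    byTranslate : ∀ {x y x′ y′} → Separated x y x′ y′ → SeparatedIn x y x′ y′
    byTranslate (t , e∈ , f∉) = translate t , ∈-++⁺ˡ (∈-map⁺ translate (∈-allFin t)) , e∈ , f∉

    row∈family : ∀ {d p} → d ∈ bad → p ∈ rowPaths d → p ∈ family
    row∈family {d} {p} d∈ p∈ = ∈-++⁺ʳ (map translate (allFin N))
        (∈-++⁺ˡ (∈-concatMap⁺ rowPaths (Any.map (λ { refl → p∈ }) d∈)))

    module Offsets (s : ℕ) .⦃ _ : NonZero s ⦄ (s<N : s < N) where

      offset≈ : ∀ {x y} → toℕ y ≡ toℕ x + s → ι y ℤ.- ι x ≈ ι (ρ (+ s))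
      offset≈ {x} {y} eq = offsetDifference (trans (cong +_ eq) (ℤ.pos-+ (toℕ x) s)) (ι-toℕ {x} refl)
          (ι-toℕ {y} refl) (ι-ρ (+ s))

      d≢0 : toℕ (ρ (+ s)) ≢ 0
      d≢0 e = <⇒≢ (>-nonZero⁻¹ s) (sym (trans (sym (toℕ-ρ s<N)) e))

    -- Another edge whose ends differ by `s` lies on both chain paths, so the translates have to
    -- separate it. Any other edge lies on at most one of the two paths, and an edge at an extra
    -- vertex on neither.
    module BadEdge {x y : Fin N} (s : ℕ) .⦃ _ : NonZero s ⦄ (s<N : s < N) (y≡ : toℕ y ≡ toℕ x + s)
      (up∈ : Rows.up s s<N ∈ family) (down∈ : Rows.down s s<N ∈ family) where
      open Rows s s<N
      open Offsets s s<N

      sameDifference : ∀ {x′ y′} → toℕ y′ ≡ toℕ x′ + s → ¬ SamePair {A = Vertex} (inj₁ x) (inj₁ y) (inj₁ x′)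
          (inj₁ y′) →
                       Separated (inj₁ x) (inj₁ y) (inj₁ x′) (inj₁ y′)
      sameDifference {x′} {y′} eq ¬same = SameDifference.separated (offset≈ y≡) (offset≈ eq) d≢0
        λ { refl → ¬same (inj₁ (refl , cong inj₁ (toℕ-injective (trans y≡ (sym eq))))) }

      otherDifference : ∀ {x′ y′} → toℕ y′ ≢ toℕ x′ + s → toℕ x′ ≢ toℕ y′ + s → SeparatedIn (inj₁ x) (inj₁ y)
          (inj₁ x′) (inj₁ y′)
      otherDifference {x′} {y′} ¬eq ¬eq′ with In? (inj₁ x′) (inj₁ y′) up
      ... | no f∉ = up , up∈ , up∋ y≡ , f∉
      ... | yes f∈ = down , down∈ , down∋ y≡ , λ f∈′ → contradict (common-In f∈ f∈′)
        where
        contradict : toℕ y′ ≡ toℕ x′ + s ⊎ toℕ x′ ≡ toℕ y′ + s → ⊥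
        contradict (inj₁ e) = ¬eq e
        contradict (inj₂ e) = ¬eq′ e

      swapSep : ∀ {x′ y′} → Separated (inj₁ x) (inj₁ y) y′ x′ → Separated (inj₁ x) (inj₁ y) x′ y′
      swapSep (t , e∈ , f∉) = t , e∈ , f∉ ∘ In-sym

      swapSame : ∀ {u v w z : Vertex} → SamePair u v z w → SamePair u v w z
      swapSame (inj₁ (p , q)) = inj₂ (p , q)
      swapSame (inj₂ (p , q)) = inj₁ (p , q)

      separated : ∀ {x′ y′} → ¬ SamePair (inj₁ x) (inj₁ y) x′ y′ → SeparatedIn (inj₁ x) (inj₁ y) x′ y′
      separated {inj₁ x′} {inj₁ y′} ¬same with toℕ y′ ≟ toℕ x′ + s | toℕ x′ ≟ toℕ y′ + s
      ... | yes e | _     = byTranslate (sameDifference e ¬same)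
      ... | no _  | yes e = byTranslate (swapSep (sameDifference e (¬same ∘ swapSame)))
      ... | no ¬e | no ¬e′ = otherDifference ¬e ¬e′
      separated {inj₁ _} {inj₂ _} ¬same = up , up∈ , up∋ y≡ ,
        λ { (inj₁ i) → ¬extraʳ (Chain.upRows N s s<N) i ; (inj₂ i) → ¬extraˡ (Chain.upRows N s s<N) i }
      separated {inj₂ _} {_} ¬same = up , up∈ , up∋ y≡ ,
        λ { (inj₁ i) → ¬extraˡ (Chain.upRows N s s<N) i ; (inj₂ i) → ¬extraʳ (Chain.upRows N s s<N) i }

    orderedEdge : ∀ {x y} → toℕ x < toℕ y → ∀ {x′ y′} → ¬ SamePair (inj₁ x) (inj₁ y) x′ y′ → SeparatedIn
        (inj₁ x) (inj₁ y) x′ y′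
    orderedEdge {x} {y} x<y = go (toℕ y ∸ toℕ x) (m<n⇒0<n∸m x<y) (≤-<-trans (m∸n≤m (toℕ y) (toℕ x)) (toℕ<n y))
        (sym (m+[n∸m]≡n (<⇒≤ x<y)))
      where
      go : ∀ s → 0 < s → s < N → toℕ y ≡ toℕ x + s → ∀ {x′ y′} → ¬ SamePair (inj₁ x) (inj₁ y) x′ y′ →
          SeparatedIn (inj₁ x) (inj₁ y) x′ y′
      go s@(suc _) _ s<N eq ¬same with ρ (+ s) ∈? bad
      ... | no d∉ = byTranslate (GoodEdge.separated (Offsets.offset≈ s s<N eq) (Offsets.d≢0 s s<N) d∉ ¬same)
      ... | yes d∈ = BadEdge.separated s s<N eq (rows∈ (here refl)) (rows∈ (there (here refl))) ¬same
        where
        rows∈ : ∀ {p} → p ∈ rowPathsOf s s<N → p ∈ family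
        rows∈ {p} p∈ = row∈family d∈ (subst (p ∈_) (sym (rowPaths≡ (toℕ-ρ s<N) (toℕ<n (ρ (+ s))))) p∈)
          where
          rowPaths≡ : ∀ {m} → m ≡ s → ∀ (m<N : m < N) → rowPathsOf m m<N ≡ rowPathsOf s s<N
          rowPaths≡ refl m<N = cong (rowPathsOf s) (<-irrelevant m<N s<N)
    In-symmetric : ∀ {x y x′ y′} → SeparatedIn y x x′ y′ → SeparatedIn x y x′ y′
    In-symmetric (p , p∈ , e∈ , f∉) = p , p∈ , In-sym e∈ , f∉

    SamePair-symmetric : ∀ {x y x′ y′ : Vertex} → SamePair y x x′ y′ → SamePair x y x′ y′
    SamePair-symmetric (inj₁ (p , q)) = inj₂ (q , p)
    SamePair-symmetric (inj₂ (p , q)) = inj₁ (q , p)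

    extraPath-In : ∀ {i j x y} → In x y (extraPath (i , j)) → SamePair (inj₂ i) (inj₂ j) x y
    extraPath-In (inj₁ first) = inj₁ (refl , refl)
    extraPath-In (inj₂ first) = inj₂ (refl , refl)
    extraPath-In (inj₁ (Inf.there (Inf.here (_ ∷ ()))))
    extraPath-In (inj₁ (Inf.there (Inf.there (Inf.here ()))))
    extraPath-In (inj₂ (Inf.there (Inf.here (_ ∷ ()))))
    extraPath-In (inj₂ (Inf.there (Inf.there (Inf.here ()))))

    extraPath∈family : ∀ {i j} → i ≢ j → extraPath (i , j) ∈ family
    extraPath∈family {i} {j} i≢j = ∈-++⁺ʳ (map translate (allFin N)) (∈-++⁺ʳ (concatMap rowPaths bad)
      (∈-map⁺ extraPath (∈-filter⁺ distinct? (∈-cartesianProduct⁺ (∈-allFin i) (∈-allFin j)) i≢j)))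

    separates : ∀ x y {x′ y′} → x ≢ y → ¬ SamePair x y x′ y′ → SeparatedIn x y x′ y′
    separates (inj₁ x) (inj₁ y) x≢y ¬same with <-cmp (toℕ x) (toℕ y)
    ... | tri< x<y _ _ = orderedEdge x<y ¬same
    ... | tri≈ _ x≡y _ = ⊥-elim (x≢y (cong inj₁ (toℕ-injective x≡y)))
    ... | tri> _ _ y<x = In-symmetric (orderedEdge y<x (¬same ∘ SamePair-symmetric))
    separates (inj₁ v) (inj₂ i) _ ¬same = byTranslate (ExtraEdge.separated v i ¬same)
    separates (inj₂ i) (inj₁ v) _ ¬same = In-symmetric (byTranslate
        (ExtraEdge.separated v i (¬same ∘ SamePair-symmetric)))
    separates (inj₂ i) (inj₂ j) x≢y ¬same =
      extraPath (i , j) , extraPath∈family (x≢y ∘ cong inj₂) , inj₁ first , ¬same ∘ extraPath-In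

    Simple : List Vertex → Set
    Simple p = p ≢ [] × Unique p

    base≢[] : base ≢ []
    base≢[] eq = weave≢[] rotated closing (trans (sym base≡) eq)
      where
      weave≢[] : ∀ xs {a b} → Next a b xs → Weaving.weave mark xs ≢ []
      weave≢[] (_ ∷ _) _ ()
      weave≢[] [] (Inf.here ())

    translate-simple : ∀ t → Simple (translate t)
    translate-simple t = (λ eq → base≢[] (map-[] (trans (sym (translate≡ t)) eq))) ,
      subst Unique (sym (translate≡ t)) (Unique.map⁺ (shift-injective t) base-unique)
      where
      map-[] : ∀ {xs} → map (shift t) xs ≡ [] → xs ≡ []
      map-[] {[]} _ = refl

    rows-simple : ∀ s s<N {p} → p ∈ rowPathsOf s s<N → Simple p
    rows-simple (suc s) s<N (here refl) = (λ eq → nonempty (up∋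
        (trans (toℕ-ρ s<N) (cong (_+ suc s) (sym (toℕ-ρ {0} z<s))))) eq) ,
      embed-unique {xs = Chain.upRows N (suc s) s<N} (Chain.up-∈ N (suc s) s<N) (Chain.up-unique N (suc s) s<N)
      where
      open Rows (suc s) s<N
      nonempty : ∀ {x y p} → In x y p → p ≢ []
      nonempty (inj₁ i) refl with () ← next-∈ˡ i
      nonempty (inj₂ i) refl with () ← next-∈ˡ i
    rows-simple (suc s) s<N (there (here refl)) = (λ eq → nonempty
        (down∋ (trans (toℕ-ρ s<N) (cong (_+ suc s) (sym (toℕ-ρ {0} z<s))))) eq) ,
      embed-unique {xs = Chain.downRows N (suc s) s<N} (Chain.down-∈ N (suc s) s<N)
          (Chain.down-unique N (suc s) s<N)
      where
      open Rows (suc s) s<N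
      nonempty : ∀ {x y p} → In x y p → p ≢ []
      nonempty (inj₁ i) refl with () ← next-∈ˡ i
      nonempty (inj₂ i) refl with () ← next-∈ˡ i

    family-simple : All Simple family
    family-simple = All.++⁺ (All.map⁺ {xs = allFin N} (All.tabulate λ {t} _ → translate-simple t))
      (All.++⁺ (All.concat⁺ (All.map⁺ {xs = bad} (All.tabulate λ {d} _ → All.tabulate
          (rows-simple (toℕ d) (toℕ<n d)))))
        (All.map⁺ {xs = distinctPairs} (All.tabulate λ m → extra-simple
            (proj₂ (∈-filter⁻ distinct? {xs = cartesianProduct (allFin r) (allFin r)} m)))))
      where
      extra-simple : ∀ {ij} → proj₁ ij ≢ proj₂ ij → Simple (extraPath ij)
      extra-simple i≢j = (λ ()) , ((λ eq → i≢j (Sum.inj₂-injective eq)) ∷ []) ∷ [] ∷ []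

    -- Each link accounts for 24 conflicts, its starting point and the negative of this; each of the
    -- `r + 1` broken edges accounts for `P i` and its negative.
    length-bad : length bad ≡ length links * 26 + 2 * suc r
    length-bad = trans (length-++ conflicts) (trans (cong₂ _+_ length-conflicts
        (trans (length-++ (map proj₁ links ++ map (neg ∘ proj₁) links))
      (cong₂ _+_ (trans (length-++ (map proj₁ links)) (cong₂ _+_ (length-map proj₁ links)
          (length-map (neg ∘ proj₁) links)))
        (trans (length-++ (map P (upTo (suc r)))) (cong₂ _+_
            (trans (length-map P (upTo (suc r))) (length-applyUpTo (λ i → i) (suc r)))
          (trans (length-map (neg ∘ P) (upTo (suc r))) (length-applyUpTo (λ i → i) (suc r))))))))
      (arith (length links) (suc r)))
      where
      arith : ∀ l r → l * 24 + (l + l + (r + r)) ≡ l * 26 + 2 * r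
      arith = solve-∀

    length-rows : ∀ ds → length (concatMap rowPaths ds) ≤ 2 * length ds
    length-rows []       = z≤n
    length-rows (d ∷ ds) = ≤-trans (≤-reflexive (length-++ (rowPaths d)))
        (≤-trans (+-mono-≤ (atMostTwo (toℕ d) (toℕ<n d)) (length-rows ds))
            (≤-reflexive (sym (*-suc 2 (length ds)))))
      where
      atMostTwo : ∀ s s<N → length (rowPathsOf s s<N) ≤ 2
      atMostTwo zero    _ = z≤n
      atMostTwo (suc _) _ = ≤-refl

    length-family : length family ≤ N + (2 * (length links * 26 + 2 * suc r) + r * r)
    length-family = ≤-trans (≤-reflexive (length-++ (map translate (allFin N))))
      (+-mono-≤ (≤-reflexive (trans (length-map translate (allFin N)) (length-tabulate {n = N} (λ i → i))))
        (≤-trans (≤-reflexive (length-++ (concatMap rowPaths bad)))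
          (+-mono-≤ (≤-trans (length-rows bad) (≤-reflexive (cong (2 *_) length-bad)))
            (≤-trans (≤-reflexive (length-map extraPath distinctPairs))
              (≤-trans (length-filter distinct? (cartesianProduct (allFin r) (allFin r)))
                (≤-reflexive (trans (length-product (allFin r) (allFin r))
                    (cong₂ _*_ (length-tabulate {n = r} (λ i → i)) (length-tabulate {n = r} (λ i → i))))))))))
      where
      length-product : ∀ (xs ys : List (Fin r)) → length (cartesianProduct xs ys) ≡ length xs * length ys
      length-product []       ys = refl
      length-product (x ∷ xs) ys = trans (length-++ (map (x ,_) ys))
          (cong₂ _+_ (length-map (x ,_) ys) (length-product xs ys))

    vertex : Vertex → Fin (N + r)
    vertex = join N r

    vertex-injective : ∀ {x y} → vertex x ≡ vertex y → x ≡ y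
    vertex-injective {x} {y} eq = trans (sym (splitAt-join N r x))
        (trans (cong (splitAt N) eq) (splitAt-join N r y))

    paths : List (List (Fin (N + r)))
    paths = map (map vertex) family

    length-paths : length paths ≡ length family
    length-paths = length-map (map vertex) family

    isPaths : All (IsPath (K (N + r))) paths
    isPaths = All.map⁺ (All.map toPath family-simple)
      where
      toPath : ∀ {p} → Simple p → IsPath (K (N + r)) (map vertex p)
      toPath {[]}    (p≢[] , _) = ⊥-elim (p≢[] refl)
      toPath {_ ∷ _} (_ , U)    = isPath (λ ()) U′ (AllPairs⇒Linked U′)
        where U′ = Unique.map⁺ (λ {x} {y} → vertex-injective {x} {y}) U

    isStrongSeparating : IsStrongSeparating (K (N + r)) paths
    isStrongSeparating = strongSeparating isPaths sep
      where
      In-vertex⁺ : ∀ {x y p u v} → vertex x ≡ u → vertex y ≡ v → In x y p → Next u v (map vertex p) ⊎ Next v u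
          (map vertex p)
      In-vertex⁺ refl refl (inj₁ i) = inj₁ (next-map⁺ vertex i)
      In-vertex⁺ refl refl (inj₂ i) = inj₂ (next-map⁺ vertex i)

      In-vertex⁻ : ∀ {x y p u v} → vertex x ≡ u → vertex y ≡ v → Next u v (map vertex p) ⊎ Next v u
          (map vertex p) → In x y p
      In-vertex⁻ {x} {y} {p} refl refl (inj₁ i) = inj₁ (next-map-injective {a = x} {y}
          (λ {x} {y} → vertex-injective {x} {y}) p i)
      In-vertex⁻ {x} {y} {p} refl refl (inj₂ i) = inj₂ (next-map-injective {a = y} {x}
          (λ {x} {y} → vertex-injective {x} {y}) p i)

      side : ∀ u → vertex (splitAt N u) ≡ u
      side = join-splitAt N r

      fromSame : ∀ {u v u′ v′} → SamePair (splitAt N u) (splitAt N v) (splitAt N u′) (splitAt N v′) → SamePair u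
          v u′ v′
      fromSame {u} {v} {u′} {v′} (inj₁ (p , q)) = inj₁ (back p , back q)
        where
        back : ∀ {u v} → splitAt N u ≡ splitAt N v → u ≡ v
        back {u} {v} eq = trans (sym (side u)) (trans (cong vertex eq) (side v))
      fromSame {u} {v} {u′} {v′} (inj₂ (p , q)) = inj₂ (back p , back q)
        where
        back : ∀ {u v} → splitAt N u ≡ splitAt N v → u ≡ v
        back {u} {v} eq = trans (sym (side u)) (trans (cong vertex eq) (side v))

      sep : ∀ (e f : Edge (K (N + r))) → ¬ (e ≈ₑ f) → Any (λ p → e ∈ₑ p × ¬ (f ∈ₑ p)) paths
      sep (edge u v u≢v) (edge u′ v′ _) e≉f with separates (splitAt N u) (splitAt N v)
        (λ eq → u≢v (trans (sym (side u)) (trans (cong vertex eq) (side v)))) (e≉f ∘ fromSame)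
      ... | p , p∈ , e∈ , f∉ = lose (∈-map⁺ (map vertex) p∈)
        (In-vertex⁺ (side u) (side v) e∈ , f∉ ∘ In-vertex⁻ (side u′) (side v′))

-- Choice of D and of the parameters

module UpperBound where

  open ConsecutivePairs
  open Residues
  open DoublingOrbits
  open MergedCycle
  open TranslatedPath
  open StrongFamily
  open import Defs
  open import Data.Empty using (⊥-elim)
  open import Data.Fin.Base as Fin using (Fin; zero; suc; toℕ)
  open import Data.Fin.Properties using (toℕ-injective; injective⇒≤; toℕ<n; ¬∀⟶∃¬)
  open import Data.List.Base using (List; []; _∷_; _++_; length; map; concatMap; upTo; lookup)
  open import Data.List.Properties using (length-map; length-++; length-applyUpTo)
  open import Data.List.Membership.Propositional using (_∈_; _∉_)
  open import Data.List.Membership.Propositional.Properties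
    using (∈-++⁺ˡ; ∈-++⁺ʳ; ∈-map⁺; ∈-concatMap⁺; ∈-upTo⁺; ∈-lookup)
  import Data.List.Membership.DecPropositional as DecMembership
  open import Data.List.Relation.Unary.All as All using (All; []; _∷_)
  open import Data.List.Relation.Unary.AllPairs using ([]; _∷_)
  open import Data.List.Relation.Unary.Any as Any using (Any)
  open import Data.List.Relation.Unary.Any.Properties using (lookup-index)
  open import Data.List.Relation.Unary.Unique.Propositional using (Unique)
  open import Data.Nat.Base using (ℕ; zero; suc; _+_; _*_; _^_; _≤_; _<_; _≥_; s≤s)
  open import Data.Nat.DivMod using (_/_; _%_; m≡m%n+[m/n]*n; m%n<n; m*n/n≡m)
  open import Data.Nat.Properties
  open import Data.Nat.Tactic.RingSolver using (solve-∀)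
  open import Data.Product.Base using (∃-syntax; _×_; _,_; proj₁; proj₂)
  open import Relation.Binary.PropositionalEquality using (_≡_; _≢_; refl; sym; trans; cong; cong₂; subst)
  open import Relation.Nullary.Negation using (¬_)

  open DecMembership _≟_ using (_∈?_)

  unique-length : ∀ {n} {xs : List (Fin n)} → Unique xs → length xs ≤ n
  unique-length U = injective⇒≤ (lookup-injective U)
    where
    lookup-injective : ∀ {A : Set} {xs : List A} → Unique xs → ∀ {i j} → lookup xs i ≡ lookup xs j → i ≡ j
    lookup-injective {xs = _ ∷ _}  (_ ∷ _)  {zero}  {zero}  _  = refl
    lookup-injective {xs = _ ∷ xs} (x≢ ∷ _) {zero}  {suc j} eq = ⊥-elim
        (All.lookup x≢ (∈-lookup {xs = xs} j) eq)
    lookup-injective {xs = _ ∷ xs} (x≢ ∷ _) {suc i} {zero}  eq = ⊥-elim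
        (All.lookup x≢ (∈-lookup {xs = xs} i) (sym eq))
    lookup-injective {xs = _ ∷ _}  (_ ∷ U)  {suc i} {suc j} eq = cong suc (lookup-injective U eq)

  -- By the pigeonhole principle, `1 + length xs` consecutive numbers cannot all occur in `xs`.
  avoid : ∀ (xs : List ℕ) a → ∃[ d ] (d ∉ xs × a ≤ d × d ≤ a + length xs)
  avoid xs a with ¬∀⟶∃¬ (suc (length xs)) (λ i → a + toℕ i ∈ xs) (λ i → a + toℕ i ∈? xs) notAll
    where
    notAll : ¬ (∀ (i : Fin (suc (length xs))) → a + toℕ i ∈ xs)
    notAll all = 1+n≰n (injective⇒≤ {f = λ i → Any.index (all i)} λ {i} {j} eq →
      toℕ-injective (+-cancelˡ-≡ a (toℕ i) (toℕ j) (trans (lookup-index (all i))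
          (trans (cong (lookup xs) eq) (sym (lookup-index (all j)))))))
  ... | i , i∉ = a + toℕ i , i∉ , m≤m+n a (toℕ i) , +-monoʳ-≤ a (≤-pred (toℕ<n i))

  -- The number of short cycles is bounded in terms of `L` alone, and that of long cycles by
  -- `N / L`. So `L` is chosen large against `E` and `q` to control the long ones, and then `N`
  -- large against `mersenneProduct L` to control the short ones.
  module Counting (k′ r L E q : ℕ) (r<30 : r < 30) (3^r≤E : 3 ^ r ≤ E) (L≥ : 6000 * E + 208 * q ≤ L)
    (N≥₁ : 4 * (E * (3 + 1500 * mersenneProduct L)) < Mod.N (suc k′))
    (N≥₂ : q * (208 * mersenneProduct L + 2040) ≤ Mod.N (suc k′)) where
    open Mod (suc k′) using (N)
    open Construction k′ L using (Stage; stage)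

    S : Stage (30 * suc k′)
    -- The index is `N - 2`, so the successor in the type of `stage` is `N - 1` and every nonzero
    -- residue is covered.
    S = stage (k′ + 29 * suc k′) ≤-refl

    open Construction.Stage S
    open Conflicts k′ L S using (conflicts; length-conflicts)

    Λ : ℕ
    Λ = mersenneProduct L

    short≤Λ : short ≤ Λ
    short≤Λ = *-cancelʳ-≤ short Λ N (≤-trans short# (*-monoʳ-≤ Λ (n≤1+n _)))

    long*L≤N : long * L ≤ N
    long*L≤N = ≤-trans long# (unique-length unique)

    long≤ : ∀ c → c ≤ L → c * long ≤ N
    long≤ c c≤L = ≤-trans (*-monoˡ-≤ long c≤L) (≤-trans (≤-reflexive (*-comm L long)) long*L≤N)

    forbidden : List (Fin N)
    forbidden = map proj₁ links ++ conflicts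

    -- Every spliced cycle brings two links, and every link 24 conflicts besides its starting point:
    -- `2 * 25 = 50`.
    length-forbidden : length forbidden ≡ 50 * (short + long)
    length-forbidden = trans (length-++ (map proj₁ links)) (trans
        (cong₂ _+_ (length-map proj₁ links) length-conflicts)
      (trans (cong (λ l → l + l * 24) links#) (arith (short + long))))
      where
      arith : ∀ c → 2 * c + 2 * c * 24 ≡ 50 * c
      arith = solve-∀

    -- A forbidden number `a` is hit by `3 ^ i * D` only if `D` is the quotient of `a` by `3 ^ i`.
    -- Avoiding all quotients, divisible or not, costs at most `30 * 50` values per spliced cycle.
    quotients : ℕ → List ℕ
    quotients i = map (λ a → (toℕ a / 3 ^ i) ⦃ m^n≢0 3 i ⦄) forbidden

    quotientLists : List ℕ
    quotientLists = concatMap quotients (upTo (suc r))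

    length-quotientLists : length quotientLists ≡ suc r * (50 * (short + long))
    length-quotientLists = trans (go (upTo (suc r))) (cong (_* (50 * (short + long)))
        (length-applyUpTo (λ i → i) (suc r)))
      where
      go : ∀ is → length (concatMap quotients is) ≡ length is * (50 * (short + long))
      go []       = refl
      go (i ∷ is) = trans (length-++ (quotients i)) (trans (cong (λ m → m + length (concatMap quotients is))
          (trans (length-map (λ a → (toℕ a / 3 ^ i) ⦃ m^n≢0 3 i ⦄) forbidden) length-forbidden))
        (cong (λ m → 50 * (short + long) + m) (go is)))

    D : ℕ
    D = proj₁ (avoid quotientLists 3)

    D≥3 : 3 ≤ D
    D≥3 = proj₁ (proj₂ (proj₂ (avoid quotientLists 3)))

    D≤ : D ≤ 3 + 1500 * (short + long)
    D≤ = ≤-trans (proj₂ (proj₂ (proj₂ (avoid quotientLists 3))))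
        (+-monoʳ-≤ 3 (≤-trans (≤-reflexive length-quotientLists)
      (≤-trans (*-monoˡ-≤ (50 * (short + long)) r<30) (≤-reflexive (sym (*-assoc 30 50 (short + long)))))))

    D-fresh : ∀ {i} → i ≤ r → ∀ {a} → a ∈ forbidden → toℕ a ≢ 3 ^ i * D
    D-fresh {i} i≤r {a} a∈ eq = proj₁ (proj₂ (avoid quotientLists 3))
      (∈-concatMap⁺ quotients (Any.map (λ { refl → D∈ }) (∈-upTo⁺ (s≤s i≤r))))
      where
      D∈ : D ∈ quotients i
      D∈ = subst (_∈ quotients i) (trans (cong (λ m → (m / 3 ^ i) ⦃ m^n≢0 3 i ⦄) (trans eq (*-comm (3 ^ i) D)))
          (m*n/n≡m D (3 ^ i) ⦃ m^n≢0 3 i ⦄))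
        (∈-map⁺ (λ a → (toℕ a / 3 ^ i) ⦃ m^n≢0 3 i ⦄) a∈)

    double-< : ∀ {m} → 2 * m < N + N → m < N
    double-< {m} h = *-cancelˡ-< 2 m N (subst (2 * m <_) (cong (λ z → N + z) (sym (+-identityʳ N))) h)

    double-≤ : ∀ {m} → 2 * m ≤ N + N → m ≤ N
    double-≤ {m} h = *-cancelˡ-≤ 2 (subst (2 * m ≤_) (cong (λ z → N + z) (sym (+-identityʳ N))) h)

    -- The claim is doubled so that the contributions of the short and of the long cycles can each
    -- be compared with `N` separately: `N≥₁` serves the former, the size of `L` the latter.
    small : 2 * (3 ^ r * D) < N
    small = double-< (≤-<-trans bound (+-mono-<-≤ N≥₁ (long≤ (6000 * E)
        (≤-trans (m≤m+n (6000 * E) (208 * q)) L≥))))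
      where
      arith : ∀ E s l → 2 * (2 * (E * (3 + 1500 * (s + l)))) ≡ 4 * (E * (3 + 1500 * s)) + 6000 * E * l
      arith = solve-∀
      bound : 2 * (2 * (3 ^ r * D)) ≤ 4 * (E * (3 + 1500 * Λ)) + 6000 * E * long
      bound = ≤-trans (*-monoʳ-≤ 2 (*-monoʳ-≤ 2 (*-mono-≤ 3^r≤E
          (≤-trans D≤ (+-monoʳ-≤ 3 (*-monoʳ-≤ 1500 (+-monoˡ-≤ long short≤Λ)))))))
        (≤-reflexive (arith E Λ long))

    open SeparatingFamily k′ L r D S D≥3 small
      (λ i≤r l → D-fresh i≤r (∈-++⁺ˡ (∈-map⁺ proj₁ l))) (λ i≤r a∈ → D-fresh i≤r (∈-++⁺ʳ (map proj₁ links) a∈))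
      public using (paths; isStrongSeparating; length-paths; length-family)

    surplus : ℕ
    surplus = 2 * (length links * 26 + 2 * suc r) + r * r

    -- There are two chain paths for each of 26 bad differences per link, with two links per cycle,
    -- which gives 104. The constant is `2 * 2 * 30` for the broken edges plus `30 * 30` for the
    -- edges between extra vertices.
    surplus≤ : surplus ≤ 104 * (Λ + long) + 1020
    surplus≤ = ≤-trans (+-mono-≤ (*-monoʳ-≤ 2 (+-mono-≤ (≤-reflexive (cong (_* 26) links#)) (*-monoʳ-≤ 2 r<30)))
                                  (≤-trans (*-mono-≤ (<⇒≤ r<30) (<⇒≤ r<30)) ≤-refl))
      (≤-trans (≤-reflexive (arith (short + long))) (+-monoˡ-≤ 1020 (*-monoʳ-≤ 104 (+-monoˡ-≤ long short≤Λ))))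
      where
      arith : ∀ c → 2 * (2 * c * 26 + 2 * 30) + 30 * 30 ≡ 104 * c + 1020
      arith = solve-∀

    q*surplus≤N : q * surplus ≤ N
    q*surplus≤N = double-≤ (≤-trans (*-monoʳ-≤ 2 (*-monoʳ-≤ q surplus≤)) (≤-trans (≤-reflexive (arith q Λ long))
      (+-mono-≤ N≥₂ (long≤ (208 * q) (≤-trans (m≤n+m (208 * q) (6000 * E)) L≥)))))
      where
      arith : ∀ q s l → 2 * (q * (104 * (s + l) + 1020)) ≡ q * (208 * s + 2040) + 208 * q * l
      arith = solve-∀

    few : q * length paths ≤ q * (N + r) + (N + r)
    few = ≤-trans (*-monoʳ-≤ q (≤-trans (≤-reflexive length-paths) length-family))
      (≤-trans (≤-reflexive (*-distribˡ-+ q N surplus)) (+-mono-≤ (*-monoʳ-≤ q (m≤m+n N r))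
          (≤-trans q*surplus≤N (m≤m+n N r))))

  upperBound : ∀ q E L → 3 ^ 29 ≤ E → 6000 * E + 208 * q ≤ L →
    ∃[ N₀ ] (∀ n → n ≥ N₀ → ∃[ 𝒫 ] (IsStrongSeparating (K n) 𝒫 × q * length 𝒫 ≤ q * n + n))
  upperBound q E L 3^29≤E L≥ = 31 + (30 + T₁ + T₂) , λ { (suc n) (s≤s le) → go n le }
    where
    T₁ T₂ : ℕ
    T₁ = 4 * (E * (3 + 1500 * mersenneProduct L))
    T₂ = q * (208 * mersenneProduct L + 2040)

    Goal : ℕ → Set
    Goal n = ∃[ 𝒫 ] (IsStrongSeparating (K n) 𝒫 × q * length 𝒫 ≤ q * n + n)

    go : ∀ n → 30 + (30 + T₁ + T₂) ≤ n → Goal (suc n)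
    go n le = decompose (n / 30) (n % 30) (m%n<n n 30) (trans (m≡m%n+[m/n]*n n 30)
        (trans (+-comm (n % 30) _) (cong (_+ n % 30) (*-comm (n / 30) 30))))
      where
      decompose : ∀ m r → r < 30 → n ≡ 30 * m + r → Goal (suc n)
      decompose zero    r r<30 eq = ⊥-elim (<⇒≱ r<30 (≤-trans (≤-trans (m≤m+n 30 _) le) (≤-reflexive eq)))
      decompose (suc k′) r r<30 eq = subst Goal (cong suc (sym eq)) (paths , isStrongSeparating , few)
        where
        30+T≤ : 30 + T₁ + T₂ ≤ 30 * suc k′
        30+T≤ = +-cancelʳ-≤ r _ _ (≤-trans (+-monoʳ-≤ (30 + T₁ + T₂) (<⇒≤ r<30))
            (≤-trans (≤-reflexive (+-comm (30 + T₁ + T₂) 30)) (≤-trans le (≤-reflexive eq))))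
        open Counting k′ r L E q r<30 (≤-trans (^-monoʳ-≤ 3 (≤-pred r<30)) 3^29≤E) L≥
          (s≤s (≤-trans (m≤n+m T₁ 30) (≤-trans (m≤m+n (30 + T₁) T₂) 30+T≤)))
          (≤-trans (m≤n+m T₂ (30 + T₁)) (≤-trans 30+T≤ (n≤1+n _)))

  abstract
    almostOptimal : ∀ q → ∃[ N₀ ] (∀ n → n ≥ N₀ → ∃[ 𝒫 ] (IsStrongSeparating (K n) 𝒫 × q * length 𝒫 ≤ q * n +
        n))
    almostOptimal q = upperBound q (3 ^ 29) (6000 * 3 ^ 29 + 208 * q) ≤-refl ≤-refl

-- From the two bounds to the relative error

module Asymptotic where

  open LowerBound
  open UpperBound
  open import Defs
  import Data.Integer.Base as ℤ
  open import Data.Integer.Base using (ℤ; +_; -[1+_])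
  import Data.Integer.Properties as ℤ
  import Data.Integer.Tactic.RingSolver as ℤSolver
  open import Data.List.Base using ([]; length)
  open import Data.List.Relation.Unary.All using ([])
  open import Data.Nat.Base using (ℕ; zero; suc; _+_; _*_; _∸_; _≤_; _<_; _≥_; z≤n; s≤s; z<s)
  open import Data.Nat.Properties
  open import Data.Product.Base using (∃-syntax; _,_)
  import Data.Rational.Base as ℚ
  open import Data.Rational.Base using (ℚ; mkℚ; 0ℚ; 1ℚ; toℚᵘ)
  import Data.Rational.Properties as ℚ
  import Data.Rational.Unnormalised.Base as ℚᵘ
  open import Data.Rational.Unnormalised.Base using (ℚᵘ; mkℚᵘ; *≡*; *<*; _≃_)
  import Data.Rational.Unnormalised.Properties as ℚᵘ
  open import Relation.Binary.PropositionalEquality using (_≡_; sym; trans; cong; subst)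
  open import Relation.Nullary.Decidable using (yes; no)

  module Asymptotics (sspK : ℕ → ℕ) (isSsp : ∀ n → IsSsp (K n) (sspK n)) where

    sspK-≤ : ∀ n 𝒫 → IsStrongSeparating (K n) 𝒫 → sspK n ≤ length 𝒫
    sspK-≤ n = IsSsp.minimal (isSsp n)

    ≤-sspK : ∀ m → 2 + m ≤ sspK (3 + m)
    ≤-sspK m with 𝒫 , eq , isSep ← IsSsp.attained (isSsp (3 + m)) = subst (2 + m ≤_) eq (lowerBound m 𝒫 isSep)

    sspK-zero : sspK 0 ≡ 0
    sspK-zero = n≤0⇒n≡0 (sspK-≤ 0 [] (strongSeparating [] λ { (edge () _ _) }))

    -- The lower bound leaves only the value `n - 1` below `n`, where the distance is 1 and `q ≤ n`
    -- suffices. From `n` upwards the constructed family bounds the excess.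
    sspK-asymptotic : ∀ q → ∃[ N₀ ] (∀ n → n ≥ N₀ → q * ℤ.∣ sspK n ℤ.⊖ n ∣ ≤ n)
    sspK-asymptotic q with almostOptimal q
    ... | N₀ , small = 3 + N₀ + q , bound
      where
      bound : ∀ n → n ≥ 3 + N₀ + q → q * ℤ.∣ sspK n ℤ.⊖ n ∣ ≤ n
      bound (suc (suc (suc m))) (s≤s (s≤s (s≤s le))) with small (3 + m)
          (≤-trans (≤-trans (m≤m+n N₀ q) le) (m≤n+m m 3)) | 3 + m ≤? sspK (3 + m)
      ... | 𝒫 , isSep , few | yes n≤s = ≤-trans (≤-reflexive (cong (q *_) (cong ℤ.∣_∣ (ℤ.⊖-≥ n≤s))))
          (≤-trans (≤-reflexive (*-distribˡ-∸ q (sspK (3 + m)) (3 + m)))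
            (≤-trans (∸-monoˡ-≤ (q * (3 + m)) (≤-trans (*-monoʳ-≤ q (sspK-≤ (3 + m) 𝒫 isSep)) few))
                (≤-reflexive (m+n∸m≡n (q * (3 + m)) (3 + m)))))
      ... | _ | no n≰s = ≤-trans (≤-reflexive (cong (q *_) (trans (cong (λ s → ℤ.∣ s ℤ.⊖ (3 + m) ∣) s≡)
          (distance (2 + m))))) (≤-trans (≤-reflexive (*-identityʳ q))
              (≤-trans (m≤n+m q N₀) (≤-trans le (m≤n+m m 3))))
        where
        s≡ : sspK (3 + m) ≡ 2 + m
        s≡ = ≤-antisym (≤-pred (≰⇒> n≰s)) (≤-sspK m)
        distance : ∀ m → ℤ.∣ m ℤ.⊖ suc m ∣ ≡ 1
        distance m = trans (cong ℤ.∣_∣ (ℤ.⊖-< (n<1+n m))) (trans (ℤ.∣-i∣≡∣i∣ (+ (suc m ∸ m))) (m+n∸n≡m 1 m))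

    -- The value at 0 is arbitrary, since both `sspK 0` and the factor `fromℕ 0` vanish.
    relativeError : ℕ → ℚ
    relativeError zero        = 0ℚ
    relativeError n@(suc _)   = (sspK n ℤ.⊖ n) ℚ./ n

    toℚᵘ-/ : ∀ z n → toℚᵘ (z ℚ./ suc n) ≃ mkℚᵘ z n
    toℚᵘ-/ z n = ℚ.toℚᵘ-fromℚᵘ (mkℚᵘ z n)

    relativeError-spec : ∀ n → fromℕ (sspK n) ≡ (1ℚ ℚ.+ relativeError n) ℚ.* fromℕ n
    relativeError-spec zero    = trans (cong fromℕ sspK-zero) (sym (ℚ.*-zeroʳ (1ℚ ℚ.+ 0ℚ)))
    relativeError-spec n@(suc m) = ℚ.toℚᵘ-injective (begin
      toℚᵘ (fromℕ s)                                        ≈⟨ toℚᵘ-/ (+ s) 0 ⟩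
      mkℚᵘ (+ s) 0                                          ≈⟨ *≡*
          (trans (cong (ℤ._* (ℤ.1ℤ ℤ.* + n ℤ.* ℤ.1ℤ)) s≡) (identity (+ n) (s ℤ.⊖ n))) ⟩
      (mkℚᵘ ℤ.1ℤ 0 ℚᵘ.+ mkℚᵘ (s ℤ.⊖ n) m) ℚᵘ.* mkℚᵘ (+ n) 0 ≈⟨ ℚᵘ.*-cong
          (ℚᵘ.+-congʳ (mkℚᵘ ℤ.1ℤ 0) (ℚᵘ.≃-sym (toℚᵘ-/ (s ℤ.⊖ n) m))) (ℚᵘ.≃-sym (toℚᵘ-/ (+ n) 0)) ⟩
      (toℚᵘ 1ℚ ℚᵘ.+ toℚᵘ δ) ℚᵘ.* toℚᵘ (fromℕ n)             ≈⟨ ℚᵘ.*-congʳ (ℚᵘ.≃-sym (ℚ.toℚᵘ-homo-+ 1ℚ δ)) ⟩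
      toℚᵘ (1ℚ ℚ.+ δ) ℚᵘ.* toℚᵘ (fromℕ n)                   ≈⟨ ℚᵘ.≃-sym (ℚ.toℚᵘ-homo-* (1ℚ ℚ.+ δ) (fromℕ n)) ⟩
      toℚᵘ ((1ℚ ℚ.+ δ) ℚ.* fromℕ n)                         ∎)
      where
      open ℚᵘ.≃-Reasoning
      s = sspK n
      δ = relativeError n
      s≡ : + s ≡ + n ℤ.+ (s ℤ.⊖ n)
      s≡ = trans (sym (shift (+ n) (+ s))) (cong (λ i → + n ℤ.+ i) (ℤ.m-n≡m⊖n s n))
        where
        shift : ∀ a b → a ℤ.+ (b ℤ.- a) ≡ b
        shift = ℤSolver.solve-∀
      identity : ∀ n z → (n ℤ.+ z) ℤ.* (ℤ.1ℤ ℤ.* n ℤ.* ℤ.1ℤ) ≡ (ℤ.1ℤ ℤ.* n ℤ.+ z ℤ.* ℤ.1ℤ) ℤ.* n ℤ.* ℤ.1ℤ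
      identity = ℤSolver.solve-∀

    relativeError-small : IsLittleO1 relativeError
    relativeError-small (mkℚ (+ zero) d _)   (ℚ.*<* (ℤ.+<+ ()))
    relativeError-small (mkℚ -[1+ p ] d _)   (ℚ.*<* ())
    -- For `ε = (p + 1) / (d + 1)` the choice `q = d + 2` bounds the error by `1 / (d + 2)`,
    -- strictly below `1 / (d + 1)` and so below `ε`.
    relativeError-small ε@(mkℚ (+ suc p) d _) _ with sspK-asymptotic (2 + d)
    ... | N₀ , close = suc N₀ , λ { n@(suc m) (s≤s le) → small m (close n (m≤n⇒m≤1+n le)) }
      where
      small : ∀ m → (2 + d) * ℤ.∣ sspK (suc m) ℤ.⊖ suc m ∣ ≤ suc m → ℚ.∣ relativeError (suc m) ∣ ℚ.< ε
      small m h = ℚ.toℚᵘ-cancel-< (ℚᵘ.<-respˡ-≃ (ℚᵘ.≃-sym (ℚᵘ.≃-trans (ℚ.toℚᵘ-homo-∣-∣ (relativeError (suc m)))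
          (ℚᵘ.∣-∣-cong (toℚᵘ-/ z m))))
        (*<* (subst (ℤ._< + suc p ℤ.* + suc m) (ℤ.pos-* ℤ.∣ z ∣ (suc d))
            (subst (+ (ℤ.∣ z ∣ * suc d) ℤ.<_) (ℤ.pos-* (suc p) (suc m)) (ℤ.+<+ strict)))))
        where
        z = sspK (suc m) ℤ.⊖ suc m
        less : ∀ a → (2 + d) * a ≤ suc m → a * suc d < suc m
        less zero    _ = z<s
        less (suc a) h = <-≤-trans (≤-trans (≤-reflexive (cong suc (*-comm (suc a) (suc d))))
            (+-monoˡ-≤ (suc d * suc a) (s≤s (z≤n {a})))) h
        strict : ℤ.∣ z ∣ * suc d < suc p * suc m
        strict = <-≤-trans (less ℤ.∣ z ∣ h) (m≤n*m (suc m) (suc p))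

open import Defs
open import Data.Nat.Base using (ℕ)
open import Data.Product.Base using (∃; _×_; _,_)
open import Data.Rational.Base using (ℚ; 1ℚ; _+_; _*_)
open import Relation.Binary.PropositionalEquality using (_≡_)

theorem1p1 : ∃ λ (δ : ℕ → ℚ) →
    IsLittleO1 δ × (∀ (n : ℕ) → fromℕ (ssp (K n)) ≡ (1ℚ + δ n) * fromℕ n)
theorem1p1 = relativeError , relativeError-small , relativeError-spec
  where open Asymptotic.Asymptotics (λ n → ssp (K n)) (λ n → ssp-isSsp (K n))
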